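{- Let $\lambda,\mu,\nu$ be partitions of $l$, $m$, $l+m$ respectively. Let $(x_1,x_2)$, $(y_1,y_2)$, $(w_1,w_2)$ be complementary pairs of words (of lengths $l$, $m$, $l+m$) corresponding to $\lambda,\mu,\nu$ respectively. Let $L$ be the Littlewood-Richardson matrix: its rows are indexed by triples $(p,q,r)$ where $p,q,r$ are rearrangements of $x_1,y_1,w_1$ respectively, its columns are indexed by triples $(s,t,u)$ where $s,t,u$ are rearrangements of $x_2,y_2,w_2$ respectively, and its $((p,q,r),(s,t,u))$ entry is $$\sum_{\sigma\times\tau\in S_l\times S_m}\mathrm{Y}_{x_2,x_1}(\sigma s,p)\cdot\mathrm{Y}_{y_2,y_1}(\tau t,q)\cdot\mathrm{Y}_{w_2,w_1}((\sigma\times\tau)u,r).$$ Then the dimension of the Littlewood-Richardson polytope, i.e. the convex hull of the columns of $L$ in the real vector space with coordinates indexed by the rows of $L$, equals the Littlewood-Richardson coefficient $$c_{\lambda\mu}^{\nu}=\dim\,\bigl((V(\lambda)\boxtimes V(\mu))\otimes \mathrm{Res}^{S_{l+m}}_{S_l\times S_m}V(\nu)\bigr)^{S_l\times S_m}.$$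
   Context: A word of length $n$ is a sequence of $n$ letters; $S_n$ acts on words of length $n$ by permuting positions, $(\sigma w)_i=w_{\sigma^{ -1}(i)}$. A rearrangement of $w$ is an element of its $S_n$-orbit. Words $w_1,w_2$ of the same length $n$ have complementary rearrangements if the diagonal action of $S_n$ on $\{\text{rearrangements of }w_1\}\times\{\text{rearrangements of }w_2\}$ has exactly one free orbit (an orbit whose points have trivial stabilizer); they are complementary if moreover $(w_1,w_2)$ lies in that free orbit. A complementary pair $(w_1,w_2)$ corresponds to the partition $\lambda$ of $n$ if, for every $j\ge1$, the $j$-th most common letter of $w_1$ occurs $\lambda_j$ times in $w_1$ and the $j$-th most common letter of $w_2$ occurs $\lambda^*_j$ times in $w_2$, where $\lambda^*_j=\#\{k:\lambda_k\ge j\}$ is the conjugate partition. Such a pair exists for every $\lambda$. Young's character: for words $a,b$ of length $n$ and rearrangements $r$ of $a$ and $r'$ of $b$, $\mathrm{Y}_{a,b}(r,r')=\sum_\sigma \mathrm{sign}(\sigma)$, the sum over all $\sigma\in S_n$ with $\sigma a=r$ and $\sigma b=r'$. For a word $w$, $V(w)$ is the complex vector space with basis the rearrangements of $w$, with $S_n$ permuting the basis. The Specht matrix of a complementary pair $(w_1,w_2)$ has rows indexed by rearrangements $r_1$ of $w_1$, columns indexed by rearrangements $r_2$ of $w_2$, and entries $\mathrm{Y}_{w_1,w_2}(r_1,r_2)$. The Specht module $V(\lambda)$ is the column span of this matrix inside $V(w_1)$, for a complementary pair corresponding to $\lambda$, with $S_n$ acting by restriction of its action on $V(w_1)$; up to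 isomorphism it depends only on $\lambda$. $S_l\times S_m$ is the subgroup of $S_{l+m}$ in which $S_l$ permutes the first $l$ positions and $S_m$ the last $m$; $\sigma\times\tau$ denotes the element of $S_{l+m}$ given by $\sigma\in S_l,\tau\in S_m$. $V(\lambda)\boxtimes V(\mu)$ is the tensor product with $S_l$ acting on the first factor and $S_m$ on the second; $\mathrm{Res}$ denotes restriction of the $S_{l+m}$-action to $S_l\times S_m$; $\otimes$ carries the diagonal action of $S_l\times S_m$; the superscript denotes invariants.
   Formalization: The case where λ, μ, ν all have only parts ≤ 1 (single columns, empty included) is excluded: there L has one column, so the polytope is a point of dimension 0, while the coefficient is 1. -}

module Defs where

open import Algebra.Bundles using (CommutativeRing; Group)
import Algebra.Construct.DirectProduct as DirectProduct
import Algebra.Construct.Pointwise as Pointwise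
import Algebra.Definitions.RawMonoid as RawMonoidDefinitions
open import Algebra.Module.Bundles using (LeftModule)
open import Algebra.Module.Morphism.Structures using (module LeftModuleMorphisms)
open import Algebra.Morphism.Structures using (module GroupMorphisms)
import Algebra.Properties.CommutativeMonoid.Sum as Sum
open import Data.Bool.Base using (Bool; true; false; not; _∧_; _xor_; if_then_else_)
import Data.Bool.Properties as Bool
open import Data.Fin.Base using (Fin; zero; suc; splitAt; join; punchIn)
open import Data.Fin.Permutation as Perm using (Permutation′; _⟨$⟩ʳ_; _⟨$⟩ˡ_; _∘ₚ_)
import Data.Fin.Properties as Fin
open import Data.Integer.Base as ℤ using (ℤ; 0ℤ; +0; +[1+_]; -[1+_])
import Data.Integer.Properties as ℤ
open import Data.List.Base as List using (List; []; _∷_; length; filter)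
import Data.List.Membership.Propositional as List
open import Data.List.Relation.Unary.All using (All)
open import Data.List.Relation.Unary.Linked using (Linked)
open import Data.List.Relation.Unary.Unique.Propositional using (Unique)
open import Data.Nat.Base as ℕ using (ℕ)
import Data.Nat.ListAction as ℕ
import Data.Nat.Properties as ℕ
open import Data.Product.Base using (Σ; Σ-syntax; ∃-syntax; _×_; _,_; proj₁; proj₂)
open import Data.Rational.Base as ℚ using (ℚ; 0ℚ; 1ℚ; ½)
import Data.Rational.Properties as ℚ
open import Data.Sign.Base as Sign using (Sign)
import Data.Sign.Properties as Sign
open import Data.Sum.Base using (inj₁; inj₂)
open import Data.Sum.Function.Propositional using (_⊎-↔_)
open import Data.Vec.Base as Vec using (Vec; lookup; tabulate)
import Data.Vec.Functional as Vector
open Vector using (Vector)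
import Data.Vec.Membership.Propositional as Vec
import Data.Vec.Properties as Vec
open import Function.Base using (_∘_)
open import Function.Bundles using (_⇔_; mk⇔)
open import Function.Construct.Composition using (_↔-∘_)
open import Function.Construct.Symmetry using (↔-sym)
open import Level using (0ℓ)
open import Relation.Binary.Definitions using (DecidableEquality; tri<; tri≈; tri>)
open import Relation.Binary.PropositionalEquality as ≡ using (_≡_; _≢_)
open import Relation.Nullary.Decidable using (yes; no; does; dec-true; dec-false; does-⇔)
open import Relation.Nullary.Negation using (contradiction)

module RingIdentities (R : CommutativeRing 0ℓ 0ℓ) where
  open CommutativeRing R
  open import Algebra.Solver.Ring.NaturalCoefficients.Default commutativeSemiring
  open import Algebra.Properties.Ring ring
  open import Relation.Binary.Reasoning.Setoid setoid

  +-interchange : ∀ a b c d → (a + b) + (c + d) ≈ (a + c) + (b + d)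
  +-interchange = solve 4 (λ a b c d → (a :+ b) :+ (c :+ d) := (a :+ c) :+ (b :+ d)) refl

  telescope : ∀ a b c → a - c ≈ (a - b) + (b - c)
  telescope a b c = sym (begin
    (a - b) + (b - c)      ≈⟨ +-assoc a (- b) (b - c) ⟩
    a + (- b + (b - c))    ≈⟨ +-congˡ (+-assoc (- b) b (- c)) ⟨
    a + ((- b + b) - c)    ≈⟨ +-congˡ (+-congʳ (-‿inverseˡ b)) ⟩
    a + (0# - c)           ≈⟨ +-congˡ (+-identityˡ (- c)) ⟩
    a - c                  ∎)

  restore : ∀ a b → a ≈ (a - b) + b
  restore a b = sym (trans (+-assoc a (- b) b) (trans (+-congˡ (-‿inverseˡ b)) (+-identityʳ a)))

  +-difference : ∀ a b c d → (a + b) - (c + d) ≈ (a - c) + (b - d)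
  +-difference a b c d = trans (+-congˡ (sym (-‿+-comm c d))) (+-interchange a b (- c) (- d))

  -‿swap : ∀ a b → - (a - b) ≈ b - a
  -‿swap = ⁻¹-anti-homo‿-

  *-difference : ∀ a b c d → a * b - c * d ≈ a * (b - d) + d * (a - c)
  *-difference a b c d = begin
    a * b - c * d                          ≈⟨ telescope (a * b) (a * d) (c * d) ⟩
    (a * b - a * d) + (a * d - c * d)      ≈⟨ +-cong (x[y-z]≈xy-xz a b d) (trans (*-comm d _) ([y-z]x≈yx-zx d a c)) ⟨
    a * (b - d) + d * (a - c)              ∎

  -‿difference : ∀ a b → (- a) - (- b) ≈ - (a - b)
  -‿difference a b = -‿+-comm a (- b)

infix 4 _~_

record _~_ (s t : ℕ → ℚ) : Set where
  constructor converge
  field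
    modulus : ∀ ε → 0ℚ ℚ.< ε →
              ∃[ N ] ∀ m n → N ℕ.≤ m → N ℕ.≤ n → ℚ.∣ s m ℚ.- t n ∣ ℚ.< ε

open _~_ public

-- The index of t is independent of the index of s in `s ~ t`, so `s ~ s` says
-- that s is a Cauchy sequence.
record ℝ : Set where
  constructor _,_
  field
    seq    : ℕ → ℚ
    cauchy : seq ~ seq

open ℝ public

module RealProperties where
  private
    open RingIdentities ℚ.+-*-commutativeRing

    ½ε : ∀ {ε} → 0ℚ ℚ.< ε → 0ℚ ℚ.< ½ ℚ.* ε
    ½ε {ε} 0<ε = ≡.subst (ℚ._< ½ ℚ.* ε) (ℚ.*-zeroʳ ½) (ℚ.*-monoʳ-<-pos ½ 0<ε)

    ½ε+½ε : ∀ ε → ½ ℚ.* ε ℚ.+ ½ ℚ.* ε ≡ ε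
    ½ε+½ε ε = ≡.trans (≡.sym (ℚ.*-distribʳ-+ ε ½ ½)) (ℚ.*-identityˡ ε)

    triangle : ∀ p q r {a b ε} → p ≡ q ℚ.+ r → ℚ.∣ q ∣ ℚ.< a → ℚ.∣ r ∣ ℚ.< b →
               a ℚ.+ b ≡ ε → ℚ.∣ p ∣ ℚ.< ε
    triangle _ q r ≡.refl q<a r<b ≡.refl =
      ℚ.≤-<-trans (ℚ.∣p+q∣≤∣p∣+∣q∣ q r) (ℚ.+-mono-< q<a r<b)

    ∣-∣-comm : ∀ p q → ℚ.∣ p ℚ.- q ∣ ≡ ℚ.∣ q ℚ.- p ∣
    ∣-∣-comm p q = ≡.trans (≡.sym (ℚ.∣-p∣≡∣p∣ (p ℚ.- q))) (≡.cong ℚ.∣_∣ (-‿swap p q))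

    ⊔ˡ : ∀ M N {m} → M ℕ.⊔ N ℕ.≤ m → M ℕ.≤ m
    ⊔ˡ M N = ℕ.≤-trans (ℕ.m≤m⊔n M N)

    ⊔ʳ : ∀ M N {m} → M ℕ.⊔ N ℕ.≤ m → N ℕ.≤ m
    ⊔ʳ M N = ℕ.≤-trans (ℕ.m≤n⊔m M N)

  ~-sym : ∀ {s t} → s ~ t → t ~ s
  ~-sym {s} {t} (converge s~t) = converge λ ε 0<ε →
    let N , f = s~t ε 0<ε in N , λ m n N≤m N≤n →
    ≡.subst (ℚ._< ε) (∣-∣-comm (s n) (t m)) (f n m N≤n N≤m)

  ~-trans : ∀ {s t u} → s ~ t → t ~ u → s ~ u
  ~-trans {s} {t} {u} (converge s~t) (converge t~u) = converge λ ε 0<ε →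
    let M , f = s~t _ (½ε 0<ε)
        N , g = t~u _ (½ε 0<ε)
    in M ℕ.⊔ N , λ m n p q →
      triangle (s m ℚ.- u n) (s m ℚ.- t (M ℕ.⊔ N)) (t (M ℕ.⊔ N) ℚ.- u n)
        (telescope (s m) (t (M ℕ.⊔ N)) (u n))
        (f m _ (⊔ˡ M N p) (ℕ.m≤m⊔n M N)) (g _ n (ℕ.m≤n⊔m M N) (⊔ʳ M N q))
        (½ε+½ε ε)

  ≗⇒~ : ∀ {s t} → s ~ s → (∀ n → s n ≡ t n) → s ~ t
  ≗⇒~ {s} (converge s~s) s≗t = converge λ ε 0<ε →
    let N , f = s~s ε 0<ε in N , λ m n N≤m N≤n →
    ≡.subst (λ q → ℚ.∣ s m ℚ.- q ∣ ℚ.< ε) (s≗t n) (f m n N≤m N≤n)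

  const-~ : ∀ q → (λ _ → q) ~ (λ _ → q)
  const-~ q = converge λ ε 0<ε → 0 , λ _ _ _ _ →
    ≡.subst (ℚ._< ε) (≡.sym (≡.cong ℚ.∣_∣ (ℚ.+-inverseʳ q))) 0<ε

  +-cong : ∀ {s s′ t t′} → s ~ s′ → t ~ t′ →
           (λ n → s n ℚ.+ t n) ~ (λ n → s′ n ℚ.+ t′ n)
  +-cong {s} {s′} {t} {t′} (converge s~s′) (converge t~t′) = converge λ ε 0<ε →
    let M , f = s~s′ _ (½ε 0<ε)
        N , g = t~t′ _ (½ε 0<ε)
    in M ℕ.⊔ N , λ m n p q →
      triangle ((s m ℚ.+ t m) ℚ.- (s′ n ℚ.+ t′ n)) (s m ℚ.- s′ n) (t m ℚ.- t′ n)
        (+-difference (s m) (t m) (s′ n) (t′ n))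
        (f m n (⊔ˡ M N p) (⊔ˡ M N q)) (g m n (⊔ʳ M N p) (⊔ʳ M N q))
        (½ε+½ε ε)

  -‿cong : ∀ {s t} → s ~ t → (λ n → ℚ.- s n) ~ (λ n → ℚ.- t n)
  -‿cong {s} {t} (converge s~t) = converge λ ε 0<ε →
    let N , f = s~t ε 0<ε in N , λ m n N≤m N≤n → ≡.subst (ℚ._< ε)
    (≡.trans (≡.sym (ℚ.∣-p∣≡∣p∣ (s m ℚ.- t n)))
             (≡.cong ℚ.∣_∣ (≡.sym (-‿difference (s m) (t n)))))
    (f m n N≤m N≤n)

  private
    record EventuallyBounded (s : ℕ → ℚ) : Set where
      constructor bounded
      field
        B     : ℚ
        0<B   : 0ℚ ℚ.< B
        N     : ℕ
        bound : ∀ n → N ℕ.≤ n → ℚ.∣ s n ∣ ℚ.< B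

    ~⇒bounded : ∀ {s t} → s ~ t → EventuallyBounded s
    ~⇒bounded {s} {t} (converge s~t) with s~t 1ℚ (ℚ.positive⁻¹ 1ℚ)
    ... | N , f = bounded B (ℚ.≤-<-trans (ℚ.0≤∣p∣ (s N)) (bnd N ℕ.≤-refl)) N bnd
      where
      B : ℚ
      B = 1ℚ ℚ.+ (ℚ.∣ t N ∣ ℚ.+ 1ℚ)
      bnd : ∀ n → N ℕ.≤ n → ℚ.∣ s n ∣ ℚ.< B
      bnd n N≤n = triangle (s n) (s n ℚ.- t N) (t N)
        (restore (s n) (t N))
        (f n N N≤n ℕ.≤-refl)
        (ℚ.≤-<-trans (ℚ.≤-reflexive (≡.sym (ℚ.+-identityʳ ℚ.∣ t N ∣)))
          (ℚ.+-monoʳ-< ℚ.∣ t N ∣ (ℚ.positive⁻¹ 1ℚ)))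
        ≡.refl

    product-bound : ∀ p q {a b} → 0ℚ ℚ.< a → ℚ.∣ p ∣ ℚ.< a → ℚ.∣ q ∣ ℚ.< b →
                    ℚ.∣ p ℚ.* q ∣ ℚ.< a ℚ.* b
    product-bound p q {a} {b} 0<a p<a q<b = begin-strict
      ℚ.∣ p ℚ.* q ∣           ≡⟨ ℚ.∣p*q∣≡∣p∣*∣q∣ p q ⟩
      ℚ.∣ p ∣ ℚ.* ℚ.∣ q ∣     ≤⟨ ℚ.*-monoʳ-≤-nonNeg ℚ.∣ q ∣ {{ℚ.∣-∣-nonNeg q}} (ℚ.<⇒≤ p<a) ⟩
      a ℚ.* ℚ.∣ q ∣           <⟨ ℚ.*-monoʳ-<-pos a {{ℚ.positive 0<a}} q<b ⟩
      a ℚ.* b                 ∎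
      where open ℚ.≤-Reasoning

    divide : ∀ B → 0ℚ ℚ.< B → ∀ ε → 0ℚ ℚ.< ε → Σ[ δ ∈ ℚ ] 0ℚ ℚ.< δ × B ℚ.* δ ≡ ε
    divide B 0<B ε 0<ε = 1/B ℚ.* ε , 0<δ , (begin
      B ℚ.* (1/B ℚ.* ε)   ≡⟨ ℚ.*-assoc B 1/B ε ⟨
      (B ℚ.* 1/B) ℚ.* ε   ≡⟨ ≡.cong (ℚ._* ε) (ℚ.*-inverseʳ B {{B≢0}}) ⟩
      1ℚ ℚ.* ε            ≡⟨ ℚ.*-identityˡ ε ⟩
      ε                   ∎)
      where
      open ≡.≡-Reasoning
      B≢0 : ℚ.NonZero B
      B≢0 = ℚ.>-nonZero 0<B
      1/B : ℚ
      1/B = ℚ.1/_ B {{B≢0}}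
      0<δ : 0ℚ ℚ.< 1/B ℚ.* ε
      0<δ = ≡.subst (ℚ._< 1/B ℚ.* ε) (ℚ.*-zeroʳ 1/B)
        (ℚ.*-monoʳ-<-pos 1/B {{ℚ.1/pos⇒pos B {{ℚ.positive 0<B}}}} 0<ε)

  *-cong : ∀ {s s′ t t′} → s ~ s′ → t ~ t′ →
           (λ n → s n ℚ.* t n) ~ (λ n → s′ n ℚ.* t′ n)
  *-cong {s} {s′} {t} {t′} s~s′ t~t′ = converge λ ε 0<ε →
    let bounded B 0<B K sB = ~⇒bounded s~s′
        bounded C 0<C L tC = ~⇒bounded (~-sym t~t′)
        δ , 0<δ , Bδ = divide B 0<B (½ ℚ.* ε) (½ε 0<ε)
        η , 0<η , Cη = divide C 0<C (½ ℚ.* ε) (½ε 0<ε)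
        M , f = modulus s~s′ η 0<η
        N , g = modulus t~t′ δ 0<δ
        KL = K ℕ.⊔ L
        MN = M ℕ.⊔ N
    in KL ℕ.⊔ MN , λ m n p q →
      triangle (s m ℚ.* t m ℚ.- s′ n ℚ.* t′ n)
               (s m ℚ.* (t m ℚ.- t′ n)) (t′ n ℚ.* (s m ℚ.- s′ n))
        (*-difference (s m) (t m) (s′ n) (t′ n))
        (product-bound (s m) (t m ℚ.- t′ n) 0<B
          (sB m (⊔ˡ K L (⊔ˡ KL MN p)))
          (g m n (⊔ʳ M N (⊔ʳ KL MN p)) (⊔ʳ M N (⊔ʳ KL MN q))))
        (product-bound (t′ n) (s m ℚ.- s′ n) 0<C
          (tC n (⊔ʳ K L (⊔ˡ KL MN q)))
          (f m n (⊔ˡ M N (⊔ʳ KL MN p)) (⊔ˡ M N (⊔ʳ KL MN q))))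
        (≡.trans (≡.cong₂ ℚ._+_ Bδ Cη) (½ε+½ε ε))

ℝ-commutativeRing : CommutativeRing 0ℓ 0ℓ
ℝ-commutativeRing = record
  { Carrier = ℝ
  ; _≈_     = λ x y → seq x ~ seq y
  ; _+_     = λ x y → (λ n → seq x n ℚ.+ seq y n) , +-cong (cauchy x) (cauchy y)
  ; _*_     = λ x y → (λ n → seq x n ℚ.* seq y n) , *-cong (cauchy x) (cauchy y)
  ; -_      = λ x → (λ n → ℚ.- seq x n) , -‿cong (cauchy x)
  ; 0#      = (λ _ → 0ℚ) , const-~ 0ℚ
  ; 1#      = (λ _ → 1ℚ) , const-~ 1ℚ
  ; isCommutativeRing = record
    { isRing = record
      { +-isAbelianGroup = record
        { isGroup = record
          { isMonoid = record
            { isSemigroup = record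
              { isMagma = record
                { isEquivalence = record
                  { refl = λ {x} → cauchy x ; sym = ~-sym ; trans = ~-trans }
                ; ∙-cong = +-cong
                }
              ; assoc = λ x y z → ≗⇒~ (+-cong (+-cong (cauchy x) (cauchy y)) (cauchy z))
                  λ n → ℚ.+-assoc (seq x n) (seq y n) (seq z n)
              }
            ; identity =
                (λ x → ≗⇒~ (+-cong (const-~ 0ℚ) (cauchy x)) λ n → ℚ.+-identityˡ (seq x n))
              , (λ x → ≗⇒~ (+-cong (cauchy x) (const-~ 0ℚ)) λ n → ℚ.+-identityʳ (seq x n))
            }
          ; inverse =
              (λ x → ≗⇒~ (+-cong (-‿cong (cauchy x)) (cauchy x)) λ n → ℚ.+-inverseˡ (seq x n))
            , (λ x → ≗⇒~ (+-cong (cauchy x) (-‿cong (cauchy x))) λ n → ℚ.+-inverseʳ (seq x n))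
          ; ⁻¹-cong = -‿cong
          }
        ; comm = λ x y → ≗⇒~ (+-cong (cauchy x) (cauchy y)) λ n → ℚ.+-comm (seq x n) (seq y n)
        }
      ; *-cong = *-cong
      ; *-assoc = λ x y z → ≗⇒~ (*-cong (*-cong (cauchy x) (cauchy y)) (cauchy z))
          λ n → ℚ.*-assoc (seq x n) (seq y n) (seq z n)
      ; *-identity =
          (λ x → ≗⇒~ (*-cong (const-~ 1ℚ) (cauchy x)) λ n → ℚ.*-identityˡ (seq x n))
        , (λ x → ≗⇒~ (*-cong (cauchy x) (const-~ 1ℚ)) λ n → ℚ.*-identityʳ (seq x n))
      ; distrib =
          (λ x y z → ≗⇒~ (*-cong (cauchy x) (+-cong (cauchy y) (cauchy z)))
            λ n → ℚ.*-distribˡ-+ (seq x n) (seq y n) (seq z n))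
        , (λ x y z → ≗⇒~ (*-cong (+-cong (cauchy y) (cauchy z)) (cauchy x))
            λ n → ℚ.*-distribʳ-+ (seq x n) (seq y n) (seq z n))
      }
    ; *-comm = λ x y → ≗⇒~ (*-cong (cauchy x) (cauchy y)) λ n → ℚ.*-comm (seq x n) (seq y n)
    }
  }
  where open RealProperties

infix 4 _≤ℝ_

_≤ℝ_ : ℝ → ℝ → Set
x ≤ℝ y = ∀ ε → 0ℚ ℚ.< ε → ∃[ N ] ∀ n → N ℕ.≤ n → seq x n ℚ.< seq y n ℚ.+ ε

fromℤ : ℤ → ℝ
fromℤ i = (λ _ → i ℚ./ 1) , RealProperties.const-~ (i ℚ./ 1)

-- R[i] with i² = - 1.
module Complexification (R : CommutativeRing 0ℓ 0ℓ) where
  open CommutativeRing R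
  open import Algebra.Properties.Ring ring using (-0#≈0#; -1*x≈-x)
  open import Algebra.Solver.Ring.NaturalCoefficients.Default commutativeSemiring

  complexRing : CommutativeRing 0ℓ 0ℓ
  complexRing = record
    { Carrier = Carrier × Carrier
    ; _≈_     = λ (a , b) (c , d) → a ≈ c × b ≈ d
    ; _+_     = λ (a , b) (c , d) → a + c , b + d
    ; _*_     = λ (a , b) (c , d) → a * c - b * d , a * d + b * c
    ; -_      = λ (a , b) → - a , - b
    ; 0#      = 0# , 0#
    ; 1#      = 1# , 0#
    ; isCommutativeRing = record
      { isRing = record
        { +-isAbelianGroup = record
          { isGroup = record
            { isMonoid = record
              { isSemigroup = record
                { isMagma = record
                  { isEquivalence = record
                    { refl = refl , refl
                    ; sym = λ (p , q) → sym p , sym q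
                    ; trans = λ (p , q) (r , s) → trans p r , trans q s
                    }
                  ; ∙-cong = λ (p , q) (r , s) → +-cong p r , +-cong q s
                  }
                ; assoc = λ (a , b) (c , d) (e , f) → +-assoc a c e , +-assoc b d f
                }
              ; identity = (λ (a , b) → +-identityˡ a , +-identityˡ b)
                         , (λ (a , b) → +-identityʳ a , +-identityʳ b)
              }
            ; inverse = (λ (a , b) → -‿inverseˡ a , -‿inverseˡ b)
                      , (λ (a , b) → -‿inverseʳ a , -‿inverseʳ b)
            ; ⁻¹-cong = λ (p , q) → -‿cong p , -‿cong q
            }
          ; comm = λ (a , b) (c , d) → +-comm a c , +-comm b d
          }
        ; *-cong = λ (p , q) (r , s) →
              +-cong (*-cong p r) (-‿cong (*-cong q s))
            , +-cong (*-cong p s) (*-cong q r)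
        ; *-assoc = *-assoc′
        ; *-identity = *-identityˡ′ , λ z → trans′ (*-comm′ z 1′) (*-identityˡ′ z)
        ; distrib = distribˡ′
                  , λ x y z → trans′ (*-comm′ (y +′ z) x)
                      (trans′ (distribˡ′ x y z) (+-cong′ (*-comm′ x y) (*-comm′ x z)))
        }
      ; *-comm = *-comm′
      }
    }
    where
    _≈′_ : Carrier × Carrier → Carrier × Carrier → Set
    (a , b) ≈′ (c , d) = a ≈ c × b ≈ d
    _+′_ _*′_ : Carrier × Carrier → Carrier × Carrier → Carrier × Carrier
    (a , b) +′ (c , d) = a + c , b + d
    (a , b) *′ (c , d) = a * c - b * d , a * d + b * c
    1′ : Carrier × Carrier
    1′ = 1# , 0#
    trans′ : ∀ {x y z} → x ≈′ y → y ≈′ z → x ≈′ z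
    trans′ (p , q) (r , s) = trans p r , trans q s
    +-cong′ : ∀ {x x′ y y′} → x ≈′ x′ → y ≈′ y′ → (x +′ y) ≈′ (x′ +′ y′)
    +-cong′ (p , q) (r , s) = +-cong p r , +-cong q s
    *-comm′ : ∀ x y → (x *′ y) ≈′ (y *′ x)
    *-comm′ (a , b) (c , d) =
        +-cong (*-comm a c) (-‿cong (*-comm b d))
      , trans (+-comm (a * d) (b * c)) (+-cong (*-comm b c) (*-comm a d))
    -- The solver is one for semirings; it is given - 1# as a variable.
    minus : ∀ {x x′ y y′} → x ≈ x′ → y ≈ y′ → x - y ≈ x′ + - 1# * y′
    minus {y = y} p q = +-cong p (trans (sym (-1*x≈-x y)) (*-congˡ q))
    *-assoc′ : ∀ x y z → ((x *′ y) *′ z) ≈′ (x *′ (y *′ z))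
    *-assoc′ (a , b) (c , d) (e , f) =
        trans (minus (*-congʳ (minus refl refl)) refl)
       (trans (solve 7 (λ k a b c d e f →
          ((a :* c :+ k :* (b :* d)) :* e :+ k :* ((a :* d :+ b :* c) :* f))
          := (a :* (c :* e :+ k :* (d :* f)) :+ k :* (b :* (c :* f :+ d :* e))))
          refl (- 1#) a b c d e f)
       (sym (minus (*-congˡ (minus refl refl)) refl)))
      , trans (+-congʳ (*-congʳ (minus refl refl)))
       (trans (solve 7 (λ k a b c d e f →
          ((a :* c :+ k :* (b :* d)) :* f :+ (a :* d :+ b :* c) :* e)
          := (a :* (c :* f :+ d :* e) :+ b :* (c :* e :+ k :* (d :* f))))
          refl (- 1#) a b c d e f)
       (sym (+-congˡ (*-congˡ (minus refl refl)))))
    distribˡ′ : ∀ x y z → (x *′ (y +′ z)) ≈′ ((x *′ y) +′ (x *′ z))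
    distribˡ′ (a , b) (c , d) (e , f) =
        trans (minus refl refl)
       (trans (solve 7 (λ k a b c d e f →
          (a :* (c :+ e) :+ k :* (b :* (d :+ f)))
          := ((a :* c :+ k :* (b :* d)) :+ (a :* e :+ k :* (b :* f))))
          refl (- 1#) a b c d e f)
       (sym (+-cong (minus refl refl) (minus refl refl))))
      , solve 6 (λ a b c d e f →
          (a :* (d :+ f) :+ b :* (c :+ e))
          := ((a :* d :+ b :* c) :+ (a :* f :+ b :* e))) refl a b c d e f
    *-identityˡ′ : ∀ z → (1′ *′ z) ≈′ z
    *-identityˡ′ (a , b) =
        trans (+-cong (*-identityˡ a) (trans (-‿cong (zeroˡ b)) -0#≈0#)) (+-identityʳ a)
      , trans (+-cong (*-identityˡ b) (zeroˡ a)) (+-identityʳ b)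

ℂ-commutativeRing : CommutativeRing 0ℓ 0ℓ
ℂ-commutativeRing = Complexification.complexRing ℝ-commutativeRing

Homomorphism : (G H : Group 0ℓ 0ℓ) → (Group.Carrier G → Group.Carrier H) → Set
Homomorphism G H = GroupMorphisms.IsGroupHomomorphism (Group.rawGroup G) (Group.rawGroup H)

proj₁-homomorphism : ∀ {G H} → Homomorphism (DirectProduct.group G H) G proj₁
proj₁-homomorphism {G} = record
  { isMonoidHomomorphism = record
    { isMagmaHomomorphism = record
      { isRelHomomorphism = record { cong = proj₁ } ; homo = λ _ _ → Group.refl G }
    ; ε-homo = Group.refl G
    }
  ; ⁻¹-homo = λ _ → Group.refl G
  }

proj₂-homomorphism : ∀ {G H} → Homomorphism (DirectProduct.group G H) H proj₂
proj₂-homomorphism {H = H} = record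
  { isMonoidHomomorphism = record
    { isMagmaHomomorphism = record
      { isRelHomomorphism = record { cong = proj₂ } ; homo = λ _ _ → Group.refl H }
    ; ε-homo = Group.refl H
    }
  ; ⁻¹-homo = λ _ → Group.refl H
  }

module LinearAlgebra (R : CommutativeRing 0ℓ 0ℓ) where
  open CommutativeRing R using (_≈_; _+_; _*_; -_; 0#; 1#; ring; +-rawMonoid)
    renaming (Carrier to K)
  private module R = CommutativeRing R

  Space : Set₁
  Space = LeftModule ring 0ℓ 0ℓ

  ∣_∣ : Space → Set
  ∣_∣ = LeftModule.Carrierᴹ

  total : ∀ {n} → Vector K n → K
  total = RawMonoidDefinitions.sum +-rawMonoid

  module _ (V : Space) where
    open LeftModule V

    combination : ∀ {n} → Vector K n → Vector ∣ V ∣ n → ∣ V ∣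
    combination c v = RawMonoidDefinitions.sum +ᴹ-rawMonoid λ i → c i *ₗ v i

    Span : {I : Set} → (I → ∣ V ∣) → ∣ V ∣ → Set
    Span {I} f x = ∃[ n ] Σ[ k ∈ Vector I n ] Σ[ c ∈ Vector K n ] x ≈ᴹ combination c (f ∘ k)

    LinearlyIndependent : ∀ {n} → Vector ∣ V ∣ n → Set
    LinearlyIndependent v = ∀ c → combination c v ≈ᴹ 0ᴹ → ∀ i → c i ≈ 0#

    HasDimension : ℕ → Set
    HasDimension d = Σ[ b ∈ Vector ∣ V ∣ d ] LinearlyIndependent b × (∀ x → ∃[ c ] x ≈ᴹ combination c b)

    AffineHull : (∣ V ∣ → Set) → ∣ V ∣ → Set
    AffineHull P x = ∃[ n ] Σ[ p ∈ Vector ∣ V ∣ n ] Σ[ c ∈ Vector K n ]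
      (∀ i → P (p i)) × total c ≈ 1# × x ≈ᴹ combination c p

    AffinelyIndependent : ∀ {n} → Vector ∣ V ∣ n → Set
    AffinelyIndependent p =
      ∀ c → total c ≈ 0# → combination c p ≈ᴹ 0ᴹ → ∀ i → c i ≈ 0#

    -- The dimension of a nonempty convex set is that of its affine hull,
    -- one less than the number of points of an affine basis.
    HasAffineDimension : (∣ V ∣ → Set) → ℕ → Set
    HasAffineDimension P d = Σ[ p ∈ Vector ∣ V ∣ (ℕ.suc d) ]
      (∀ i → AffineHull P (p i)) × AffinelyIndependent p ×
      (∀ x → AffineHull P x → Σ[ c ∈ Vector K (ℕ.suc d) ] total c ≈ 1# × x ≈ᴹ combination c p)

    module _ {I : Set} (f : I → ∣ V ∣) where
      private
        ≈-span : ∀ {x y} → x ≈ᴹ y → Span f y → Span f x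
        ≈-span x≈y (n , k , c , eq) = n , k , c , ≈ᴹ-trans x≈y eq

        cons : ∀ a i {x} → Span f x → Span f (a *ₗ f i +ᴹ x)
        cons a i (n , k , c , eq) =
          ℕ.suc n , (i Vector.∷ k) , (a Vector.∷ c) , +ᴹ-congˡ eq

      Span-0 : Span f 0ᴹ
      Span-0 = 0 , (λ ()) , (λ ()) , ≈ᴹ-refl

      Span-generator : ∀ i → Span f (f i)
      Span-generator i = ≈-span
        (≈ᴹ-sym (≈ᴹ-trans (+ᴹ-identityʳ _) (*ₗ-identityˡ (f i)))) (cons 1# i Span-0)

      Span-+ : ∀ {x y} → Span f x → Span f y → Span f (x +ᴹ y)
      Span-+ (n , k , c , eq) s = ≈-span (+ᴹ-congʳ eq) (go n k c)
        where
        go : ∀ n (k : Vector I n) c → Span f (combination c (f ∘ k) +ᴹ _)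
        go ℕ.zero    k c = ≈-span (+ᴹ-identityˡ _) s
        go (ℕ.suc n) k c = ≈-span (+ᴹ-assoc _ _ _)
          (cons (c zero) (k zero) (go n (k ∘ suc) (c ∘ suc)))

      Span-* : ∀ a {x} → Span f x → Span f (a *ₗ x)
      Span-* a (n , k , c , eq) = ≈-span (*ₗ-congˡ eq) (go n k c)
        where
        go : ∀ n (k : Vector I n) c → Span f (a *ₗ combination c (f ∘ k))
        go ℕ.zero    k c = ≈-span (*ₗ-zeroʳ a) Span-0
        go (ℕ.suc n) k c = ≈-span
          (≈ᴹ-trans (*ₗ-distribˡ a _ _) (+ᴹ-congʳ (≈ᴹ-sym (*ₗ-assoc a (c zero) _))))
          (cons (a * c zero) (k zero) (go n (k ∘ suc) (c ∘ suc)))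

      Span-≈ : ∀ {x y} → x ≈ᴹ y → Span f y → Span f x
      Span-≈ = ≈-span

    record IsSubspace (P : ∣ V ∣ → Set) : Set where
      field
        ≈-closed : ∀ {x y} → x ≈ᴹ y → P y → P x
        0-closed : P 0ᴹ
        +-closed : ∀ {x y} → P x → P y → P (x +ᴹ y)
        *-closed : ∀ a {x} → P x → P (a *ₗ x)

      -‿closed : ∀ {x} → P x → P (-ᴹ x)
      -‿closed {x} p = ≈-closed (≈ᴹ-sym -1*x≈-x) (*-closed (- 1#) p)
        where
        open import Relation.Binary.Reasoning.Setoid ≈ᴹ-setoid
        -1*x≈-x : - 1# *ₗ x ≈ᴹ -ᴹ x
        -1*x≈-x = begin
          - 1# *ₗ x                       ≈⟨ +ᴹ-identityʳ _ ⟨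
          - 1# *ₗ x +ᴹ 0ᴹ                 ≈⟨ +ᴹ-congˡ (-ᴹ‿inverseʳ x) ⟨
          - 1# *ₗ x +ᴹ (x +ᴹ -ᴹ x)        ≈⟨ +ᴹ-assoc _ _ _ ⟨
          (- 1# *ₗ x +ᴹ x) +ᴹ -ᴹ x        ≈⟨ +ᴹ-congʳ (+ᴹ-congˡ (*ₗ-identityˡ x)) ⟨
          (- 1# *ₗ x +ᴹ 1# *ₗ x) +ᴹ -ᴹ x  ≈⟨ +ᴹ-congʳ (*ₗ-distribʳ x (- 1#) 1#) ⟨
          ((- 1# + 1#) *ₗ x) +ᴹ -ᴹ x      ≈⟨ +ᴹ-congʳ (*ₗ-congʳ (R.-‿inverseˡ 1#)) ⟩
          0# *ₗ x +ᴹ -ᴹ x                 ≈⟨ +ᴹ-congʳ (*ₗ-zeroˡ x) ⟩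
          0ᴹ +ᴹ -ᴹ x                      ≈⟨ +ᴹ-identityˡ _ ⟩
          -ᴹ x                            ∎

    subspace : (P : ∣ V ∣ → Set) → IsSubspace P → Space
    subspace P S = record
      { Carrierᴹ = Σ ∣ V ∣ P
      ; _≈ᴹ_ = λ x y → proj₁ x ≈ᴹ proj₁ y
      ; _+ᴹ_ = λ (x , p) (y , q) → x +ᴹ y , +-closed p q
      ; _*ₗ_ = λ a (x , p) → a *ₗ x , *-closed a p
      ; 0ᴹ   = 0ᴹ , 0-closed
      ; -ᴹ_  = λ (x , p) → -ᴹ x , -‿closed p
      ; isLeftModule = record
        { isLeftSemimodule = record
          { +ᴹ-isCommutativeMonoid = record
            { isMonoid = record
              { isSemigroup = record
                { isMagma = record
                  { isEquivalence = record
                    { refl = ≈ᴹ-refl ; sym = ≈ᴹ-sym ; trans = ≈ᴹ-trans }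
                  ; ∙-cong = +ᴹ-cong
                  }
                ; assoc = λ (x , _) (y , _) (z , _) → +ᴹ-assoc x y z
                }
              ; identity = (λ (x , _) → +ᴹ-identityˡ x) , (λ (x , _) → +ᴹ-identityʳ x)
              }
            ; comm = λ (x , _) (y , _) → +ᴹ-comm x y
            }
          ; isPreleftSemimodule = record
            { *ₗ-cong      = *ₗ-cong
            ; *ₗ-zeroˡ     = λ (x , _) → *ₗ-zeroˡ x
            ; *ₗ-distribʳ  = λ (x , _) → *ₗ-distribʳ x
            ; *ₗ-identityˡ = λ (x , _) → *ₗ-identityˡ x
            ; *ₗ-assoc     = λ a b (x , _) → *ₗ-assoc a b x
            ; *ₗ-zeroʳ     = *ₗ-zeroʳ
            ; *ₗ-distribˡ  = λ a (x , _) (y , _) → *ₗ-distribˡ a x y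
            }
          }
        ; -ᴹ‿cong    = -ᴹ‿cong
        ; -ᴹ‿inverse = (λ (x , _) → -ᴹ‿inverseˡ x) , (λ (x , _) → -ᴹ‿inverseʳ x)
        }
      }
      where open IsSubspace S

    span-isSubspace : ∀ {I} (f : I → ∣ V ∣) → IsSubspace (Span f)
    span-isSubspace f = record
      { ≈-closed = Span-≈ f ; 0-closed = Span-0 f ; +-closed = Span-+ f ; *-closed = Span-* f }

  functions : Set → Space
  functions I = record
    { Carrierᴹ = I → K
    ; _≈ᴹ_ = λ f g → ∀ i → f i ≈ g i
    ; _+ᴹ_ = λ f g i → f i + g i
    ; _*ₗ_ = λ a f i → a * f i
    ; 0ᴹ   = λ _ → 0#
    ; -ᴹ_  = λ f i → - f i
    ; isLeftModule = record
      { isLeftSemimodule = record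
        { +ᴹ-isCommutativeMonoid = Pointwise.isCommutativeMonoid I R.+-isCommutativeMonoid
        ; isPreleftSemimodule = record
          { *ₗ-cong      = λ p q i → R.*-cong p (q i)
          ; *ₗ-zeroˡ     = λ f i → R.zeroˡ (f i)
          ; *ₗ-distribʳ  = λ f a b i → R.distribʳ (f i) a b
          ; *ₗ-identityˡ = λ f i → R.*-identityˡ (f i)
          ; *ₗ-assoc     = λ a b f i → R.*-assoc a b (f i)
          ; *ₗ-zeroʳ     = λ a i → R.zeroʳ a
          ; *ₗ-distribˡ  = λ a f g i → R.distribˡ a (f i) (g i)
          }
        }
      ; -ᴹ‿cong    = λ p i → R.-‿cong (p i)
      ; -ᴹ‿inverse = (λ f i → R.-‿inverseˡ (f i)) , (λ f i → R.-‿inverseʳ (f i))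
      }
    }

  -- V ⊗ W as the vector space generated by the x ⊗ y subject to bilinearity.
  module TensorProduct (V W : Space) where
    private
      module V = LeftModule V
      module W = LeftModule W

    infix  8 _⊗_
    infixr 7 _·_
    infixl 6 _⊕_
    infix  4 _≋_

    data Tensor : Set where
      _⊗_ : ∣ V ∣ → ∣ W ∣ → Tensor
      𝟎   : Tensor
      _⊕_ : Tensor → Tensor → Tensor
      ⊖_  : Tensor → Tensor
      _·_ : K → Tensor → Tensor

    data _≋_ : Tensor → Tensor → Set where
      ≋-refl  : ∀ {t} → t ≋ t
      ≋-sym   : ∀ {t u} → t ≋ u → u ≋ t
      ≋-trans : ∀ {t u v} → t ≋ u → u ≋ v → t ≋ v

      ⊗-cong : ∀ {x x′ y y′} → x V.≈ᴹ x′ → y W.≈ᴹ y′ → x ⊗ y ≋ x′ ⊗ y′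
      ⊕-cong : ∀ {t t′ u u′} → t ≋ t′ → u ≋ u′ → t ⊕ u ≋ t′ ⊕ u′
      ⊖-cong : ∀ {t t′} → t ≋ t′ → ⊖ t ≋ ⊖ t′
      ·-cong : ∀ {a a′ t t′} → a ≈ a′ → t ≋ t′ → a · t ≋ a′ · t′

      ⊕-assoc     : ∀ t u v → (t ⊕ u) ⊕ v ≋ t ⊕ (u ⊕ v)
      ⊕-comm      : ∀ t u → t ⊕ u ≋ u ⊕ t
      ⊕-identityˡ : ∀ t → 𝟎 ⊕ t ≋ t
      ⊖-inverseˡ  : ∀ t → ⊖ t ⊕ t ≋ 𝟎
      ·-zeroˡ     : ∀ t → 0# · t ≋ 𝟎
      ·-zeroʳ     : ∀ a → a · 𝟎 ≋ 𝟎
      ·-distribˡ  : ∀ a t u → a · (t ⊕ u) ≋ a · t ⊕ a · u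
      ·-distribʳ  : ∀ t a b → (a + b) · t ≋ a · t ⊕ b · t
      ·-identityˡ : ∀ t → 1# · t ≋ t
      ·-assoc     : ∀ a b t → (a * b) · t ≋ a · (b · t)

      ⊗-distribˡ : ∀ x y z → x ⊗ (y W.+ᴹ z) ≋ x ⊗ y ⊕ x ⊗ z
      ⊗-distribʳ : ∀ x y z → (y V.+ᴹ z) ⊗ x ≋ y ⊗ x ⊕ z ⊗ x
      ⊗-scaleˡ   : ∀ a x y → (a V.*ₗ x) ⊗ y ≋ a · (x ⊗ y)
      ⊗-scaleʳ   : ∀ a x y → x ⊗ (a W.*ₗ y) ≋ a · (x ⊗ y)

    space : Space
    space = record
      { Carrierᴹ = Tensor
      ; _≈ᴹ_ = _≋_
      ; _+ᴹ_ = _⊕_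
      ; _*ₗ_ = _·_
      ; 0ᴹ   = 𝟎
      ; -ᴹ_  = ⊖_
      ; isLeftModule = record
        { isLeftSemimodule = record
          { +ᴹ-isCommutativeMonoid = record
            { isMonoid = record
              { isSemigroup = record
                { isMagma = record
                  { isEquivalence = record { refl = ≋-refl ; sym = ≋-sym ; trans = ≋-trans }
                  ; ∙-cong = ⊕-cong
                  }
                ; assoc = ⊕-assoc
                }
              ; identity = ⊕-identityˡ , λ t → ≋-trans (⊕-comm t 𝟎) (⊕-identityˡ t)
              }
            ; comm = ⊕-comm
            }
          ; isPreleftSemimodule = record
            { *ₗ-cong      = ·-cong
            ; *ₗ-zeroˡ     = ·-zeroˡ
            ; *ₗ-distribʳ  = ·-distribʳ
            ; *ₗ-identityˡ = ·-identityˡ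
            ; *ₗ-assoc     = ·-assoc
            ; *ₗ-zeroʳ     = ·-zeroʳ
            ; *ₗ-distribˡ  = ·-distribˡ
            }
          }
        ; -ᴹ‿cong    = ⊖-cong
        ; -ᴹ‿inverse = ⊖-inverseˡ , λ t → ≋-trans (⊕-comm t (⊖ t)) (⊖-inverseˡ t)
        }
      }

  IsLinear : (V W : Space) → (∣ V ∣ → ∣ W ∣) → Set
  IsLinear V W = LeftModuleMorphisms.IsLeftModuleHomomorphism
    (LeftModule.rawLeftModule V) (LeftModule.rawLeftModule W)

  module _ (V W : Space) {f : ∣ V ∣ → ∣ W ∣} where
    private
      module V = LeftModule V
      module W = LeftModule W

    -- Preservation of 0 and of negation need not be assumed.
    linear : (∀ {x y} → x V.≈ᴹ y → f x W.≈ᴹ f y) →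
             (∀ x y → f (x V.+ᴹ y) W.≈ᴹ f x W.+ᴹ f y) →
             (∀ a x → f (a V.*ₗ x) W.≈ᴹ a W.*ₗ f x) →
             IsLinear V W f
    linear cong +-homo *-homo = record
      { +ᴹ-isGroupHomomorphism = record
        { isMonoidHomomorphism = record
          { isMagmaHomomorphism = record
            { isRelHomomorphism = record { cong = cong }
            ; homo = +-homo
            }
          ; ε-homo = 0-homo
          }
        ; ⁻¹-homo = λ x → inverseˡ-unique (f (V.-ᴹ x)) (f x)
            (W.≈ᴹ-trans (W.≈ᴹ-sym (+-homo _ x)) (W.≈ᴹ-trans (cong (V.-ᴹ‿inverseˡ x)) 0-homo))
        }
      ; *ₗ-homo = *-homo
      }
      where
      open import Algebra.Properties.Group W.+ᴹ-group using (inverseˡ-unique)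
      0-homo : f V.0ᴹ W.≈ᴹ W.0ᴹ
      0-homo = W.≈ᴹ-trans (cong (V.≈ᴹ-sym (V.*ₗ-zeroˡ V.0ᴹ)))
        (W.≈ᴹ-trans (*-homo 0# V.0ᴹ) (W.*ₗ-zeroˡ (f V.0ᴹ)))

  record Representation (G : Group 0ℓ 0ℓ) : Set₁ where
    private module G = Group G
    field
      V : Space
    open LeftModule V
    field
      act        : G.Carrier → ∣ V ∣ → ∣ V ∣
      act-linear : ∀ g → IsLinear V V (act g)
      act-cong   : ∀ {g h} → g G.≈ h → ∀ x → act g x ≈ᴹ act h x
      act-ε      : ∀ x → act G.ε x ≈ᴹ x
      act-∙      : ∀ g h x → act (g G.∙ h) x ≈ᴹ act g (act h x)

    module _ (g : G.Carrier) where
      open LeftModuleMorphisms.IsLeftModuleHomomorphism (act-linear g) public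
        using () renaming (⟦⟧-cong to act-≈; +ᴹ-homo to act-+; *ₗ-homo to act-*; 0ᴹ-homo to act-0)

  module _ {G : Group 0ℓ 0ℓ} (ρ : Representation G) where
    private module G = Group G
    open Representation ρ
    open LeftModule V

    spanSubrepresentation : ∀ {I : Set} (f : I → ∣ V ∣) →
                            (∀ g i → Span V f (act g (f i))) → Representation G
    spanSubrepresentation {I} f stable = record
      { V = W
      ; act = λ g (x , s) → act g x , closed g s
      ; act-linear = λ g → linear W W (act-≈ g)
          (λ (x , _) (y , _) → act-+ g x y) (λ a (x , _) → act-* g a x)
      ; act-cong = λ g≈h (x , _) → act-cong g≈h x
      ; act-ε = λ (x , _) → act-ε x
      ; act-∙ = λ g h (x , _) → act-∙ g h x
      }
      where
      W : Space
      W = subspace V (Span V f) (span-isSubspace V f)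
      closed : ∀ g {x} → Span V f x → Span V f (act g x)
      closed g (n , k , c , eq) = Span-≈ V f (act-≈ g eq) (go n k c)
        where
        go : ∀ n (k : Vector I n) c → Span V f (act g (combination V c (f ∘ k)))
        go ℕ.zero    k c = Span-≈ V f (act-0 g) (Span-0 V f)
        go (ℕ.suc n) k c = Span-≈ V f
          (≈ᴹ-trans (act-+ g _ _) (+ᴹ-congʳ (act-* g (c zero) (f (k zero)))))
          (Span-+ V f (Span-* V f (c zero) (stable g (k zero))) (go n (k ∘ suc) (c ∘ suc)))

    Invariant : ∣ V ∣ → Set
    Invariant x = ∀ g → act g x ≈ᴹ x

    invariants : Space
    invariants = subspace V Invariant record
      { ≈-closed = λ x≈y p g → ≈ᴹ-trans (act-≈ g x≈y) (≈ᴹ-trans (p g) (≈ᴹ-sym x≈y))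
      ; 0-closed = act-0
      ; +-closed = λ p q g → ≈ᴹ-trans (act-+ g _ _) (+ᴹ-cong (p g) (q g))
      ; *-closed = λ a p g → ≈ᴹ-trans (act-* g a _) (*ₗ-congˡ (p g))
      }

  restrict : ∀ {G H φ} → Homomorphism H G φ → Representation G → Representation H
  restrict {φ = φ} hom ρ = record
    { V = V
    ; act = λ h → act (φ h)
    ; act-linear = λ h → act-linear (φ h)
    ; act-cong = λ g≈h → act-cong (⟦⟧-cong g≈h)
    ; act-ε = λ x → ≈ᴹ-trans (act-cong ε-homo x) (act-ε x)
    ; act-∙ = λ g h x → ≈ᴹ-trans (act-cong (homo g h) x) (act-∙ (φ g) (φ h) x)
    }
    where
    open Representation ρ
    open LeftModule V
    open GroupMorphisms.IsGroupHomomorphism hom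

  infixl 7 _⊗ᴿ_ _⊠_

  _⊗ᴿ_ : ∀ {G} → Representation G → Representation G → Representation G
  _⊗ᴿ_ {G} ρ π = record
    { V = space
    ; act = act
    ; act-linear = λ g → linear space space (act-≈ g) (λ _ _ → ≋-refl) (λ _ _ → ≋-refl)
    ; act-cong = act-cong
    ; act-ε = act-ε
    ; act-∙ = act-∙
    }
    where
    module G = Group G
    module ρ = Representation ρ
    module π = Representation π
    open TensorProduct ρ.V π.V

    act : G.Carrier → Tensor → Tensor
    act g (x ⊗ y) = ρ.act g x ⊗ π.act g y
    act g 𝟎       = 𝟎
    act g (t ⊕ u) = act g t ⊕ act g u
    act g (⊖ t)   = ⊖ act g t
    act g (a · t) = a · act g t

    act-≈ : ∀ g {t u} → t ≋ u → act g t ≋ act g u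
    act-≈ g ≋-refl               = ≋-refl
    act-≈ g (≋-sym p)            = ≋-sym (act-≈ g p)
    act-≈ g (≋-trans p q)        = ≋-trans (act-≈ g p) (act-≈ g q)
    act-≈ g (⊗-cong p q)         = ⊗-cong (ρ.act-≈ g p) (π.act-≈ g q)
    act-≈ g (⊕-cong p q)         = ⊕-cong (act-≈ g p) (act-≈ g q)
    act-≈ g (⊖-cong p)           = ⊖-cong (act-≈ g p)
    act-≈ g (·-cong e p)         = ·-cong e (act-≈ g p)
    act-≈ g (⊕-assoc t u v)      = ⊕-assoc _ _ _
    act-≈ g (⊕-comm t u)         = ⊕-comm _ _
    act-≈ g (⊕-identityˡ t)      = ⊕-identityˡ _
    act-≈ g (⊖-inverseˡ t)       = ⊖-inverseˡ _
    act-≈ g (·-zeroˡ t)          = ·-zeroˡ _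
    act-≈ g (·-zeroʳ a)          = ·-zeroʳ a
    act-≈ g (·-distribˡ a t u)   = ·-distribˡ a _ _
    act-≈ g (·-distribʳ t a b)   = ·-distribʳ _ a b
    act-≈ g (·-identityˡ t)      = ·-identityˡ _
    act-≈ g (·-assoc a b t)      = ·-assoc a b _
    act-≈ g (⊗-distribˡ x y z)   =
      ≋-trans (⊗-cong (LeftModule.≈ᴹ-refl ρ.V) (π.act-+ g y z)) (⊗-distribˡ _ _ _)
    act-≈ g (⊗-distribʳ x y z)   =
      ≋-trans (⊗-cong (ρ.act-+ g y z) (LeftModule.≈ᴹ-refl π.V)) (⊗-distribʳ _ _ _)
    act-≈ g (⊗-scaleˡ a x y)     =
      ≋-trans (⊗-cong (ρ.act-* g a x) (LeftModule.≈ᴹ-refl π.V)) (⊗-scaleˡ a _ _)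
    act-≈ g (⊗-scaleʳ a x y)     =
      ≋-trans (⊗-cong (LeftModule.≈ᴹ-refl ρ.V) (π.act-* g a y)) (⊗-scaleʳ a _ _)

    act-cong : ∀ {g h} → g G.≈ h → ∀ t → act g t ≋ act h t
    act-cong e (x ⊗ y) = ⊗-cong (ρ.act-cong e x) (π.act-cong e y)
    act-cong e 𝟎       = ≋-refl
    act-cong e (t ⊕ u) = ⊕-cong (act-cong e t) (act-cong e u)
    act-cong e (⊖ t)   = ⊖-cong (act-cong e t)
    act-cong e (a · t) = ·-cong R.refl (act-cong e t)

    act-ε : ∀ t → act G.ε t ≋ t
    act-ε (x ⊗ y) = ⊗-cong (ρ.act-ε x) (π.act-ε y)
    act-ε 𝟎       = ≋-refl
    act-ε (t ⊕ u) = ⊕-cong (act-ε t) (act-ε u)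
    act-ε (⊖ t)   = ⊖-cong (act-ε t)
    act-ε (a · t) = ·-cong R.refl (act-ε t)

    act-∙ : ∀ g h t → act (g G.∙ h) t ≋ act g (act h t)
    act-∙ g h (x ⊗ y) = ⊗-cong (ρ.act-∙ g h x) (π.act-∙ g h y)
    act-∙ g h 𝟎       = ≋-refl
    act-∙ g h (t ⊕ u) = ⊕-cong (act-∙ g h t) (act-∙ g h u)
    act-∙ g h (⊖ t)   = ⊖-cong (act-∙ g h t)
    act-∙ g h (a · t) = ·-cong R.refl (act-∙ g h t)

  _⊠_ : ∀ {G H} → Representation G → Representation H → Representation (DirectProduct.group G H)
  _⊠_ {G} {H} ρ π =
    restrict (proj₁-homomorphism {G} {H}) ρ ⊗ᴿ restrict (proj₂-homomorphism {G} {H}) π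

module ℝ-linear = LinearAlgebra ℝ-commutativeRing

module _ (V : ℝ-linear.Space) where
  open CommutativeRing ℝ-commutativeRing using (0#; 1#; _≈_)
  open LeftModule V

  ConvexHull : {I : Set} → (I → Carrierᴹ) → Carrierᴹ → Set
  ConvexHull {I} f x = ∃[ n ] Σ[ k ∈ Vector I n ] Σ[ c ∈ Vector ℝ n ]
    (∀ i → 0# ≤ℝ c i) × ℝ-linear.total c ≈ 1# × x ≈ᴹ ℝ-linear.combination V c (f ∘ k)

fromℤᶜ : ℤ → CommutativeRing.Carrier ℂ-commutativeRing
fromℤᶜ i = fromℤ i , CommutativeRing.0# ℝ-commutativeRing

fromℤᶜ-neg : ∀ i → let open CommutativeRing ℂ-commutativeRing in fromℤᶜ (ℤ.- i) ≈ - fromℤᶜ i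
fromℤᶜ-neg i = RealProperties.≗⇒~ (cauchy (fromℤ (ℤ.- i))) (λ _ → lemma i)
             , RealProperties.≗⇒~ (RealProperties.const-~ ℚ.0ℚ) (λ _ → ≡.refl)
  where
  lemma : ∀ i → (ℤ.- i) ℚ./ 1 ≡ ℚ.- (i ℚ./ 1)
  lemma +0       = ≡.refl
  lemma +[1+ n ] = ≡.refl
  lemma -[1+ n ] = ≡.sym (⁻¹-involutive (ℚ.normalize (ℕ.suc n) 1))
    where open import Algebra.Properties.Group ℚ.+-0-group using (⁻¹-involutive)

Perm-cong-⟨$⟩ˡ : ∀ {n} (σ τ : Permutation′ n) → σ Perm.≈ τ → ∀ i → σ ⟨$⟩ˡ i ≡ τ ⟨$⟩ˡ i
Perm-cong-⟨$⟩ˡ σ τ σ≈τ i = begin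
  σ ⟨$⟩ˡ i                        ≡⟨ Perm.inverseˡ τ ⟨
  τ ⟨$⟩ˡ (τ ⟨$⟩ʳ (σ ⟨$⟩ˡ i))       ≡⟨ ≡.cong (τ ⟨$⟩ˡ_) (σ≈τ (σ ⟨$⟩ˡ i)) ⟨
  τ ⟨$⟩ˡ (σ ⟨$⟩ʳ (σ ⟨$⟩ˡ i))       ≡⟨ ≡.cong (τ ⟨$⟩ˡ_) (Perm.inverseʳ σ) ⟩
  τ ⟨$⟩ˡ i                        ∎
  where open ≡.≡-Reasoning

-- _∘ₚ_ composes diagrammatically, so the product σ ∙ τ is τ ∘ₚ σ.
Sym : ℕ → Group 0ℓ 0ℓ
Sym n = record
  { Carrier = Permutation′ n
  ; _≈_ = Perm._≈_
  ; _∙_ = λ σ τ → τ ∘ₚ σ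
  ; ε   = Perm.id
  ; _⁻¹ = Perm.flip
  ; isGroup = record
    { isMonoid = record
      { isSemigroup = record
        { isMagma = record
          { isEquivalence = record
            { refl  = λ _ → ≡.refl
            ; sym   = λ p i → ≡.sym (p i)
            ; trans = λ p q i → ≡.trans (p i) (q i)
            }
          ; ∙-cong = λ {_} {σ′} {τ} p q i → ≡.trans (p (τ ⟨$⟩ʳ i)) (≡.cong (σ′ ⟨$⟩ʳ_) (q i))
          }
        ; assoc = λ _ _ _ _ → ≡.refl
        }
      ; identity = (λ _ _ → ≡.refl) , (λ _ _ → ≡.refl)
      }
    ; inverse = (λ σ _ → Perm.inverseˡ σ) , (λ σ _ → Perm.inverseʳ σ)
    ; ⁻¹-cong = λ {σ} {τ} → Perm-cong-⟨$⟩ˡ σ τ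
    }
  }

module _ {n : ℕ} where
  open Group (Sym n) public using () renaming (_∙_ to infixl 7 _∙_)

-- σ ∥ τ acts as σ on the first l positions and as τ on the last m.
infix 7 _∥_

_∥_ : ∀ {l m} → Permutation′ l → Permutation′ m → Permutation′ (l ℕ.+ m)
_∥_ {l} {m} σ τ = ↔-sym (Fin.+↔⊎ {l} {m}) ↔-∘ ((σ ⊎-↔ τ) ↔-∘ Fin.+↔⊎ {l} {m})

∥-homomorphism : ∀ l m → Homomorphism
  (DirectProduct.group (Sym l) (Sym m)) (Sym (l ℕ.+ m)) (λ (σ , τ) → σ ∥ τ)
∥-homomorphism l m = record
  { isMonoidHomomorphism = record
    { isMagmaHomomorphism = record
      { isRelHomomorphism = record { cong = λ { {σ , τ} {σ′ , τ′} → cong {σ} {σ′} {τ} {τ′} } }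
      ; homo = λ (σ , τ) (σ′ , τ′) → homo σ τ σ′ τ′
      }
    ; ε-homo = ε-homo
    }
  ; ⁻¹-homo = λ _ _ → ≡.refl
  }
  where
  open ≡.≡-Reasoning
  cong : ∀ {σ σ′ : Permutation′ l} {τ τ′ : Permutation′ m} →
         σ Perm.≈ σ′ × τ Perm.≈ τ′ → (σ ∥ τ) Perm.≈ (σ′ ∥ τ′)
  cong (p , q) i with splitAt l i
  ... | inj₁ j = ≡.cong (join l m ∘ inj₁) (p j)
  ... | inj₂ j = ≡.cong (join l m ∘ inj₂) (q j)
  homo : ∀ (σ : Permutation′ l) (τ : Permutation′ m) (σ′ : Permutation′ l) (τ′ : Permutation′ m) →
         ((σ ∙ σ′) ∥ (τ ∙ τ′)) Perm.≈ ((σ ∥ τ) ∙ (σ′ ∥ τ′))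
  homo σ τ σ′ τ′ i with splitAt l i
  ... | inj₁ j rewrite Fin.splitAt-join l m (inj₁ (σ′ ⟨$⟩ʳ j)) = ≡.refl
  ... | inj₂ j rewrite Fin.splitAt-join l m (inj₂ (τ′ ⟨$⟩ʳ j)) = ≡.refl
  ε-homo : (Perm.id {l} ∥ Perm.id {m}) Perm.≈ Perm.id
  ε-homo i with splitAt l i in eq
  ... | inj₁ j = ≡.trans (≡.cong (join l m) (≡.sym eq)) (Fin.join-splitAt l m i)
  ... | inj₂ j = ≡.trans (≡.cong (join l m) (≡.sym eq)) (Fin.join-splitAt l m i)

open Sum ℤ.+-0-commutativeMonoid using (sum; sum-cong-≗; sum-permute)

-- Each permutation of Fin (suc n) is insert zero j π for a unique j, the image
-- of zero, and a π that is unique up to Perm._≈_.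
sumOverSym : ∀ n → (Permutation′ n → ℤ) → ℤ
sumOverSym ℕ.zero    F = F Perm.id
sumOverSym (ℕ.suc n) F = sum λ j → sumOverSym n λ π → F (Perm.insert zero j π)

syntax sumOverSym n (λ σ → t) = ∑[ σ ∈Sym n ] t

sumOverSym-cong : ∀ n {F G : Permutation′ n → ℤ} → (∀ σ → F σ ≡ G σ) →
                  sumOverSym n F ≡ sumOverSym n G
sumOverSym-cong ℕ.zero    F≗G = F≗G Perm.id
sumOverSym-cong (ℕ.suc n) F≗G = sum-cong-≗ λ j → sumOverSym-cong n λ π → F≗G (Perm.insert zero j π)

sumOverSym-neg : ∀ n (F : Permutation′ n → ℤ) →
                 ∑[ σ ∈Sym n ] (ℤ.- F σ) ≡ ℤ.- (∑[ σ ∈Sym n ] F σ)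
sumOverSym-neg ℕ.zero    F = ≡.refl
sumOverSym-neg (ℕ.suc n) F =
  ≡.trans (sum-cong-≗ λ j → sumOverSym-neg n λ π → F (Perm.insert zero j π)) (sum-neg λ j → sumOverSym n λ π → F (Perm.insert zero j π))
  where
  sum-neg : ∀ {k} (f : Vector ℤ k) → sum (λ i → ℤ.- f i) ≡ ℤ.- sum f
  sum-neg {ℕ.zero}  f = ≡.refl
  sum-neg {ℕ.suc k} f = ≡.trans (≡.cong (λ z → (ℤ.- f zero) ℤ.+ z) (sum-neg (f ∘ suc)))
    (≡.sym (ℤ.neg-distrib-+ (f zero) (sum (f ∘ suc))))

sumOverSym-translate : ∀ n (F : Permutation′ n → ℤ) →
                       (∀ σ τ → σ Perm.≈ τ → F σ ≡ F τ) → ∀ τ →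
                       ∑[ σ ∈Sym n ] F (τ ∙ σ) ≡ ∑[ σ ∈Sym n ] F σ
sumOverSym-translate ℕ.zero    F F-cong τ = F-cong (τ ∙ Perm.id) Perm.id λ ()
sumOverSym-translate (ℕ.suc n) F F-cong τ = begin
  sum before
    ≡⟨ sum-cong-≗ {_} {before} {middle} (λ j → sumOverSym-cong n λ π →
         F-cong (τ ∙ insert₀ j π) (insert₀ (τ ⟨$⟩ʳ j) (Perm.remove j τ ∙ π)) (commute j π)) ⟩
  sum middle
    ≡⟨ sum-cong-≗ {_} {middle} {after ∘ (τ ⟨$⟩ʳ_)} (λ j →
         sumOverSym-translate n (F ∘ insert₀ (τ ⟨$⟩ʳ j))
           (λ π ρ π≈ρ → F-cong (insert₀ (τ ⟨$⟩ʳ j) π) (insert₀ (τ ⟨$⟩ʳ j) ρ)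
             (insert-cong (τ ⟨$⟩ʳ j) {π} {ρ} π≈ρ))
           (Perm.remove j τ)) ⟩
  sum (after ∘ (τ ⟨$⟩ʳ_))
    ≡⟨ sum-permute after τ ⟨
  sum after
    ∎
  where
  open ≡.≡-Reasoning
  insert₀ : Fin (ℕ.suc n) → Permutation′ n → Permutation′ (ℕ.suc n)
  insert₀ = Perm.insert zero
  before middle after : Fin (ℕ.suc n) → ℤ
  before j = ∑[ π ∈Sym n ] F (τ ∙ insert₀ j π)
  middle j = ∑[ π ∈Sym n ] F (insert₀ (τ ⟨$⟩ʳ j) (Perm.remove j τ ∙ π))
  after j = ∑[ π ∈Sym n ] F (insert₀ j π)
  insert-cong : ∀ j {π ρ : Permutation′ n} → π Perm.≈ ρ → insert₀ j π Perm.≈ insert₀ j ρ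
  insert-cong j         π≈ρ zero    = ≡.refl
  insert-cong j {π} {ρ} π≈ρ (suc i) = begin
    insert₀ j π ⟨$⟩ʳ suc i      ≡⟨ Perm.insert-punchIn zero j π i ⟩
    punchIn j (π ⟨$⟩ʳ i)        ≡⟨ ≡.cong (punchIn j) (π≈ρ i) ⟩
    punchIn j (ρ ⟨$⟩ʳ i)        ≡⟨ Perm.insert-punchIn zero j ρ i ⟨
    insert₀ j ρ ⟨$⟩ʳ suc i      ∎
  commute : ∀ j π → (τ ∙ insert₀ j π) Perm.≈ insert₀ (τ ⟨$⟩ʳ j) (Perm.remove j τ ∙ π)
  commute j π zero    = ≡.refl
  commute j π (suc i) = begin
    τ ⟨$⟩ʳ (insert₀ j π ⟨$⟩ʳ suc i)
      ≡⟨ ≡.cong (τ ⟨$⟩ʳ_) (Perm.insert-punchIn zero j π i) ⟩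
    τ ⟨$⟩ʳ punchIn j (π ⟨$⟩ʳ i)
      ≡⟨ Perm.punchIn-permute τ j (π ⟨$⟩ʳ i) ⟩
    punchIn (τ ⟨$⟩ʳ j) (Perm.remove j τ ⟨$⟩ʳ (π ⟨$⟩ʳ i))
      ≡⟨ Perm.insert-punchIn zero (τ ⟨$⟩ʳ j) (Perm.remove j τ ∙ π) i ⟨
    insert₀ (τ ⟨$⟩ʳ j) (Perm.remove j τ ∙ π) ⟨$⟩ʳ suc i
      ∎

open Sum Sign.*-commutativeMonoid using () renaming
  ( sum to product; sum-cong-≗ to product-cong; ∑-distrib-+ to product-*
  ; sum-permute to product-permute)

inversion : ∀ {n} → Permutation′ n → Fin n → Fin n → Bool
inversion σ i j = does (i Fin.<? j) ∧ does ((σ ⟨$⟩ʳ j) Fin.<? (σ ⟨$⟩ʳ i))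

-- (-1) to the number of inversions
sign : ∀ {n} → Permutation′ n → Sign
sign σ = product λ i → product λ j → if inversion σ i j then Sign.- else Sign.+

sgn : ∀ {n} → Permutation′ n → ℤ
sgn σ = sign σ ℤ.◃ 1

sign-cong : ∀ {n} {σ τ : Permutation′ n} → σ Perm.≈ τ → sign σ ≡ sign τ
sign-cong σ≈τ = product-cong λ i → product-cong λ j →
  ≡.cong₂ (λ a b → if does (i Fin.<? j) ∧ does (a Fin.<? b) then Sign.- else Sign.+) (σ≈τ j) (σ≈τ i)

± : Sign → ℤ → ℤ
± Sign.+ y = y
± Sign.- y = ℤ.- y

module SignHomomorphism where
  open ≡.≡-Reasoning

  private
    lt : ∀ {n} → Fin n → Fin n → Bool
    lt i j = does (i Fin.<? j)

    lt-irrefl : ∀ {n} (i : Fin n) → lt i i ≡ false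
    lt-irrefl i = dec-false (i Fin.<? i) (Fin.<-irrefl ≡.refl)

    lt-flip : ∀ {n} {i j : Fin n} → i ≢ j → lt j i ≡ not (lt i j)
    lt-flip {i = i} {j} i≢j with Fin.<-cmp i j
    ... | tri< i<j _ j≮i = ≡.trans (dec-false (j Fin.<? i) j≮i) (≡.cong not (≡.sym (dec-true (i Fin.<? j) i<j)))
    ... | tri≈ _ i≡j _   = contradiction i≡j i≢j
    ... | tri> i≮j _ j<i = ≡.trans (dec-true (j Fin.<? i) j<i) (≡.cong not (≡.sym (dec-false (i Fin.<? j) i≮j)))

    ⟦_⟧ : Bool → Sign
    ⟦ b ⟧ = if b then Sign.- else Sign.+

    ⟦xor⟧ : ∀ a b → ⟦ a xor b ⟧ ≡ ⟦ a ⟧ Sign.* ⟦ b ⟧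
    ⟦xor⟧ false b     = ≡.refl
    ⟦xor⟧ true  false = ≡.refl
    ⟦xor⟧ true  true  = ≡.refl

    ∏∏ : ∀ {n} → (Fin n → Fin n → Bool) → Sign
    ∏∏ h = product λ i → product λ j → ⟦ h i j ⟧

    ∏∏-cong : ∀ {n} {g h : Fin n → Fin n → Bool} → (∀ i j → g i j ≡ h i j) → ∏∏ g ≡ ∏∏ h
    ∏∏-cong p = product-cong λ i → product-cong λ j → ≡.cong ⟦_⟧ (p i j)

    ∏∏-xor : ∀ {n} (g h : Fin n → Fin n → Bool) →
             ∏∏ (λ i j → g i j xor h i j) ≡ ∏∏ g Sign.* ∏∏ h
    ∏∏-xor g h = ≡.trans
      (product-cong λ i → ≡.trans (product-cong λ j → ⟦xor⟧ (g i j) (h i j))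
        (product-* (λ j → ⟦ g i j ⟧) (λ j → ⟦ h i j ⟧)))
      (product-* (λ i → product λ j → ⟦ g i j ⟧) (λ i → product λ j → ⟦ h i j ⟧))

    ∏∏-permute : ∀ {n} (h : Fin n → Fin n → Bool) (τ : Permutation′ n) →
                 ∏∏ (λ i j → h (τ ⟨$⟩ʳ i) (τ ⟨$⟩ʳ j)) ≡ ∏∏ h
    ∏∏-permute h τ = ≡.sym (≡.trans (product-permute (λ i → product λ j → ⟦ h i j ⟧) τ)
      (product-cong λ i → product-permute (λ j → ⟦ h (τ ⟨$⟩ʳ i) j ⟧) τ))

    -- off-diagonal factors cancel in pairs
    ∏∏-symmetric : ∀ n (h : Fin n → Fin n → Bool) → (∀ i → h i i ≡ false) →
                   (∀ i j → h i j ≡ h j i) → ∏∏ h ≡ Sign.+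
    ∏∏-symmetric ℕ.zero    h diag symm = ≡.refl
    ∏∏-symmetric (ℕ.suc n) h diag symm = begin
      (⟦ h zero zero ⟧ Sign.* row) Sign.* product (λ i → ⟦ h (suc i) zero ⟧ Sign.* product λ j → ⟦ h (suc i) (suc j) ⟧)
        ≡⟨ ≡.cong₂ (λ b s → (⟦ b ⟧ Sign.* row) Sign.* s) (diag zero)
             (product-* (λ i → ⟦ h (suc i) zero ⟧) (λ i → product λ j → ⟦ h (suc i) (suc j) ⟧)) ⟩
      row Sign.* (product (λ i → ⟦ h (suc i) zero ⟧) Sign.* ∏∏ (λ i j → h (suc i) (suc j)))
        ≡⟨ ≡.cong₂ (λ s t → row Sign.* (s Sign.* t))
             (product-cong λ i → ≡.cong ⟦_⟧ (symm (suc i) zero))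
             (∏∏-symmetric n (λ i j → h (suc i) (suc j)) (diag ∘ suc) (λ i j → symm (suc i) (suc j))) ⟩
      row Sign.* (row Sign.* Sign.+)
        ≡⟨ ≡.cong (row Sign.*_) (Sign.*-identityʳ row) ⟩
      row Sign.* row
        ≡⟨ Sign.s*s≡+ row ⟩
      Sign.+
        ∎
      where
      row : Sign
      row = product λ j → ⟦ h zero (suc j) ⟧

    -- Whether σ exchanges the order of i and j.
    crosses : ∀ {n} → Permutation′ n → Fin n → Fin n → Bool
    crosses σ i j = lt i j xor lt (σ ⟨$⟩ʳ i) (σ ⟨$⟩ʳ j)

    injective : ∀ {n} (σ : Permutation′ n) {i j} → i ≢ j → σ ⟨$⟩ʳ i ≢ σ ⟨$⟩ʳ j
    injective σ i≢j p = i≢j (≡.trans (≡.sym (Perm.inverseˡ σ))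
      (≡.trans (≡.cong (σ ⟨$⟩ˡ_) p) (Perm.inverseˡ σ)))

    xor-not-not : ∀ a b → not a xor not b ≡ a xor b
    xor-not-not false false = ≡.refl
    xor-not-not false true  = ≡.refl
    xor-not-not true  false = ≡.refl
    xor-not-not true  true  = ≡.refl

    crosses-sym : ∀ {n} (σ : Permutation′ n) i j → crosses σ i j ≡ crosses σ j i
    crosses-sym σ i j with i Fin.≟ j
    ... | yes ≡.refl = ≡.refl
    ... | no  i≢j    = ≡.sym (≡.trans
      (≡.cong₂ _xor_ (lt-flip i≢j) (lt-flip (injective σ i≢j)))
      (xor-not-not (lt i j) (lt (σ ⟨$⟩ʳ i) (σ ⟨$⟩ʳ j))))

    inversion≡ : ∀ {n} (σ : Permutation′ n) i j → inversion σ i j ≡ lt i j ∧ crosses σ i j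
    inversion≡ σ i j with Fin.<-cmp i j
    ... | tri< i<j i≢j _ rewrite dec-true (i Fin.<? j) i<j = lt-flip (injective σ i≢j)
    ... | tri≈ i≮j _ _   rewrite dec-false (i Fin.<? j) i≮j = ≡.refl
    ... | tri> i≮j _ _   rewrite dec-false (i Fin.<? j) i≮j = ≡.refl

    ∧-xor : ∀ a b c → a ∧ (b xor c) ≡ (a ∧ b) xor (a ∧ c)
    ∧-xor false b c = ≡.refl
    ∧-xor true  b c = ≡.refl

    crosses-∙ : ∀ {n} (σ τ : Permutation′ n) i j →
                crosses (σ ∙ τ) i j ≡ crosses σ (τ ⟨$⟩ʳ i) (τ ⟨$⟩ʳ j) xor crosses τ i j
    crosses-∙ σ τ i j = lemma (lt i j) (lt (τ ⟨$⟩ʳ i) (τ ⟨$⟩ʳ j)) _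
      where
      lemma : ∀ a b c → a xor c ≡ (b xor c) xor (a xor b)
      lemma false false false = ≡.refl
      lemma false false true  = ≡.refl
      lemma false true  false = ≡.refl
      lemma false true  true  = ≡.refl
      lemma true  false false = ≡.refl
      lemma true  false true  = ≡.refl
      lemma true  true  false = ≡.refl
      lemma true  true  true  = ≡.refl

    *≡+⇒≡ : ∀ {s t} → s Sign.* t ≡ Sign.+ → s ≡ t
    *≡+⇒≡ {Sign.+} p = ≡.sym p
    *≡+⇒≡ {Sign.-} {Sign.-} p = ≡.refl
    *≡+⇒≡ {Sign.-} {Sign.+} ()

    -- Pairs of positions may be ordered before or after applying τ.
    reorder : ∀ {n} (σ τ : Permutation′ n) →
              ∏∏ (λ i j → lt i j ∧ crosses σ (τ ⟨$⟩ʳ i) (τ ⟨$⟩ʳ j)) ≡ sign σ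
    reorder {n} σ τ = begin
      ∏∏ (λ i j → lt i j ∧ c i j)
        ≡⟨ *≡+⇒≡ (≡.trans (≡.sym (∏∏-xor (λ i j → lt i j ∧ c i j) (λ i j → lt (τ ⟨$⟩ʳ i) (τ ⟨$⟩ʳ j) ∧ c i j)))
             (∏∏-symmetric n h diag symm)) ⟩
      ∏∏ (λ i j → lt (τ ⟨$⟩ʳ i) (τ ⟨$⟩ʳ j) ∧ c i j)
        ≡⟨ ∏∏-permute (λ i j → lt i j ∧ crosses σ i j) τ ⟩
      ∏∏ (λ i j → lt i j ∧ crosses σ i j)
        ≡⟨ ∏∏-cong (inversion≡ σ) ⟨
      sign σ
        ∎
      where
      c : Fin n → Fin n → Bool
      c i j = crosses σ (τ ⟨$⟩ʳ i) (τ ⟨$⟩ʳ j)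
      h : Fin n → Fin n → Bool
      h i j = (lt i j ∧ c i j) xor (lt (τ ⟨$⟩ʳ i) (τ ⟨$⟩ʳ j) ∧ c i j)
      factor : ∀ i j → h i j ≡ crosses τ i j ∧ c i j
      factor i j = lemma (lt i j) (lt (τ ⟨$⟩ʳ i) (τ ⟨$⟩ʳ j)) (c i j)
        where
        lemma : ∀ x y z → (x ∧ z) xor (y ∧ z) ≡ (x xor y) ∧ z
        lemma false false z     = ≡.refl
        lemma false true  z     = ≡.refl
        lemma true  false z     = Bool.xor-identityʳ z
        lemma true  true  z     = Bool.xor-same z
      diag : ∀ i → h i i ≡ false
      diag i rewrite lt-irrefl i | lt-irrefl (τ ⟨$⟩ʳ i) = ≡.refl
      symm : ∀ i j → h i j ≡ h j i
      symm i j = ≡.trans (factor i j) (≡.trans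
        (≡.cong₂ _∧_ (crosses-sym τ i j) (crosses-sym σ (τ ⟨$⟩ʳ i) (τ ⟨$⟩ʳ j)))
        (≡.sym (factor j i)))

  sign-∙ : ∀ {n} (σ τ : Permutation′ n) → sign (σ ∙ τ) ≡ sign σ Sign.* sign τ
  sign-∙ σ τ = begin
    sign (σ ∙ τ)
      ≡⟨ ∏∏-cong (λ i j → ≡.trans (inversion≡ (σ ∙ τ) i j)
           (≡.trans (≡.cong (lt i j ∧_) (crosses-∙ σ τ i j)) (∧-xor (lt i j) _ _))) ⟩
    ∏∏ (λ i j → (lt i j ∧ crosses σ (τ ⟨$⟩ʳ i) (τ ⟨$⟩ʳ j)) xor (lt i j ∧ crosses τ i j))
      ≡⟨ ∏∏-xor (λ i j → lt i j ∧ crosses σ (τ ⟨$⟩ʳ i) (τ ⟨$⟩ʳ j)) (λ i j → lt i j ∧ crosses τ i j) ⟩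
    ∏∏ (λ i j → lt i j ∧ crosses σ (τ ⟨$⟩ʳ i) (τ ⟨$⟩ʳ j)) Sign.* ∏∏ (λ i j → lt i j ∧ crosses τ i j)
      ≡⟨ ≡.cong₂ Sign._*_ (reorder σ τ) (≡.sym (∏∏-cong (inversion≡ τ))) ⟩
    sign σ Sign.* sign τ
      ∎
open SignHomomorphism public using (sign-∙)

module _ {A : Set} where

  infixr 6 _·_

  _·_ : ∀ {n} → Permutation′ n → Vec A n → Vec A n
  σ · w = tabulate λ i → lookup w (σ ⟨$⟩ˡ i)

  ·-cong : ∀ {n} (σ τ : Permutation′ n) → σ Perm.≈ τ → ∀ (w : Vec A n) → σ · w ≡ τ · w
  ·-cong σ τ σ≈τ w = Vec.tabulate-cong λ i → ≡.cong (lookup w) (Perm-cong-⟨$⟩ˡ σ τ σ≈τ i)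

  ·-id : ∀ {n} (w : Vec A n) → Perm.id · w ≡ w
  ·-id w = Vec.tabulate∘lookup w

  ·-∙ : ∀ {n} (σ τ : Permutation′ n) (w : Vec A n) → (σ ∙ τ) · w ≡ σ · τ · w
  ·-∙ σ τ w = Vec.tabulate-cong λ i →
    ≡.sym (Vec.lookup∘tabulate (λ j → lookup w (τ ⟨$⟩ˡ j)) (σ ⟨$⟩ˡ i))

  ·-flip : ∀ {n} (σ : Permutation′ n) {v w : Vec A n} → v ≡ σ · w → Perm.flip σ · v ≡ w
  ·-flip σ {w = w} ≡.refl = ≡.trans (≡.sym (·-∙ (Perm.flip σ) σ w))
    (≡.trans (·-cong (Perm.flip σ ∙ σ) Perm.id (λ _ → Perm.inverseˡ σ) w) (·-id w))

  -- The second field is irrelevant, so that rearrangements are equal as soon as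
  -- the underlying words are.
  record Rearrangement {n} (w : Vec A n) : Set where
    constructor _by_
    field
      word     : Vec A n
      .inOrbit : ∃[ σ ] σ · w ≡ word

  open Rearrangement public

  word-injective : ∀ {n} {w : Vec A n} {r s : Rearrangement w} → word r ≡ word s → r ≡ s
  word-injective ≡.refl = ≡.refl

  infixr 6 _•_

  _•_ : ∀ {n} {w : Vec A n} → Permutation′ n → Rearrangement w → Rearrangement w
  _•_ {w = w} σ (r by p) = (σ · r) by
    (σ ∙ proj₁ p , ≡.trans (·-∙ σ (proj₁ p) w) (≡.cong (σ ·_) (proj₂ p)))

  Pair : ∀ {n} → Vec A n → Vec A n → Set
  Pair w₁ w₂ = Rearrangement w₁ × Rearrangement w₂

  module _ {n} {w₁ w₂ : Vec A n} where

    TrivialStabilizer : Pair w₁ w₂ → Set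
    TrivialStabilizer (r₁ , r₂) = ∀ σ → σ • r₁ ≡ r₁ → σ • r₂ ≡ r₂ → σ Perm.≈ Perm.id

    SameOrbit : Pair w₁ w₂ → Pair w₁ w₂ → Set
    SameOrbit (r₁ , r₂) (s₁ , s₂) = ∃[ σ ] (σ • r₁ ≡ s₁ × σ • r₂ ≡ s₂)

  original : ∀ {n} (w : Vec A n) → Rearrangement w
  original w = w by (Perm.id , ·-id w)

  HaveComplementaryRearrangements : ∀ {n} → Vec A n → Vec A n → Set
  HaveComplementaryRearrangements w₁ w₂ = Σ[ r ∈ Pair w₁ w₂ ]
    TrivialStabilizer r × (∀ s → TrivialStabilizer s → SameOrbit r s)

  Complementary : ∀ {n} → Vec A n → Vec A n → Set
  Complementary w₁ w₂ = Σ[ (r , _) ∈ HaveComplementaryRearrangements w₁ w₂ ]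
    SameOrbit r (original w₁ , original w₂)

record Partition (n : ℕ) : Set where
  field
    parts      : List ℕ
    positive   : All ℕ.NonZero parts
    decreasing : Linked ℕ._≥_ parts
    total      : ℕ.sum parts ≡ n

open Partition public using (parts)

-- Entries are numbered from 0, and are 0 beyond the end of the list.
entry : List ℕ → ℕ → ℕ
entry []       _         = 0
entry (k ∷ ks) ℕ.zero    = k
entry (k ∷ ks) (ℕ.suc j) = entry ks j

-- Numbered from 0, so `conjugate λ j` is λ*_{j+1}.
conjugate : ∀ {n} → Partition n → ℕ → ℕ
conjugate p j = length (filter (ℕ.suc j ℕ.≤?_) (parts p))

-- If three partitions as in the Littlewood-Richardson rule are all single
-- columns, their matrix has only one column: the polytope is a point, although
-- the coefficient is 1.
SingleColumn : ∀ {n} → Partition n → Set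
SingleColumn p = All (ℕ._≤ 1) (parts p)

module _ {A : Set} (_≟_ : DecidableEquality A) where

  occurrences : ∀ {n} → Vec A n → A → ℕ
  occurrences w a = Vec.count (a ≟_) w

  -- For every j, the letter at position j in order of commonness occurs f j times.
  record HasMultiplicities {n} (w : Vec A n) (f : ℕ → ℕ) : Set where
    field
      letters         : List A
      distinct        : Unique letters
      complete        : ∀ a → a List.∈ letters ⇔ a Vec.∈ w
      mostCommonFirst : Linked (λ a b → occurrences w a ℕ.≥ occurrences w b) letters
      multiplicities  : ∀ j → entry (List.map (occurrences w) letters) j ≡ f j

  Corresponds : ∀ {n} → Vec A n → Vec A n → Partition n → Set
  Corresponds w₁ w₂ p =
    HasMultiplicities w₁ (entry (parts p)) × HasMultiplicities w₂ (conjugate p)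

  infix 4 _≟ʷ_

  _≟ʷ_ : ∀ {n} → DecidableEquality (Vec A n)
  _≟ʷ_ = Vec.≡-dec _≟_

  module _ {n} (a b : Vec A n) where

    young : Rearrangement a → Rearrangement b → ℤ
    young r r′ = ∑[ σ ∈Sym n ]
      (if does (σ · a ≟ʷ word r) ∧ does (σ · b ≟ʷ word r′) then sgn σ else 0ℤ)

    young-equivariant : ∀ σ r r′ → young (Perm.flip σ • r) r′ ≡
      ± (sign σ) (young r (σ • r′))
    young-equivariant σ r r′ = ≡.trans
      (sumOverSym-cong n step)
      (≡.trans (pull (sign σ)) (≡.cong (± (sign σ))
        (sumOverSym-translate n F F-cong σ)))
      where
      F : Permutation′ n → ℤ
      F τ = if does (τ · a ≟ʷ word r) ∧ does (τ · b ≟ʷ word (σ • r′)) then sgn τ else 0ℤ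

      F-cong : ∀ τ τ′ → τ Perm.≈ τ′ → F τ ≡ F τ′
      F-cong τ τ′ τ≈τ′ rewrite ·-cong τ τ′ τ≈τ′ a | ·-cong τ τ′ τ≈τ′ b | sign-cong {σ = τ} {τ′} τ≈τ′ = ≡.refl

      move : ∀ τ → does (τ · a ≟ʷ word (Perm.flip σ • r)) ≡ does ((σ ∙ τ) · a ≟ʷ word r)
      move τ = does-⇔ (mk⇔
        (λ p → ≡.trans (·-∙ σ τ a) (·-flip (Perm.flip σ) {τ · a} {word r} p))
        (λ p → ≡.sym (·-flip σ {word r} {τ · a} (≡.trans (≡.sym p) (·-∙ σ τ a)))))
        (τ · a ≟ʷ word (Perm.flip σ • r)) ((σ ∙ τ) · a ≟ʷ word r)

      move′ : ∀ τ → does (τ · b ≟ʷ word r′) ≡ does ((σ ∙ τ) · b ≟ʷ word (σ • r′))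
      move′ τ = does-⇔ (mk⇔
        (λ p → ≡.trans (·-∙ σ τ b) (≡.cong (σ ·_) {τ · b} {word r′} p))
        (λ p → ≡.trans (≡.sym (·-flip σ {σ · τ · b} {τ · b} ≡.refl))
          (·-flip σ {σ · τ · b} {word r′} (≡.trans (≡.sym (·-∙ σ τ b)) p))))
        (τ · b ≟ʷ word r′) ((σ ∙ τ) · b ≟ʷ word (σ • r′))

      signs : ∀ s t → t ℤ.◃ 1 ≡ ± s ((s Sign.* t) ℤ.◃ 1)
      signs Sign.+ t      = ≡.refl
      signs Sign.- Sign.+ = ≡.refl
      signs Sign.- Sign.- = ≡.refl

      ±-if : ∀ s c x → (if c then ± s x else 0ℤ) ≡ ± s (if c then x else 0ℤ)
      ±-if s      true  x = ≡.refl
      ±-if Sign.+ false x = ≡.refl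
      ±-if Sign.- false x = ≡.refl

      step : ∀ τ → (if does (τ · a ≟ʷ word (Perm.flip σ • r)) ∧ does (τ · b ≟ʷ word r′)
                     then sgn τ else 0ℤ) ≡ ± (sign σ) (F (σ ∙ τ))
      step τ = begin
        (if does (τ · a ≟ʷ word (Perm.flip σ • r)) ∧ does (τ · b ≟ʷ word r′) then sgn τ else 0ℤ)
          ≡⟨ ≡.cong₂ (λ c d → if c ∧ d then sgn τ else 0ℤ) (move τ) (move′ τ) ⟩
        (if C then sgn τ else 0ℤ)
          ≡⟨ ≡.cong (λ x → if C then x else 0ℤ)
               (≡.trans (signs (sign σ) (sign τ))
                 (≡.cong (λ s → ± (sign σ) (s ℤ.◃ 1)) (≡.sym (sign-∙ σ τ)))) ⟩
        (if C then ± (sign σ) (sgn (σ ∙ τ)) else 0ℤ)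
          ≡⟨ ±-if (sign σ) C (sgn (σ ∙ τ)) ⟩
        ± (sign σ) (F (σ ∙ τ))
          ∎
        where
        open ≡.≡-Reasoning
        C : Bool
        C = does ((σ ∙ τ) · a ≟ʷ word r) ∧ does ((σ ∙ τ) · b ≟ʷ word (σ • r′))

      pull : ∀ s → sumOverSym n (λ τ → ± s (F (σ ∙ τ))) ≡ ± s (sumOverSym n (λ τ → F (σ ∙ τ)))
      pull Sign.+ = ≡.refl
      pull Sign.- = sumOverSym-neg n (λ τ → F (σ ∙ τ))

  open LinearAlgebra ℂ-commutativeRing
  open CommutativeRing ℂ-commutativeRing using (_+_; _*_; refl; trans; reflexive) renaming (Carrier to ℂ)

  permutationRepresentation : ∀ {n} (w : Vec A n) → Representation (Sym n)
  permutationRepresentation {n} w = record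
    { V = V
    ; act = λ σ f r → f (Perm.flip σ • r)
    ; act-linear = λ σ → linear V V (λ p r → p (Perm.flip σ • r))
        (λ f g r → refl {f (Perm.flip σ • r) + g (Perm.flip σ • r)})
        (λ a f r → refl {a * f (Perm.flip σ • r)})
    ; act-cong = λ {σ} {τ} σ≈τ f r → reflexive (≡.cong f (word-injective
        (·-cong (Perm.flip σ) (Perm.flip τ) (Perm-cong-⟨$⟩ˡ σ τ σ≈τ) (word r))))
    ; act-ε = λ f r → reflexive (≡.cong f (word-injective (·-id (word r))))
    ; act-∙ = λ σ τ f r → reflexive (≡.cong f (word-injective
        (·-∙ (Perm.flip τ) (Perm.flip σ) (word r))))
    }
    where
    V : Space
    V = functions (Rearrangement w)

  module _ {n} (w₁ w₂ : Vec A n) where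

    spechtMatrix : Rearrangement w₁ → Rearrangement w₂ → ℤ
    spechtMatrix = young w₁ w₂

    private
      column : Rearrangement w₂ → Rearrangement w₁ → ℂ
      column r₂ r₁ = fromℤᶜ (spechtMatrix r₁ r₂)

      V : Space
      V = functions (Rearrangement w₁)

      column-stable : ∀ σ r₂ → Span V column (λ r₁ → column r₂ (Perm.flip σ • r₁))
      column-stable σ r₂ = go (sign σ) (λ r₁ → young-equivariant w₁ w₂ σ r₁ r₂)
        where
        r₂′ : Rearrangement w₂
        r₂′ = σ • r₂
        moved : Rearrangement w₁ → ℂ
        moved r₁ = column r₂ (Perm.flip σ • r₁)
        go : ∀ s → (∀ r₁ → spechtMatrix (Perm.flip σ • r₁) r₂ ≡ ± s (spechtMatrix r₁ r₂′)) →
             Span V column moved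
        go Sign.+ eq = Span-≈ V column {moved} {column r₂′}
          (λ r₁ → reflexive {moved r₁} {column r₂′ r₁} (≡.cong fromℤᶜ (eq r₁)))
          (Span-generator V column r₂′)
        go Sign.- eq = Span-≈ V column {moved} {LeftModule.-ᴹ_ V (column r₂′)}
          (λ r₁ → trans {moved r₁} {fromℤᶜ (ℤ.- spechtMatrix r₁ r₂′)} {LeftModule.-ᴹ_ V (column r₂′) r₁}
            (reflexive (≡.cong fromℤᶜ (eq r₁)))
            (fromℤᶜ-neg (spechtMatrix r₁ r₂′)))
          (IsSubspace.-‿closed (span-isSubspace V column) {column r₂′} (Span-generator V column r₂′))

    spechtModule : Representation (Sym n)
    spechtModule = spanSubrepresentation (permutationRepresentation w₁) column column-stable

  module LittlewoodRichardson {l m}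
    (x₁ x₂ : Vec A l) (y₁ y₂ : Vec A m) (w₁ w₂ : Vec A (l ℕ.+ m)) where

    Row Column : Set
    Row    = Rearrangement x₁ × Rearrangement y₁ × Rearrangement w₁
    Column = Rearrangement x₂ × Rearrangement y₂ × Rearrangement w₂

    matrix : Row → Column → ℤ
    matrix (p , q , r) (s , t , u) = ∑[ σ ∈Sym l ] ∑[ τ ∈Sym m ]
      (young x₂ x₁ (σ • s) p ℤ.* young y₂ y₁ (τ • t) q ℤ.* young w₂ w₁ ((σ ∥ τ) • u) r)

    polytope : (Row → ℝ) → Set
    polytope = ConvexHull (ℝ-linear.functions Row) λ c r → fromℤ (matrix r c)

    PolytopeHasDimension : ℕ → Set
    PolytopeHasDimension = ℝ-linear.HasAffineDimension (ℝ-linear.functions Row) polytope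

    CoefficientEquals : ℕ → Set
    CoefficientEquals = HasDimension (invariants
      ((spechtModule x₁ x₂ ⊠ spechtModule y₁ y₂) ⊗ᴿ
        restrict (∥-homomorphism l m) (spechtModule w₁ w₂)))

{-# OPTIONS --safe #-}
module Submission where

-- Let G = S_l × S_m. Applying σ to a column of a Specht matrix gives, up to sign σ, the
-- column indexed by the rearrangement moved by σ, and sign (σ ∥ τ) = sign σ sign τ; so the
-- columns of L are the sums over G of the G-orbits of the products of three Specht columns.
-- These products span V(λ) ⊗ V(μ) ⊗ V(ν), which embeds into the functions on the rows of L,
-- and averaging over G is a projection onto the invariants. Hence the columns of L span the
-- invariants, and the coefficient is the rank of L. As L is an integer matrix, Gaussian
-- elimination over ℚ gives a basis of columns together with dual functionals, valid over
-- both ℝ and ℂ. The dimension of the polytope is the rank as soon as 0 is in the affine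
-- hull of the columns. If one partition is not a single column then the first word of its
-- pair has a repeated letter, so that every rearrangement of it is fixed by an odd
-- permutation; for this reason the sum of Young's character over the rearrangements of the
-- second word vanishes, and so does a sum of columns of L.

open import Defs
open import Algebra.Bundles using (CommutativeMonoid; CommutativeRing; Group; module Semiring)
import Algebra.Construct.DirectProduct as DirectProduct
open import Algebra.Module.Bundles using (LeftModule)
open import Algebra.Module.Morphism.Structures using (module LeftModuleMorphisms)
import Algebra.Morphism.Construct.Composition as Composition
open import Algebra.Morphism.Structures using (module GroupMorphisms; module SemiringMorphisms)
import Algebra.Properties.CommutativeMonoid.Sum as Sum
import Algebra.Properties.CommutativeSemigroup
import Algebra.Properties.Ring
import Algebra.Properties.Semiring.Sum as SemiringSum
open import Data.Bool.Base using (Bool; true; false; _∧_; if_then_else_)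
import Data.Bool.Properties as Bool
open import Data.Empty using (⊥; ⊥-elim-irr)
open import Data.Fin.Base using (Fin; zero; suc; combine; remQuot; _↑ˡ_; _↑ʳ_; punchIn; punchOut; toℕ)
open import Data.Fin.Permutation as Perm using (Permutation′; _⟨$⟩ʳ_; _⟨$⟩ˡ_)
import Data.Fin.Properties as Fin
open import Data.Integer.Base as ℤ using (ℤ; 0ℤ; +0; +[1+_]; -[1+_])
import Data.Integer.Properties as ℤ
open import Data.Integer.Tactic.RingSolver using (solve-∀)
open import Data.List.Base as List using (List; []; _∷_)
open import Data.List.Relation.Unary.All as All using (All; []; _∷_)
open import Data.Nat.Base as ℕ using (ℕ; _!)
import Data.Nat.Properties as ℕ
open import Data.Product.Base using (Σ-syntax; _×_; _,_; proj₁; proj₂; ∃-syntax)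
open import Data.Product.Function.NonDependent.Propositional using (_×-↠_)
open import Data.Rational.Base as ℚ using (ℚ; 0ℚ; 1ℚ)
import Data.Rational.Properties as ℚ
import Data.Rational.Unnormalised.Base as ℚᵘ
import Data.Rational.Unnormalised.Properties as ℚᵘ
open import Data.Sign.Base as Sign using (Sign)
import Data.Sign.Properties as Sign
open import Data.Sum.Base using (_⊎_; inj₁; inj₂)
open import Data.Vec.Base using (Vec; []; _∷_; lookup)
import Data.Vec.Functional as Vector
open Vector using (Vector)
import Data.Vec.Properties as Vec
open import Function.Base using (_∘_)
open import Function.Bundles using (_↠_; mk↠ₛ; mk⇔; module Surjection)
open import Function.Construct.Composition using (_↠-∘_)
open import Function.Properties.Inverse using (↔⇒↠)
open import Level using (0ℓ)
open import Relation.Binary.Definitions using (DecidableEquality; tri<; tri≈; tri>)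
open import Relation.Binary.PropositionalEquality as ≡ using (_≡_; _≢_)
import Relation.Binary.Reasoning.Setoid as SetoidReasoning
open import Relation.Nullary.Decidable using (yes; no; does; dec-false; does-⇔)
open import Relation.Nullary.Negation using (¬_; contradiction)


-- Finite sums and matrix rank

-- Equality in ℝ and ℂ cannot be decided, so pivots could not be found there. The rank is therefore
-- computed over ℚ and recorded as a system of equations, which every ring homomorphism preserves;
-- polytope and coefficient thus get the same number from one computation. The tensor product is a
-- quotient of formal terms, so a tensor all of whose values vanish is not evidently zero: a
-- derivation in `_≋_` is required. For this reason each embedding carries an interpolation formula
-- that recovers a vector from its values at finitely many rows. For a Specht module the formula
-- comes from an inverted minor of its matrix, and the formulas of two factors multiply to one for
-- their tensor product. The point 0 matters because the affine hull of the columns is their linear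
-- span if it contains 0, and has dimension one less otherwise. A vanishing sum of columns becomes
-- an affine combination with value 0 by giving each of its n terms the weight 1/n.

module ProductSums (M : CommutativeMonoid 0ℓ 0ℓ) where
  open CommutativeMonoid M renaming (_∙_ to _+_; ∙-congˡ to +-congˡ)
  open Sum M public using (sum; sum-cong-≋; ∑-comm; ∑-distrib-+)

  sum-++ : ∀ m {n} (f : Vector Carrier (m ℕ.+ n)) → sum f ≈ sum (f ∘ (_↑ˡ n)) + sum (f ∘ (m ↑ʳ_))
  sum-++ ℕ.zero    f = sym (identityˡ _)
  sum-++ (ℕ.suc m) f = trans (+-congˡ (sum-++ m (f ∘ suc))) (sym (assoc _ _ _))

  sum-combine : ∀ m {n} (f : Vector Carrier (m ℕ.* n)) →
                sum f ≈ sum {m} (λ i → sum {n} λ j → f (combine i j))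
  sum-combine ℕ.zero        f = refl
  sum-combine (ℕ.suc m) {n} f = trans (sum-++ n f) (+-congˡ (sum-combine m (f ∘ (n ↑ʳ_))))

  sum-remQuot : ∀ {m n} (f : Fin m × Fin n → Carrier) →
                sum (f ∘ remQuot {m} n) ≈ sum {m} (λ i → sum {n} λ j → f (i , j))
  sum-remQuot {m} {n} f = trans (sum-combine m (f ∘ remQuot {m} n))
    (sum-cong-≋ λ i → sum-cong-≋ λ j → reflexive (≡.cong f (Fin.remQuot-combine {m} {n} i j)))

  sum-zero : ∀ {n} (f : Vector Carrier n) → (∀ i → f i ≈ ε) → sum f ≈ ε
  sum-zero {n} f f≈0 = trans (sum-cong-≋ f≈0) (Sum.sum-replicate-zero M n)

module MatrixRank (R : CommutativeRing 0ℓ 0ℓ) where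
  open CommutativeRing R hiding (zero)
  open SemiringSum semiring using (*-distribˡ-sum; *-distribʳ-sum)
  open ProductSums +-commutativeMonoid
  open Algebra.Properties.Ring ring using (-‿distribˡ-*; -‿distribʳ-*; x∙y⁻¹≈ε⇒x≈y)
  open SetoidReasoning setoid

  δ : ∀ {n} → Fin n → Fin n → Carrier
  δ zero    zero    = 1#
  δ zero    (suc _) = 0#
  δ (suc _) zero    = 0#
  δ (suc i) (suc j) = δ i j

  sum-δʳ : ∀ {n} (c : Vector Carrier n) i → sum (λ j → c j * δ i j) ≈ c i
  sum-δʳ c zero    = trans (+-cong (*-identityʳ _) (sum-zero (λ j → c (suc j) * 0#) λ j → zeroʳ _)) (+-identityʳ _)
  sum-δʳ c (suc i) = trans (+-cong (zeroʳ _) (sum-δʳ (c ∘ suc) i)) (+-identityˡ _)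

  δ-sym : ∀ {n} (i j : Fin n) → δ i j ≈ δ j i
  δ-sym zero    zero    = refl
  δ-sym zero    (suc _) = refl
  δ-sym (suc _) zero    = refl
  δ-sym (suc i) (suc j) = δ-sym i j

  -- Associativity of the product of a row vector, a matrix and a column vector.
  sum-bilinear : ∀ {m n} (c : Vector Carrier m) (A : Fin m → Fin n → Carrier) (f : Vector Carrier n) →
                 sum (λ a → sum (λ i → c i * A i a) * f a) ≈ sum (λ i → c i * sum (λ a → A i a * f a))
  sum-bilinear c A f = begin
    sum (λ a → sum (λ i → c i * A i a) * f a)       ≈⟨ sum-cong-≋ (λ a → *-distribʳ-sum (f a) (λ i → c i * A i a)) ⟩
    sum (λ a → sum (λ i → (c i * A i a) * f a))     ≈⟨ ∑-comm (λ a i → (c i * A i a) * f a) ⟩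
    sum (λ i → sum (λ a → (c i * A i a) * f a))     ≈⟨ sum-cong-≋ (λ i → sum-cong-≋ λ a → *-assoc (c i) (A i a) (f a)) ⟩
    sum (λ i → sum (λ a → c i * (A i a * f a)))     ≈⟨ sum-cong-≋ (λ i → *-distribˡ-sum (c i) (λ a → A i a * f a)) ⟨
    sum (λ i → c i * sum (λ a → A i a * f a))       ∎

  -- `basis` picks columns spanning all columns; `dual` inverts the square minor
  -- at the rows `point` and the columns `basis`.
  record RankFactorization {I J : Set} (M : I → J → Carrier) : Set where
    field
      rank       : ℕ
      basis      : Fin rank → J
      point      : Fin rank → I
      dual       : Fin rank → Fin rank → Carrier
      coordinate : J → Fin rank → Carrier
      dual-basis : ∀ i k → sum (λ a → dual i a * M (point a) (basis k)) ≈ δ i k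
      expansion  : ∀ x j → M x j ≈ sum (λ i → coordinate j i * M x (basis i))

  -- The decision that pivoting needs; it turns a finite list of scalars into either a proof that
  -- all vanish or an invertible entry.
  module _ (zero-or-unit : ∀ x → x ≈ 0# ⊎ ∃[ y ] y * x ≈ 1#) where

    private
      zero-or-unit-somewhere : ∀ {n} (f : Vector Carrier n) →
                               (∀ i → f i ≈ 0#) ⊎ ∃[ i ] ∃[ y ] y * f i ≈ 1#
      zero-or-unit-somewhere {ℕ.zero}  f = inj₁ λ ()
      zero-or-unit-somewhere {ℕ.suc n} f with zero-or-unit (f zero) | zero-or-unit-somewhere (f ∘ suc)
      ... | inj₂ u | _            = inj₂ (zero , u)
      ... | inj₁ _ | inj₂ (i , u) = inj₂ (suc i , u)
      ... | inj₁ z | inj₁ zs      = inj₁ λ { zero → z ; (suc i) → zs i }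

    module _ {I : Set} {n} (M : I → Fin (ℕ.suc n) → Carrier)
             (F : RankFactorization (λ x j → M x (suc j))) where
      open RankFactorization F

      private
        v : I → Carrier
        v x = M x zero

        b : Fin rank → I → Carrier
        b k x = M x (suc (basis k))

        ⟨_,_⟩ : Fin rank → (I → Carrier) → Carrier
        ⟨ i , f ⟩ = sum (λ a → dual i a * f (point a))

      -- The new column minus its projection to the span of the basis columns, with coefficients
      -- read off by the dual functionals. Whether it vanishes decides if the column joins the
      -- basis.
      residue : I → Carrier
      residue x = v x - sum (λ i → ⟨ i , v ⟩ * b i x)

      dependentColumn : (∀ x → residue x ≈ 0#) → RankFactorization M
      dependentColumn residue≈0 = record
        { rank       = rank
        ; basis      = suc ∘ basis
        ; point      = point
        ; dual       = dual
        ; coordinate = λ { zero i → ⟨ i , v ⟩ ; (suc j) → coordinate j }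
        ; dual-basis = dual-basis
        ; expansion  = λ { x zero → x∙y⁻¹≈ε⇒x≈y _ _ (residue≈0 x) ; x (suc j) → expansion x j }
        }

      module _ (x₀ : I) (c : Carrier) (c*residue≈1 : c * residue x₀ ≈ 1#) where
        private
          s : Fin rank → Carrier
          s a = sum (λ k → b k x₀ * dual k a)

          -- The functional taking a column to `c` times its residue at `x₀`. It is 1 on the new
          -- column by the choice of `c`, and 0 on the old basis columns, whose residues vanish.
          ψ : Fin (ℕ.suc rank) → Carrier
          ψ zero    = c
          ψ (suc a) = - c * s a

          point′ : Fin (ℕ.suc rank) → I
          point′ = x₀ Vector.∷ point

          -- Inverse of the bordered minor. A multiple of `ψ` is subtracted from each old functional
          -- so that it vanishes on the new column; its values on the old basis columns stay, since
          -- `ψ` is 0 there.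
          dual′ : Fin (ℕ.suc rank) → Fin (ℕ.suc rank) → Carrier
          dual′ zero    a       = ψ a
          dual′ (suc i) zero    = - ⟨ i , v ⟩ * ψ zero
          dual′ (suc i) (suc a) = dual i a + - ⟨ i , v ⟩ * ψ (suc a)

          ⟨ψ,_⟩ : (I → Carrier) → Carrier
          ⟨ψ, f ⟩ = sum (λ a → ψ a * f (point′ a))

          ⟨ψ,f⟩≈ : ∀ f → ⟨ψ, f ⟩ ≈ c * (f x₀ - sum (λ k → b k x₀ * ⟨ k , f ⟩))
          ⟨ψ,f⟩≈ f = begin
            c * f x₀ + sum (λ a → (- c * s a) * f (point a))
              ≈⟨ +-congˡ (sum-cong-≋ λ a → *-assoc (- c) (s a) (f (point a))) ⟩
            c * f x₀ + sum (λ a → - c * (s a * f (point a)))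
              ≈⟨ +-congˡ (*-distribˡ-sum (- c) (λ a → s a * f (point a))) ⟨
            c * f x₀ + - c * sum (λ a → s a * f (point a))
              ≈⟨ +-congˡ (*-congˡ (sum-bilinear (λ k → b k x₀) dual (f ∘ point))) ⟩
            c * f x₀ + - c * sum (λ k → b k x₀ * ⟨ k , f ⟩)
              ≈⟨ +-congˡ (trans (sym (-‿distribˡ-* c _)) (-‿distribʳ-* c _)) ⟩
            c * f x₀ + c * - sum (λ k → b k x₀ * ⟨ k , f ⟩)
              ≈⟨ distribˡ c _ _ ⟨
            c * (f x₀ - sum (λ k → b k x₀ * ⟨ k , f ⟩))
              ∎

          ⟨ψ,v⟩≈1 : ⟨ψ, v ⟩ ≈ 1#
          ⟨ψ,v⟩≈1 = begin
            ⟨ψ, v ⟩                                           ≈⟨ ⟨ψ,f⟩≈ v ⟩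
            c * (v x₀ - sum (λ k → b k x₀ * ⟨ k , v ⟩))       ≈⟨ *-congˡ (+-congˡ (-‿cong (sum-cong-≋ λ k → *-comm (b k x₀) ⟨ k , v ⟩))) ⟩
            c * residue x₀                                    ≈⟨ c*residue≈1 ⟩
            1#                                                ∎

          ⟨ψ,b⟩≈0 : ∀ k → ⟨ψ, b k ⟩ ≈ 0#
          ⟨ψ,b⟩≈0 k = begin
            ⟨ψ, b k ⟩
              ≈⟨ ⟨ψ,f⟩≈ (b k) ⟩
            c * (b k x₀ - sum (λ i → b i x₀ * ⟨ i , b k ⟩))
              ≈⟨ *-congˡ (+-congˡ (-‿cong (sum-cong-≋ λ i → *-congˡ (trans (dual-basis i k) (δ-sym i k))))) ⟩
            c * (b k x₀ - sum (λ i → b i x₀ * δ k i))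
              ≈⟨ *-congˡ (+-congˡ (-‿cong (sum-δʳ (λ i → b i x₀) k))) ⟩
            c * (b k x₀ - b k x₀)
              ≈⟨ *-congˡ (-‿inverseʳ _) ⟩
            c * 0#
              ≈⟨ zeroʳ c ⟩
            0#
              ∎

          ⟨dual′,f⟩≈ : ∀ i f → sum (λ a → dual′ (suc i) a * f (point′ a)) ≈ ⟨ i , f ⟩ + - ⟨ i , v ⟩ * ⟨ψ, f ⟩
          ⟨dual′,f⟩≈ i f = begin
            (t * c) * f x₀ + sum (λ a → (dual i a + t * ψ (suc a)) * f (point a))
              ≈⟨ +-cong (*-assoc t c (f x₀)) (sum-cong-≋ λ a → trans (distribʳ (f (point a)) _ _) (+-congˡ (*-assoc t _ _))) ⟩
            t * (c * f x₀) + sum (λ a → dual i a * f (point a) + t * (ψ (suc a) * f (point a)))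
              ≈⟨ +-congˡ (∑-distrib-+ (λ a → dual i a * f (point a)) (λ a → t * (ψ (suc a) * f (point a)))) ⟩
            t * (c * f x₀) + (⟨ i , f ⟩ + sum (λ a → t * (ψ (suc a) * f (point a))))
              ≈⟨ x∙yz≈y∙xz _ _ _ ⟩
            ⟨ i , f ⟩ + (t * (c * f x₀) + sum (λ a → t * (ψ (suc a) * f (point a))))
              ≈⟨ +-congˡ (*-distribˡ-sum t (λ a → ψ a * f (point′ a))) ⟨
            ⟨ i , f ⟩ + t * ⟨ψ, f ⟩
              ∎
            where
            open import Algebra.Properties.CommutativeSemigroup +-commutativeSemigroup using (x∙yz≈y∙xz)
            t : Carrier
            t = - ⟨ i , v ⟩

        independentColumn : RankFactorization M
        independentColumn = record
          { rank       = ℕ.suc rank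
          ; basis      = zero Vector.∷ (suc ∘ basis)
          ; point      = point′
          ; dual       = dual′
          ; coordinate = coordinate′
          ; dual-basis = dual-basis′
          ; expansion  = expansion′
          }
          where
          coordinate′ : Fin (ℕ.suc n) → Fin (ℕ.suc rank) → Carrier
          coordinate′ zero    zero    = 1#
          coordinate′ zero    (suc _) = 0#
          coordinate′ (suc j) zero    = 0#
          coordinate′ (suc j) (suc i) = coordinate j i

          dual-basis′ : ∀ i k → sum (λ a → dual′ i a * M (point′ a) ((zero Vector.∷ (suc ∘ basis)) k)) ≈ δ i k
          dual-basis′ zero    zero    = ⟨ψ,v⟩≈1
          dual-basis′ zero    (suc k) = ⟨ψ,b⟩≈0 k
          dual-basis′ (suc i) zero    = begin
            _                                    ≈⟨ ⟨dual′,f⟩≈ i v ⟩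
            ⟨ i , v ⟩ + - ⟨ i , v ⟩ * ⟨ψ, v ⟩    ≈⟨ +-congˡ (trans (*-congˡ ⟨ψ,v⟩≈1) (*-identityʳ _)) ⟩
            ⟨ i , v ⟩ - ⟨ i , v ⟩                ≈⟨ -‿inverseʳ _ ⟩
            0#                                   ∎
          dual-basis′ (suc i) (suc k) = begin
            _                                        ≈⟨ ⟨dual′,f⟩≈ i (b k) ⟩
            ⟨ i , b k ⟩ + - ⟨ i , v ⟩ * ⟨ψ, b k ⟩    ≈⟨ +-cong (dual-basis i k) (trans (*-congˡ (⟨ψ,b⟩≈0 k)) (zeroʳ _)) ⟩
            δ i k + 0#                               ≈⟨ +-identityʳ _ ⟩
            δ i k                                    ∎

          expansion′ : ∀ x j → M x j ≈ sum (λ i → coordinate′ j i * M x ((zero Vector.∷ (suc ∘ basis)) i))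
          expansion′ x zero    = sym (trans
            (+-cong (*-identityˡ _) (sum-zero (λ i → 0# * b i x) λ i → zeroˡ _)) (+-identityʳ _))
          expansion′ x (suc j) = trans (expansion x j) (sym (trans (+-congʳ (zeroˡ _)) (+-identityˡ _)))

    -- Induction on the number of columns. The listing of the rows reduces the vanishing of a
    -- residue at all rows to a finite search.
    rankFactorization-Fin : ∀ {I : Set} {m n} → Fin m ↠ I → (M : I → Fin n → Carrier) → RankFactorization M
    rankFactorization-Fin {n = ℕ.zero}  I M = record
      { rank = 0 ; basis = λ () ; point = λ () ; dual = λ () ; coordinate = λ ()
      ; dual-basis = λ () ; expansion = λ _ () }
    rankFactorization-Fin {n = ℕ.suc n} I M
      with F ← rankFactorization-Fin I (λ x j → M x (suc j))
      with zero-or-unit-somewhere (residue M F ∘ Surjection.to I)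
    ... | inj₂ (k , c , u) = independentColumn M F (Surjection.to I k) c u
    ... | inj₁ residue≈0   = dependentColumn M F λ x →
      ≡.subst (λ y → residue M F y ≈ 0#) (proj₂ (strictlySurjective x)) (residue≈0 _)
      where open Surjection I

    -- The listing of the columns may have repetitions: elimination runs on the listed columns, and
    -- each column takes the coordinates of one chosen occurrence.
    rankFactorization : ∀ {I J : Set} {m n} → Fin m ↠ I → Fin n ↠ J → (M : I → J → Carrier) → RankFactorization M
    rankFactorization I J M = record
      { rank       = rank
      ; basis      = to ∘ basis
      ; point      = point
      ; dual       = dual
      ; coordinate = λ j → coordinate (proj₁ (strictlySurjective j))
      ; dual-basis = dual-basis
      ; expansion  = λ x j → trans (reflexive (≡.cong (M x) (≡.sym (proj₂ (strictlySurjective j)))))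
                                   (expansion x (proj₁ (strictlySurjective j)))
      }
      where
      open Surjection J
      open RankFactorization (rankFactorization-Fin I λ x → M x ∘ to)

-- Linear algebra over a commutative ring

module LinearMaps (R : CommutativeRing 0ℓ 0ℓ) where
  open CommutativeRing R hiding (zero) renaming (Carrier to K)
  open LinearAlgebra R
  open ProductSums +-commutativeMonoid
  open Algebra.Properties.CommutativeSemigroup *-commutativeSemigroup using (x∙yz≈y∙xz)

  module IsLinear {V W : Space} {f : ∣ V ∣ → ∣ W ∣} (f-linear : IsLinear V W f) =
    LeftModuleMorphisms.IsLeftModuleHomomorphism f-linear

  module _ (V : Space) where
    open LeftModule V
    private module V-sums = ProductSums +ᴹ-commutativeMonoid

    combination-cong : ∀ {n} {c d : Vector K n} {v w : Vector ∣ V ∣ n} →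
                       (∀ i → c i ≈ d i) → (∀ i → v i ≈ᴹ w i) → combination V c v ≈ᴹ combination V d w
    combination-cong c≈d v≈w = V-sums.sum-cong-≋ λ i → *ₗ-cong (c≈d i) (v≈w i)

    -- With v left to unification, the terms of a sum over ℝ or ℂ are replaced without
    -- comparing the Cauchy proofs in them, which would not finish.
    ≈-sum-cong : ∀ {x n} (v w : Vector ∣ V ∣ n) → x ≈ᴹ V-sums.sum v → (∀ i → v i ≈ᴹ w i) → x ≈ᴹ V-sums.sum w
    ≈-sum-cong v w x≈ v≈w = ≈ᴹ-trans x≈ (V-sums.sum-cong-≋ v≈w)

    combination-linear : ∀ {n} (v : Vector ∣ V ∣ n) → IsLinear (functions (Fin n)) V (λ c → combination V c v)
    combination-linear v = linear (functions (Fin _)) V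
      (λ c≈d → combination-cong c≈d λ _ → ≈ᴹ-refl)
      (λ c d → ≈ᴹ-trans (V-sums.sum-cong-≋ λ i → *ₗ-distribʳ (v i) (c i) (d i))
                        (V-sums.∑-distrib-+ (λ i → c i *ₗ v i) (λ i → d i *ₗ v i)))
      (λ a c → scale a c v)
      where
      scale : ∀ {n} a c (v : Vector ∣ V ∣ n) → combination V (λ i → a * c i) v ≈ᴹ a *ₗ combination V c v
      scale {ℕ.zero}  a c v = ≈ᴹ-sym (*ₗ-zeroʳ a)
      scale {ℕ.suc n} a c v = ≈ᴹ-trans
        (+ᴹ-cong (*ₗ-assoc a _ _) (scale a (c ∘ suc) (v ∘ suc))) (≈ᴹ-sym (*ₗ-distribˡ a _ _))

    combination-remQuot : ∀ {m n} (c : Fin m × Fin n → K) (v : Fin m × Fin n → ∣ V ∣) →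
      combination V (c ∘ remQuot {m} n) (v ∘ remQuot {m} n) ≈ᴹ
      V-sums.sum (λ i → combination V (λ j → c (i , j)) (λ j → v (i , j)))
    combination-remQuot c v = V-sums.sum-remQuot λ ij → c ij *ₗ v ij

    module _ {P : ∣ V ∣ → Set} (S : IsSubspace V P) where
      open IsSubspace S

      combination-closed : ∀ {n} (c : Vector K n) {v : Vector ∣ V ∣ n} → (∀ i → P (v i)) → P (combination V c v)
      combination-closed {ℕ.zero}  c p = 0-closed
      combination-closed {ℕ.suc n} c p = +-closed (*-closed (c zero) (p zero)) (combination-closed (c ∘ suc) (p ∘ suc))

      -- The induction principle for spans: a property that defines a subspace has to be checked on
      -- generators only.
      Span-least : ∀ {I} {f : I → ∣ V ∣} → (∀ i → P (f i)) → ∀ {x} → Span V f x → P x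
      Span-least p (n , k , c , x≈) = ≈-closed x≈ (combination-closed c (p ∘ k))

    combinations-isSubspace : ∀ {n} (v : Vector ∣ V ∣ n) → IsSubspace V (λ x → ∃[ c ] x ≈ᴹ combination V c v)
    combinations-isSubspace {n} v = record
      { ≈-closed = λ { x≈y (c , y≈) → c , ≈ᴹ-trans x≈y y≈ }
      ; 0-closed = (λ _ → 0#) , ≈ᴹ-sym 0ᴹ-homo
      ; +-closed = λ { (c , x≈) (d , y≈) → (λ i → c i + d i) , ≈ᴹ-trans (+ᴹ-cong x≈ y≈) (≈ᴹ-sym (+ᴹ-homo c d)) }
      ; *-closed = λ { a (c , x≈) → (λ i → a * c i) , ≈ᴹ-trans (*ₗ-congˡ x≈) (≈ᴹ-sym (*ₗ-homo a c)) }
      }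
      where open IsLinear {functions (Fin n)} {V} (combination-linear v)

  module _ (V W : Space) {f : ∣ V ∣ → ∣ W ∣} (f-linear : IsLinear V W f) where
    private
      module V = LeftModule V
      module W = LeftModule W
    open IsLinear {V} {W} f-linear

    linear-combination : ∀ {n} (c : Vector K n) v → f (combination V c v) W.≈ᴹ combination W c (f ∘ v)
    linear-combination {ℕ.zero}  c v = 0ᴹ-homo
    linear-combination {ℕ.suc n} c v = W.≈ᴹ-trans (+ᴹ-homo _ _)
      (W.+ᴹ-cong (*ₗ-homo _ _) (linear-combination (c ∘ suc) (v ∘ suc)))

    preimage-isSubspace : ∀ {P} → IsSubspace W P → IsSubspace V (P ∘ f)
    preimage-isSubspace S = record
      { ≈-closed = λ x≈y → ≈-closed (⟦⟧-cong x≈y)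
      ; 0-closed = ≈-closed 0ᴹ-homo 0-closed
      ; +-closed = λ p q → ≈-closed (+ᴹ-homo _ _) (+-closed p q)
      ; *-closed = λ a p → ≈-closed (*ₗ-homo a _) (*-closed a p)
      }
      where open IsSubspace S

  module _ (U W : Space) (f : ∣ U ∣ → ∣ W ∣)
           (f-cong : ∀ {x y} → LeftModule._≈ᴹ_ U x y → LeftModule._≈ᴹ_ W (f x) (f y))
           (f-+ : ∀ x y → LeftModule._≈ᴹ_ W (f (LeftModule._+ᴹ_ U x y)) (LeftModule._+ᴹ_ W (f x) (f y)))
           (f-* : ∀ a x → LeftModule._≈ᴹ_ W (f (LeftModule._*ₗ_ U a x)) (LeftModule._*ₗ_ W a (f x)))
           (f-kernel : ∀ x → LeftModule._≈ᴹ_ W (f x) (LeftModule.0ᴹ W) → LeftModule._≈ᴹ_ U x (LeftModule.0ᴹ U))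
           (f-surjective : ∀ y → ∃[ x ] LeftModule._≈ᴹ_ W y (f x)) where
    private
      module W = LeftModule W

      f-combination : ∀ {n} (c : Vector K n) v → f (combination U c v) W.≈ᴹ combination W c (f ∘ v)
      f-combination = linear-combination U W (linear U W f-cong f-+ f-*)

    dimension-transfer : ∀ {d} → HasDimension U d → HasDimension W d
    dimension-transfer (b , independent , spanning) = f ∘ b ,
      (λ c c≈0 → independent c (f-kernel (combination U c b) (W.≈ᴹ-trans (f-combination c b) c≈0))) ,
      (λ y → let x , y≈fx = f-surjective y
                 c , x≈   = spanning x
             in c , W.≈ᴹ-trans y≈fx (W.≈ᴹ-trans (f-cong x≈) (f-combination c b)))

  combination-functions : ∀ {I : Set} {n} (c : Vector K n) (v : Fin n → I → K) i →
                          combination (functions I) c v i ≡ sum (λ k → c k * v k i)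
  combination-functions {n = ℕ.zero}  c v i = ≡.refl
  combination-functions {n = ℕ.suc n} c v i = ≡.cong (_ +_) (combination-functions (c ∘ suc) (v ∘ suc) i)

  -- With `w` the inverse of the order of a group and `s` its action on `I`, this operator is the
  -- averaging projection.
  weightedOrbitSum-linear : ∀ {I : Set} {n} (w : K) (s : Fin n → I → I) →
    IsLinear (functions I) (functions I) (λ f i → sum λ k → w * f (s k i))
  weightedOrbitSum-linear {I} w s = linear (functions I) (functions I)
    (λ f≈g i → sum-cong-≋ λ k → *-congˡ (f≈g (s k i)))
    (λ f g i → trans (sum-cong-≋ λ k → distribˡ w (f (s k i)) (g (s k i))) (∑-distrib-+ (λ k → w * f (s k i)) (λ k → w * g (s k i))))
    (λ a f i → trans (sum-cong-≋ λ k → x∙yz≈y∙xz w a (f (s k i)))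
      (sym (SemiringSum.*-distribˡ-sum semiring a (λ k → w * f (s k i)))))

module ColumnSpace (R : CommutativeRing 0ℓ 0ℓ) where
  open CommutativeRing R hiding (zero) renaming (Carrier to K)
  open LinearAlgebra R
  open LinearMaps R
  open MatrixRank R
  open ProductSums +-commutativeMonoid
  open SemiringSum semiring using (*-distribˡ-sum; *-distribʳ-sum)
  open SetoidReasoning setoid

  module _ {I J : Set} {M : I → J → K} (F : RankFactorization M) where
    open RankFactorization F

    column : J → I → K
    column j x = M x j

    -- By bilinearity this reduces to `dual-basis`: the dual functionals read off the coefficients
    -- of a combination of basis columns.
    dual-column : ∀ i (c : Vector K rank) →
                  sum (λ a → dual i a * sum (λ k → c k * M (point a) (basis k))) ≈ c i
    dual-column i c = begin
      sum (λ a → dual i a * sum (λ k → c k * M (point a) (basis k)))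
        ≈⟨ sum-cong-≋ (λ a → *-comm (dual i a) _) ⟩
      sum (λ a → sum (λ k → c k * M (point a) (basis k)) * dual i a)
        ≈⟨ sum-bilinear c (λ k a → M (point a) (basis k)) (dual i) ⟩
      sum (λ k → c k * sum (λ a → M (point a) (basis k) * dual i a))
        ≈⟨ sum-cong-≋ (λ k → *-congˡ (trans (sum-cong-≋ λ a → *-comm _ (dual i a)) (dual-basis i k))) ⟩
      sum (λ k → c k * δ i k)
        ≈⟨ sum-δʳ c i ⟩
      c i
        ∎

    basis-independent : LinearlyIndependent (functions I) (column ∘ basis)
    basis-independent c c≈0 i = begin
      c i
        ≈⟨ dual-column i c ⟨
      sum (λ a → dual i a * sum (λ k → c k * M (point a) (basis k)))
        ≈⟨ sum-zero (λ a → dual i a * sum (λ k → c k * M (point a) (basis k))) (λ a → trans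
             (*-congˡ (trans (reflexive (≡.sym (combination-functions c (column ∘ basis) (point a)))) (c≈0 (point a))))
             (zeroʳ _)) ⟩
      0#
        ∎

    column-spanned : ∀ j → ∃[ c ] (∀ x → column j x ≈ combination (functions I) c (column ∘ basis) x)
    column-spanned j = coordinate j , λ x →
      trans (expansion x j) (reflexive (≡.sym (combination-functions (coordinate j) (column ∘ basis) x)))

    -- Interpolation vectors, in the manner of Lagrange polynomials: they rebuild a function in the
    -- column span from its values at the chosen rows.
    dualVector : Fin rank → I → K
    dualVector a = combination (functions I) (λ i → dual i a) (column ∘ basis)

    -- The skeleton decomposition of a matrix: chosen columns, times the inverse of the chosen
    -- minor, times chosen rows.
    column-reconstruct : ∀ j x → column j x ≈ sum (λ a → M (point a) j * dualVector a x)
    column-reconstruct j x = begin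
      M x j
        ≈⟨ expansion x j ⟩
      sum (λ i → coordinate j i * M x (basis i))
        ≈⟨ sum-cong-≋ (λ i → *-congʳ (dual-column i (coordinate j))) ⟨
      sum (λ i → sum (λ a → dual i a * sum (λ k → coordinate j k * M (point a) (basis k))) * M x (basis i))
        ≈⟨ sum-cong-≋ (λ i → *-congʳ (sum-cong-≋ λ a → trans (*-congˡ (sym (expansion (point a) j))) (*-comm (dual i a) (M (point a) j)))) ⟩
      sum (λ i → sum (λ a → M (point a) j * dual i a) * M x (basis i))
        ≈⟨ sum-bilinear (λ a → M (point a) j) (λ a i → dual i a) (λ i → M x (basis i)) ⟩
      sum (λ a → M (point a) j * sum (λ i → dual i a * M x (basis i)))
        ≈⟨ sum-cong-≋ (λ a → *-congˡ (reflexive (≡.sym (combination-functions (λ i → dual i a) (column ∘ basis) x)))) ⟩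
      sum (λ a → M (point a) j * dualVector a x)
        ∎

    Span-reconstruct : ∀ {f} → Span (functions I) column f → ∀ x → f x ≈ sum (λ a → f (point a) * dualVector a x)
    Span-reconstruct = Span-least (functions I) reconstructed {f = column} column-reconstruct
      where
      reconstructed : IsSubspace (functions I) (λ f → ∀ x → f x ≈ sum (λ a → f (point a) * dualVector a x))
      reconstructed = record
        { ≈-closed = λ f≈g p x → trans (f≈g x) (trans (p x) (sum-cong-≋ λ a → *-congʳ (sym (f≈g (point a)))))
        ; 0-closed = λ x → sym (sum-zero (λ a → 0# * dualVector a x) λ a → zeroˡ _)
        ; +-closed = λ {f} {g} p q x → trans (+-cong (p x) (q x)) (sym (trans
            (sum-cong-≋ λ a → distribʳ (dualVector a x) (f (point a)) (g (point a)))
            (∑-distrib-+ (λ a → f (point a) * dualVector a x) (λ a → g (point a) * dualVector a x))))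
        ; *-closed = λ b {f} p x → trans (*-congˡ (p x)) (trans
            (*-distribˡ-sum b (λ a → f (point a) * dualVector a x))
            (sum-cong-≋ λ a → sym (*-assoc b (f (point a)) (dualVector a x))))
        }

-- Representations embedded into spaces of functions

module Realizations (R : CommutativeRing 0ℓ 0ℓ) where
  open CommutativeRing R hiding (zero) renaming (Carrier to K)
  open LinearAlgebra R
  open LinearMaps R

  -- An equivariant embedding ι of ρ into functions on I; `reconstruct` recovers a vector
  -- from finitely many of its values, and this form of injectivity passes to tensor products.
  record Realization {G : Group 0ℓ 0ℓ} (ρ : Representation G) (I J : Set) (move : Group.Carrier G → I → I) : Set where
    open Representation ρ
    open LeftModule V
    field
      ι           : ∣ V ∣ → I → K
      ι-linear    : IsLinear V (functions I) ι
      ι-act       : ∀ g x i → ι (act g x) i ≈ ι x (move g i)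
      {size}      : ℕ
      point       : Fin size → I
      vector      : Fin size → ∣ V ∣
      reconstruct : ∀ x → x ≈ᴹ combination V (ι x ∘ point) vector
      generator   : J → ∣ V ∣
      ι-span      : ∀ x → Span (functions I) (ι ∘ generator) (ι x)

    open LeftModuleMorphisms.IsLeftModuleHomomorphism ι-linear public
      using () renaming (⟦⟧-cong to ι-cong; +ᴹ-homo to ι-+; *ₗ-homo to ι-*)

    ι-injective : ∀ {x y} → (∀ i → ι x i ≈ ι y i) → x ≈ᴹ y
    ι-injective {x} {y} ιx≈ιy = ≈ᴹ-trans (reconstruct x) (≈ᴹ-trans
      (combination-cong V (λ a → ιx≈ιy (point a)) λ a → ≈ᴹ-refl) (≈ᴹ-sym (reconstruct y)))

  restrict-realization : ∀ {G H : Group 0ℓ 0ℓ} {φ} (hom : Homomorphism H G φ) {ρ : Representation G} {I J move} →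
    Realization ρ I J move → Realization (restrict {G} {H} hom ρ) I J (move ∘ φ)
  restrict-realization {φ = φ} hom Z = record
    { ι = ι ; ι-linear = ι-linear ; ι-act = ι-act ∘ φ ; point = point ; vector = vector
    ; reconstruct = reconstruct ; generator = generator ; ι-span = ι-span }
    where open Realization Z

  module _ {G : Group 0ℓ 0ℓ} {ρ π : Representation G} {I J I′ J′ : Set} {move move′}
           (X : Realization ρ I J move) (Y : Realization π I′ J′ move′) where
    private
      module X = Realization X
      module Y = Realization Y
      module V = LeftModule (Representation.V ρ)
      module W = LeftModule (Representation.V π)
      module ⊗ = Representation (ρ ⊗ᴿ π)
    open TensorProduct (Representation.V ρ) (Representation.V π) renaming (_·_ to _⊙_; ·-cong to ⊙-cong)
    private module T = LeftModule space

    -- Defined on formal terms, with a product of values for a pure tensor; `evaluate-cong` checks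
    -- each relation of the tensor product and so makes it a map on the quotient.
    evaluate : Tensor → I × I′ → K
    evaluate (x ⊗ y) (i , j) = X.ι x i * Y.ι y j
    evaluate 𝟎       ij      = 0#
    evaluate (t ⊕ u) ij      = evaluate t ij + evaluate u ij
    evaluate (⊖ t)   ij      = - evaluate t ij
    evaluate (a ⊙ t) ij      = a * evaluate t ij

    evaluate-cong : ∀ {t u} → t ≋ u → ∀ ij → evaluate t ij ≈ evaluate u ij
    evaluate-cong ≋-refl             ij = refl
    evaluate-cong (≋-sym p)          ij = sym (evaluate-cong p ij)
    evaluate-cong (≋-trans p q)      ij = trans (evaluate-cong p ij) (evaluate-cong q ij)
    evaluate-cong (⊗-cong p q)  (i , j) = *-cong (X.ι-cong p i) (Y.ι-cong q j)
    evaluate-cong (⊕-cong p q)       ij = +-cong (evaluate-cong p ij) (evaluate-cong q ij)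
    evaluate-cong (⊖-cong p)         ij = -‿cong (evaluate-cong p ij)
    evaluate-cong (⊙-cong e p)       ij = *-cong e (evaluate-cong p ij)
    evaluate-cong (⊕-assoc t u v)    ij = +-assoc _ _ _
    evaluate-cong (⊕-comm t u)       ij = +-comm _ _
    evaluate-cong (⊕-identityˡ t)    ij = +-identityˡ _
    evaluate-cong (⊖-inverseˡ t)     ij = -‿inverseˡ _
    evaluate-cong (·-zeroˡ t)        ij = zeroˡ _
    evaluate-cong (·-zeroʳ a)        ij = zeroʳ a
    evaluate-cong (·-distribˡ a t u) ij = distribˡ a _ _
    evaluate-cong (·-distribʳ t a b) ij = distribʳ _ a b
    evaluate-cong (·-identityˡ t)    ij = *-identityˡ _
    evaluate-cong (·-assoc a b t)    ij = *-assoc a b _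
    evaluate-cong (⊗-distribˡ x y z) (i , j) = trans (*-congˡ (Y.ι-+ y z j)) (distribˡ _ _ _)
    evaluate-cong (⊗-distribʳ x y z) (i , j) = trans (*-congʳ (X.ι-+ y z i)) (distribʳ _ _ _)
    evaluate-cong (⊗-scaleˡ a x y)   (i , j) = trans (*-congʳ (X.ι-* a x i)) (*-assoc a _ _)
    evaluate-cong (⊗-scaleʳ a x y)   (i , j) = trans (*-congˡ (Y.ι-* a y j)) (x∙yz≈y∙xz _ a _)
      where open Algebra.Properties.CommutativeSemigroup *-commutativeSemigroup using (x∙yz≈y∙xz)

    evaluate-act : ∀ g t i j → evaluate (⊗.act g t) (i , j) ≈ evaluate t (move g i , move′ g j)
    evaluate-act g (x ⊗ y) i j = *-cong (X.ι-act g x i) (Y.ι-act g y j)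
    evaluate-act g 𝟎       i j = refl
    evaluate-act g (t ⊕ u) i j = +-cong (evaluate-act g t i j) (evaluate-act g u i j)
    evaluate-act g (⊖ t)   i j = -‿cong (evaluate-act g t i j)
    evaluate-act g (a ⊙ t) i j = *-congˡ (evaluate-act g t i j)

    private
      pointPair : Fin X.size × Fin Y.size → I × I′
      pointPair (a , b) = X.point a , Y.point b

      vectorPair : Fin X.size × Fin Y.size → Tensor
      vectorPair (a , b) = X.vector a ⊗ Y.vector b

      ⊗ˡ-linear : ∀ y → IsLinear (Representation.V ρ) space (_⊗ y)
      ⊗ˡ-linear y = linear (Representation.V ρ) space
        (λ p → ⊗-cong p W.≈ᴹ-refl) (λ x x′ → ⊗-distribʳ y x x′) (λ a x → ⊗-scaleˡ a x y)

      ⊗ʳ-linear : ∀ x → IsLinear (Representation.V π) space (x ⊗_)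
      ⊗ʳ-linear x = linear (Representation.V π) space
        (λ p → ⊗-cong V.≈ᴹ-refl p) (λ y y′ → ⊗-distribˡ x y y′) (λ a y → ⊗-scaleʳ a x y)

      flatPoint : Fin (X.size ℕ.* Y.size) → I × I′
      flatPoint = pointPair ∘ remQuot Y.size

      flatVector : Fin (X.size ℕ.* Y.size) → Tensor
      flatVector = vectorPair ∘ remQuot Y.size

      module Flat = IsLinear {functions (Fin (X.size ℕ.* Y.size))} {space} (combination-linear space flatVector)

      -- For a pure tensor, both factors are expanded by their own formulas and the coefficients
      -- multiply; the other terms follow since both sides are linear. Injectivity of `evaluate` on
      -- the quotient is a consequence.
      reconstruct⊗ : ∀ t → t ≋ combination space (evaluate t ∘ flatPoint) flatVector
      reconstruct⊗ (x ⊗ y) = begin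
        x ⊗ y
          ≈⟨ ⊗-cong (X.reconstruct x) W.≈ᴹ-refl ⟩
        combination (Representation.V ρ) c X.vector ⊗ y
          ≈⟨ linear-combination (Representation.V ρ) space (⊗ˡ-linear y) c X.vector ⟩
        T-sums.sum (λ a → c a ⊙ (X.vector a ⊗ y))
          ≈⟨ T-sums.sum-cong-≋ (λ a → ⊙-cong (refl {c a}) (≋-trans (⊗-cong V.≈ᴹ-refl (Y.reconstruct y))
               (linear-combination (Representation.V π) space (⊗ʳ-linear (X.vector a)) d Y.vector))) ⟩
        T-sums.sum (λ a → c a ⊙ combination space d (λ b → X.vector a ⊗ Y.vector b))
          ≈⟨ T-sums.sum-cong-≋ (λ a → ≋-sym (IsLinear.*ₗ-homo {functions (Fin Y.size)} {space}
               (combination-linear space (λ b → X.vector a ⊗ Y.vector b)) (c a) d)) ⟩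
        T-sums.sum (λ a → combination space (λ b → c a * d b) (λ b → X.vector a ⊗ Y.vector b))
          ≈⟨ combination-remQuot space (evaluate (x ⊗ y) ∘ pointPair) vectorPair ⟨
        combination space (evaluate (x ⊗ y) ∘ flatPoint) flatVector
          ∎
        where
        open SetoidReasoning T.≈ᴹ-setoid
        module T-sums = ProductSums T.+ᴹ-commutativeMonoid
        c : Vector K X.size
        c = X.ι x ∘ X.point
        d : Vector K Y.size
        d = Y.ι y ∘ Y.point
      reconstruct⊗ 𝟎       = ≋-sym Flat.0ᴹ-homo
      reconstruct⊗ (t ⊕ u) = ≋-trans (⊕-cong (reconstruct⊗ t) (reconstruct⊗ u))
        (≋-sym (Flat.+ᴹ-homo (evaluate t ∘ flatPoint) (evaluate u ∘ flatPoint)))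
      reconstruct⊗ (⊖ t)   = ≋-trans (⊖-cong (reconstruct⊗ t))
        (≋-sym (Flat.-ᴹ-homo (evaluate t ∘ flatPoint)))
      reconstruct⊗ (a ⊙ t) = ≋-trans (⊙-cong refl (reconstruct⊗ t))
        (≋-sym (Flat.*ₗ-homo a (evaluate t ∘ flatPoint)))

      generatorPair : J × J′ → Tensor
      generatorPair (k , k′) = X.generator k ⊗ Y.generator k′

      productˡ-linear : ∀ (h : I′ → K) → IsLinear (functions I) (functions (I × I′)) (λ f (i , j) → f i * h j)
      productˡ-linear h = linear (functions I) (functions (I × I′))
        (λ p (i , j) → *-congʳ (p i)) (λ f f′ (i , j) → distribʳ (h j) _ _) (λ a f (i , j) → *-assoc a _ _)

      productʳ-linear : ∀ (f : I → K) → IsLinear (functions I′) (functions (I × I′)) (λ h (i , j) → f i * h j)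
      productʳ-linear f = linear (functions I′) (functions (I × I′))
        (λ p (i , j) → *-congˡ (p j)) (λ h h′ (i , j) → distribˡ (f i) _ _) (λ a h (i , j) → x∙yz≈y∙xz (f i) a (h j))
        where open Algebra.Properties.CommutativeSemigroup *-commutativeSemigroup using (x∙yz≈y∙xz)

      module Products = IsSubspace (span-isSubspace (functions (I × I′)) (evaluate ∘ generatorPair))

      evaluate-span : ∀ t → Span (functions (I × I′)) (evaluate ∘ generatorPair) (evaluate t)
      -- One factor is treated at a time: with `ι y` fixed, the functions whose product with it lies
      -- in the span form a subspace, so `x` may be taken to be a generator; then the same is done
      -- for `y`.
      evaluate-span (x ⊗ y) = Span-least (functions I) spannedˡ {f = X.ι ∘ X.generator}
        (λ k → Span-least (functions I′) (spannedʳ k) {f = Y.ι ∘ Y.generator}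
          (λ k′ → Span-generator (functions (I × I′)) (evaluate ∘ generatorPair) (k , k′)) (Y.ι-span y))
        (X.ι-span x)
        where
        spannedˡ = preimage-isSubspace (functions I) (functions (I × I′)) (productˡ-linear (Y.ι y))
          (span-isSubspace (functions (I × I′)) (evaluate ∘ generatorPair))
        spannedʳ = λ k → preimage-isSubspace (functions I′) (functions (I × I′)) (productʳ-linear (X.ι (X.generator k)))
          (span-isSubspace (functions (I × I′)) (evaluate ∘ generatorPair))
      evaluate-span 𝟎       = Products.0-closed
      evaluate-span (t ⊕ u) = Products.+-closed {evaluate t} {evaluate u} (evaluate-span t) (evaluate-span u)
      evaluate-span (⊖ t)   = Products.-‿closed {evaluate t} (evaluate-span t)
      evaluate-span (a ⊙ t) = Products.*-closed a {evaluate t} (evaluate-span t)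

    ⊗-realization : Realization (ρ ⊗ᴿ π) (I × I′) (J × J′) (λ g (i , j) → move g i , move′ g j)
    ⊗-realization = record
      { ι = evaluate
      ; ι-linear = linear space (functions (I × I′)) evaluate-cong (λ _ _ _ → refl) (λ _ _ _ → refl)
      ; ι-act = λ g t (i , j) → evaluate-act g t i j
      ; point = flatPoint
      ; vector = flatVector
      ; reconstruct = reconstruct⊗
      ; generator = generatorPair
      ; ι-span = evaluate-span
      }

  ⊠-realization : ∀ {G H : Group 0ℓ 0ℓ} {ρ : Representation G} {π : Representation H} {I J I′ J′ : Set} {move move′} →
    Realization ρ I J move → Realization π I′ J′ move′ →
    Realization (ρ ⊠ π) (I × I′) (J × J′) (λ (g , h) (i , j) → move g i , move′ h j)
  ⊠-realization {G} {H} X Y = ⊗-realization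
    (restrict-realization {G} {DirectProduct.group G H} (proj₁-homomorphism {G} {H}) X)
    (restrict-realization {H} {DirectProduct.group G H} (proj₂-homomorphism {G} {H}) Y)

SemiringHomomorphism : (A B : CommutativeRing 0ℓ 0ℓ) →
                       (CommutativeRing.Carrier A → CommutativeRing.Carrier B) → Set
SemiringHomomorphism A B = SemiringMorphisms.IsSemiringHomomorphism
  (Semiring.rawSemiring (CommutativeRing.semiring A)) (Semiring.rawSemiring (CommutativeRing.semiring B))

module BaseChange (A B : CommutativeRing 0ℓ 0ℓ) {h} (h-homomorphism : SemiringHomomorphism A B h) where
  private
    module A = CommutativeRing A
    module B = CommutativeRing B
    module A-rank = MatrixRank A
    module B-rank = MatrixRank B
    module A-sums = ProductSums A.+-commutativeMonoid
    module B-sums = ProductSums B.+-commutativeMonoid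
  open SemiringMorphisms.IsSemiringHomomorphism h-homomorphism

  sum-homo : ∀ {n} (f : Vector A.Carrier n) → h (A-sums.sum f) B.≈ B-sums.sum (h ∘ f)
  sum-homo {ℕ.zero}  f = 0#-homo
  sum-homo {ℕ.suc n} f = B.trans (+-homo _ _) (B.+-congˡ (sum-homo (f ∘ suc)))

  dot-homo : ∀ {n} (f g : Vector A.Carrier n) →
             h (A-sums.sum (λ i → f i A.* g i)) B.≈ B-sums.sum (λ i → h (f i) B.* h (g i))
  dot-homo f g = B.trans (sum-homo (λ i → f i A.* g i)) (B-sums.sum-cong-≋ λ i → *-homo (f i) (g i))

  δ-homo : ∀ {n} (i j : Fin n) → h (A-rank.δ i j) B.≈ B-rank.δ i j
  δ-homo zero    zero    = 1#-homo
  δ-homo zero    (suc _) = 0#-homo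
  δ-homo (suc _) zero    = 0#-homo
  δ-homo (suc i) (suc j) = δ-homo i j

  -- The two laws are identities between sums of products, so a homomorphism transports them. The
  -- transported `dual-basis` keeps the columns independent, so the rank does not drop.
  rankFactorization-map : ∀ {I J : Set} {M : I → J → A.Carrier} →
                          A-rank.RankFactorization M → B-rank.RankFactorization (λ x j → h (M x j))
  rankFactorization-map {M = M} F = record
    { rank       = rank
    ; basis      = basis
    ; point      = point
    ; dual       = λ i a → h (dual i a)
    ; coordinate = λ j i → h (coordinate j i)
    ; dual-basis = λ i k → B.trans (B.sym (dot-homo (dual i) (λ a → M (point a) (basis k))))
        (B.trans (⟦⟧-cong (dual-basis i k)) (δ-homo i k))
    ; expansion  = λ x j → B.trans (⟦⟧-cong (expansion x j))
        (dot-homo (coordinate j) (λ i → M x (basis i)))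
    }
    where open A-rank.RankFactorization F

-- Dimensions of spaces of invariants and of affine hulls

module Dimensions (R : CommutativeRing 0ℓ 0ℓ) where
  open CommutativeRing R hiding (zero) renaming (Carrier to K)
  open LinearAlgebra R
  open LinearMaps R
  open MatrixRank R
  open ColumnSpace R
  open Realizations R
  open ProductSums +-commutativeMonoid
  open SemiringSum semiring using (*-distribˡ-sum; *-distribʳ-sum)
  open SetoidReasoning setoid

  -- Used to pass from triples (p, q, r), which index the Littlewood-Richardson matrix, to the
  -- nested pairs ((p, q), r) produced by an iterated tensor product.
  rankFactorization-reindex : ∀ {I J I′ J′ : Set} {M : I → J → K} (f : I′ → I) (f⁻¹ : I → I′) (g : J′ → J) (g⁻¹ : J → J′) →
    (∀ i → f (f⁻¹ i) ≡ i) → (∀ j → g (g⁻¹ j) ≡ j) →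
    RankFactorization M → RankFactorization (λ x j → M (f x) (g j))
  rankFactorization-reindex {M = M} f f⁻¹ g g⁻¹ f∘f⁻¹ g∘g⁻¹ F = record
    { rank       = rank
    ; basis      = g⁻¹ ∘ basis
    ; point      = f⁻¹ ∘ point
    ; dual       = dual
    ; coordinate = coordinate ∘ g
    ; dual-basis = λ i k → trans
        (sum-cong-≋ λ a → *-congˡ (reflexive (≡.cong₂ M (f∘f⁻¹ (point a)) (g∘g⁻¹ (basis k))))) (dual-basis i k)
    ; expansion  = λ x j → trans (expansion (f x) (g j))
        (sum-cong-≋ λ i → *-congˡ (reflexive (≡.cong (M (f x)) (≡.sym (g∘g⁻¹ (basis i))))))
    }
    where open RankFactorization F

  SpannedImage : {I J : Set} (V : Space) → (∣ V ∣ → I → K) → (J → ∣ V ∣) → Set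
  SpannedImage {I} V ι f = ∀ x → Span (functions I) (ι ∘ f) (ι x)

  module _ {G : Group 0ℓ 0ℓ} (ρ : Representation G) {I J : Set} {move : Group.Carrier G → I → I}
           {ι : ∣ Representation.V ρ ∣ → I → K}
           (ι-linear : IsLinear (Representation.V ρ) (functions I) ι)
           (ι-reflects : ∀ x y → (∀ i → ι x i ≈ ι y i) → LeftModule._≈ᴹ_ (Representation.V ρ) x y)
           (ι-act : ∀ g x i → ι (Representation.act ρ g x) i ≈ ι x (move g i))
           (f : J → ∣ Representation.V ρ ∣)
           (ι-span : SpannedImage (Representation.V ρ) ι f)
           (F : RankFactorization (λ i j → ι (f j) i)) where
    open Representation ρ using (V)
    open RankFactorization F
    private
      vector : Fin rank → ∣ V ∣
      vector a = combination V (λ i → dual i a) (f ∘ basis)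

      ι-combination : ∀ c i → ι (combination V c vector) i ≈ sum (λ a → c a * dualVector F a i)
      ι-combination c i = begin
        ι (combination V c vector) i
          ≈⟨ linear-combination V (functions I) ι-linear c vector i ⟩
        combination (functions I) c (ι ∘ vector) i
          ≡⟨ combination-functions c (ι ∘ vector) i ⟩
        sum (λ a → c a * ι (vector a) i)
          ≈⟨ sum-cong-≋ (λ a → *-congˡ {c a} (linear-combination V (functions I) ι-linear (λ i → dual i a) (f ∘ basis) i)) ⟩
        sum (λ a → c a * dualVector F a i)
          ∎

    -- The interpolation vectors are formed inside the representation, from the preimages `f` of the
    -- columns; the formula holds for the values, and `ι-reflects` lifts it to vectors.
    column-realization : Realization ρ I J move
    column-realization = record
      { ι           = ι
      ; ι-linear    = ι-linear
      ; ι-act       = ι-act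
      ; point       = point
      ; vector      = vector
      ; reconstruct = λ x → ι-reflects x _ λ i → trans
          (Span-reconstruct F (ι-span x) i) (sym (ι-combination (ι x ∘ point) i))
      ; generator   = f
      ; ι-span      = ι-span
      }

  -- The orbit sums of the generators are invariant vectors with values the columns of M.
  module _ {G : Group 0ℓ 0ℓ} {ρ : Representation G} {I J : Set} {move : Group.Carrier G → I → I}
           (Z : Realization ρ I J move) {M : I → J → K} (F : RankFactorization M)
           {n} (g : Fin n → Group.Carrier G) (w : K) (total-weight : sum {n} (λ _ → w) ≈ 1#)
           (orbit-sum : ∀ j i → sum (λ k → Realization.ι Z (Realization.generator Z j) (move (g k) i)) ≈ M i j)
           (M-invariant : ∀ h i j → M (move h i) j ≈ M i j) where
    open Representation ρ
    open Realization Z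
    open RankFactorization F using (rank; basis)
    private
      module V = LeftModule V

      orbitSum : J → ∣ V ∣
      orbitSum j = combination V (λ _ → 1#) (λ k → act (g k) (generator j))

      ι-orbitSum : ∀ j i → ι (orbitSum j) i ≈ M i j
      ι-orbitSum j i = begin
        ι (orbitSum j) i
          ≈⟨ linear-combination V (functions I) ι-linear (λ _ → 1#) (λ k → act (g k) (generator j)) i ⟩
        combination (functions I) (λ _ → 1#) (λ k → ι (act (g k) (generator j))) i
          ≡⟨ combination-functions (λ _ → 1#) (λ k → ι (act (g k) (generator j))) i ⟩
        sum (λ k → 1# * ι (act (g k) (generator j)) i)
          ≈⟨ sum-cong-≋ (λ k → trans (*-identityˡ _) (ι-act (g k) (generator j) i)) ⟩
        sum (λ k → ι (generator j) (move (g k) i))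
          ≈⟨ orbit-sum j i ⟩
        M i j
          ∎

      -- Invariance is seen on values, where it is that of the rows of `M`. The family `g` is not
      -- reindexed, so it need not be known to be closed under products or free of repetitions.
      orbitSum-invariant : ∀ j → Invariant ρ (orbitSum j)
      orbitSum-invariant j h = ι-injective λ i → begin
        ι (act h (orbitSum j)) i    ≈⟨ ι-act h (orbitSum j) i ⟩
        ι (orbitSum j) (move h i)   ≈⟨ ι-orbitSum j (move h i) ⟩
        M (move h i) j              ≈⟨ M-invariant h i j ⟩
        M i j                       ≈⟨ ι-orbitSum j i ⟨
        ι (orbitSum j) i            ∎

      U : Space
      U = invariants ρ

      basisVector : Fin rank → ∣ U ∣
      basisVector i = orbitSum (basis i) , orbitSum-invariant (basis i)

      ι-combination : ∀ c i → ι (proj₁ (combination U c basisVector)) i ≈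
                              combination (functions I) c (column F ∘ basis) i
      ι-combination c i = begin
        ι (proj₁ (combination U c basisVector)) i
          ≈⟨ linear-combination U (functions I)
               (linear U (functions I) ι-cong (λ (x , _) (y , _) → ι-+ x y) (λ a (x , _) → ι-* a x)) c basisVector i ⟩
        combination (functions I) c (ι ∘ proj₁ ∘ basisVector) i
          ≈⟨ combination-cong (functions I) {c = c} (λ _ → refl) (λ k → ι-orbitSum (basis k)) i ⟩
        combination (functions I) c (column F ∘ basis) i
          ∎

      average : (I → K) → I → K
      average f i = sum λ k → w * f (move (g k) i)

      -- The average of a generator is `w` times a column of `M`, and each column is a combination
      -- of the basis columns.
      average-generator : ∀ j → ∃[ c ] (∀ i → average (ι (generator j)) i ≈ combination (functions I) c (column F ∘ basis) i)
      average-generator j = ≈-closed (λ i → trans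
          (sym (*-distribˡ-sum w (λ k → ι (generator j) (move (g k) i)))) (*-congˡ (orbit-sum j i)))
        (*-closed w {column F j} (column-spanned F j))
        where open IsSubspace (combinations-isSubspace (functions I) (column F ∘ basis))

      average-spanned : ∀ x → ∃[ c ] (∀ i → average (ι x) i ≈ combination (functions I) c (column F ∘ basis) i)
      average-spanned x = Span-least (functions I)
        (preimage-isSubspace (functions I) (functions I) (weightedOrbitSum-linear w (λ k → move (g k)))
          (combinations-isSubspace (functions I) (column F ∘ basis)))
        {f = ι ∘ generator} average-generator (ι-span x)

      average-invariant : ∀ x → Invariant ρ x → ∀ i → average (ι x) i ≈ ι x i
      average-invariant x x-invariant i = begin
        sum (λ k → w * ι x (move (g k) i))
          ≈⟨ sum-cong-≋ (λ k → *-congˡ (trans (sym (ι-act (g k) x i)) (ι-cong (x-invariant (g k)) i))) ⟩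
        sum {n} (λ _ → w * ι x i)
          ≈⟨ *-distribʳ-sum {n} (ι x i) (λ _ → w) ⟨
        sum {n} (λ _ → w) * ι x i
          ≈⟨ *-congʳ total-weight ⟩
        1# * ι x i
          ≈⟨ *-identityˡ _ ⟩
        ι x i
          ∎

    -- The orbit sums of the basis generators form a basis: their values are independent columns,
    -- and an invariant vector equals its own average, whose values these columns span.
    invariants-dimension : HasDimension (invariants ρ) rank
    invariants-dimension = basisVector , independent , spanning
      where
      independent : LinearlyIndependent U basisVector
      independent c c≈0 = basis-independent F c λ i →
        trans (sym (ι-combination c i)) (trans (ι-cong c≈0 i) (0ᴹ-homo i))
        where open LinearMaps.IsLinear R {V} {functions I} ι-linear using (0ᴹ-homo)

      spanning : ∀ x → ∃[ c ] LeftModule._≈ᴹ_ U x (combination U c basisVector)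
      spanning (x , x-invariant) with c , average≈ ← average-spanned x =
        c , ι-injective λ i → trans (sym (average-invariant x x-invariant i))
              (trans (average≈ i) (sym (ι-combination c i)))

  module _ {I J : Set} {M : I → J → K} (F : RankFactorization M) (P : (I → K) → Set)
           (columns : ∀ j → P (column F j))
           (spanned : ∀ {f} → P f → Span (functions I) (column F) f)
           (zero-in-hull : AffineHull (functions I) P (λ _ → 0#)) where
    open RankFactorization F
    private
      V : Space
      V = functions I

      combination-0∷ : ∀ {d} (c : Vector K (ℕ.suc d)) (v : Fin d → I → K) i →
        combination V c ((λ _ → 0#) Vector.∷ v) i ≈ combination V (c ∘ suc) v i
      combination-0∷ c v i = trans (+-congʳ (zeroʳ (c zero))) (+-identityˡ _)

    -- The point 0 together with a linear basis of the column span is an affine basis. Independence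
    -- is linear on the basis columns, and the zero total then kills the coefficient of 0.
    affineDimension : HasAffineDimension V P rank
    affineDimension = p , p∈hull , independent , spanning
      where
      p : Vector ∣ V ∣ (ℕ.suc rank)
      p = (λ _ → 0#) Vector.∷ (column F ∘ basis)

      p∈hull : ∀ i → AffineHull V P (p i)
      p∈hull zero    = zero-in-hull
      p∈hull (suc i) = 1 , (λ _ → column F (basis i)) , (λ _ → 1#) , (λ _ → columns (basis i)) ,
        +-identityʳ 1# , λ x → sym (trans (+-identityʳ _) (*-identityˡ _))

      independent : AffinelyIndependent V p
      independent c total≈0 c≈0 = λ { zero → first ; (suc i) → rest i }
        where
        rest : ∀ i → c (suc i) ≈ 0#
        rest = basis-independent F (c ∘ suc) λ x →
          trans (sym (combination-0∷ c (column F ∘ basis) x)) (c≈0 x)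
        first : c zero ≈ 0#
        first = trans (sym (trans (+-congˡ (sum-zero (c ∘ suc) rest)) (+-identityʳ _))) total≈0

      spanning : ∀ x → AffineHull V P x → ∃[ c ] total c ≈ 1# × (∀ i → x i ≈ combination V c p i)
      -- The coefficient of the point 0 does not change the combination, so it can be chosen to make
      -- the total 1.
      spanning x (n , q , c , q∈P , _ , x≈) = (1# - total d) Vector.∷ d , restore , λ i →
        trans (x≈ i) (trans (q≈ i) (sym (combination-0∷ ((1# - total d) Vector.∷ d) (column F ∘ basis) i)))
        where
        combos : IsSubspace V (λ f → ∃[ d ] (∀ i → f i ≈ combination V d (column F ∘ basis) i))
        combos = combinations-isSubspace V (column F ∘ basis)
        coordinates = combination-closed V combos c {q} λ k →
          Span-least V combos {f = column F} (column-spanned F) (spanned (q∈P k))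
        d : Vector K rank
        d = proj₁ coordinates
        q≈ = proj₂ coordinates
        restore : (1# - total d) + total d ≈ 1#
        restore = trans (+-assoc _ _ _) (trans (+-congˡ (-‿inverseˡ _)) (+-identityʳ 1#))

open ProductSums ℤ.+-0-commutativeMonoid using () renaming
  (sum to sumℤ; sum-cong-≋ to sumℤ-cong; sum-remQuot to sumℤ-remQuot; sum-zero to sumℤ-zero; ∑-comm to sumℤ-comm)

-- Permutations and words

-- Mixed-radix decoding that follows the recursion of `sumOverSym`, so that a sum over the symmetric
-- group becomes a sum over an index set of size `n !`.
permutationAt : ∀ n → Fin (n !) → Permutation′ n
permutationAt ℕ.zero    _ = Perm.id
permutationAt (ℕ.suc n) i with j , k ← remQuot {ℕ.suc n} (n !) i = Perm.insert zero j (permutationAt n k)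

insert-cong : ∀ {n} j {π ρ : Permutation′ n} → π Perm.≈ ρ → Perm.insert zero j π Perm.≈ Perm.insert zero j ρ
insert-cong j         π≈ρ zero    = ≡.refl
insert-cong j {π} {ρ} π≈ρ (suc i) = ≡.trans (Perm.insert-punchIn zero j π i)
  (≡.trans (≡.cong (punchIn j) (π≈ρ i)) (≡.sym (Perm.insert-punchIn zero j ρ i)))

permutationAt-surjective : ∀ n (σ : Permutation′ n) → ∃[ k ] permutationAt n k Perm.≈ σ
permutationAt-surjective ℕ.zero    σ = zero , λ ()
permutationAt-surjective (ℕ.suc n) σ with k , at-k≈ ← permutationAt-surjective n (Perm.remove zero σ) =
  combine (σ ⟨$⟩ʳ zero) k , λ i → ≡.trans
    (≡.cong (λ (j , k) → Perm.insert zero j (permutationAt n k) ⟨$⟩ʳ i) (Fin.remQuot-combine (σ ⟨$⟩ʳ zero) k))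
    (≡.trans (insert-cong (σ ⟨$⟩ʳ zero) at-k≈ i) (Perm.insert-remove zero σ i))

sumOverSym-at : ∀ n (F : Permutation′ n → ℤ) → sumOverSym n F ≡ sumℤ (F ∘ permutationAt n)
sumOverSym-at ℕ.zero    F = ≡.sym (ℤ.+-identityʳ (F Perm.id))
sumOverSym-at (ℕ.suc n) F = ≡.trans
  (sumℤ-cong λ j → sumOverSym-at n (λ π → F (Perm.insert zero j π)))
  (≡.sym (sumℤ-remQuot {ℕ.suc n} {n !} λ (j , k) → F (Perm.insert zero j (permutationAt n k))))

sumOverSym-zero : ∀ n {F : Permutation′ n → ℤ} → (∀ σ → F σ ≡ 0ℤ) → sumOverSym n F ≡ 0ℤ
sumOverSym-zero n {F} F≡0 = ≡.trans (sumOverSym-at n F) (sumℤ-zero (F ∘ permutationAt n) (F≡0 ∘ permutationAt n))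

sum-sumOverSym-comm : ∀ {k} n (F : Fin k → Permutation′ n → ℤ) →
                      sumℤ (λ a → sumOverSym n (F a)) ≡ sumOverSym n (λ σ → sumℤ (λ a → F a σ))
sum-sumOverSym-comm n F = ≡.trans (sumℤ-cong λ a → sumOverSym-at n (F a))
  (≡.trans (sumℤ-comm λ a → F a ∘ permutationAt n) (≡.sym (sumOverSym-at n _)))

private
  module Π where
    open ProductSums Sign.*-commutativeMonoid public renaming (sum to product; sum-cong-≋ to product-cong)

  signOf : Bool → Sign
  signOf b = if b then Sign.- else Sign.+

-- A pair of positions from different blocks is never an inversion, since `σ ∥ τ` keeps the first
-- block before the second. The double product splits into its two diagonal blocks.
sign-∥ : ∀ {l m} (σ : Permutation′ l) (τ : Permutation′ m) → sign (σ ∥ τ) ≡ sign σ Sign.* sign τ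
sign-∥ {l} {m} σ τ = begin
  sign (σ ∥ τ)
    ≡⟨ Π.sum-++ l (λ i → Π.product λ j → signOf (inversion (σ ∥ τ) i j)) ⟩
  Π.product (λ i → Π.product λ j → signOf (inversion (σ ∥ τ) (i ↑ˡ m) j)) Sign.*
  Π.product (λ i → Π.product λ j → signOf (inversion (σ ∥ τ) (l ↑ʳ i) j))
    ≡⟨ ≡.cong₂ Sign._*_ (Π.product-cong left) (Π.product-cong right) ⟩
  sign σ Sign.* sign τ
    ∎
  where
  open ≡.≡-Reasoning

  ∥-↑ˡ : ∀ i → (σ ∥ τ) ⟨$⟩ʳ (i ↑ˡ m) ≡ (σ ⟨$⟩ʳ i) ↑ˡ m
  ∥-↑ˡ i rewrite Fin.splitAt-↑ˡ l i m = ≡.refl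

  ∥-↑ʳ : ∀ i → (σ ∥ τ) ⟨$⟩ʳ (l ↑ʳ i) ≡ l ↑ʳ (τ ⟨$⟩ʳ i)
  ∥-↑ʳ i rewrite Fin.splitAt-↑ʳ l m i = ≡.refl

  <?-↑ˡ : ∀ (i j : Fin l) → does ((i ↑ˡ m) Fin.<? (j ↑ˡ m)) ≡ does (i Fin.<? j)
  <?-↑ˡ i j rewrite Fin.toℕ-↑ˡ i m | Fin.toℕ-↑ˡ j m = ≡.refl

  <?-↑ʳ : ∀ (i j : Fin m) → does ((l ↑ʳ i) Fin.<? (l ↑ʳ j)) ≡ does (i Fin.<? j)
  <?-↑ʳ i j = does-⇔ (mk⇔
    (λ li<lj → ℕ.+-cancelˡ-< l (toℕ i) (toℕ j) (≡.subst₂ ℕ._<_ (Fin.toℕ-↑ʳ l i) (Fin.toℕ-↑ʳ l j) li<lj))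
    (λ i<j → ≡.subst₂ ℕ._<_ (≡.sym (Fin.toℕ-↑ʳ l i)) (≡.sym (Fin.toℕ-↑ʳ l j)) (ℕ.+-monoʳ-< l i<j)))
    ((l ↑ʳ i) Fin.<? (l ↑ʳ j)) (i Fin.<? j)

  ↑ʳ≮↑ˡ : ∀ (i : Fin m) (j : Fin l) → does ((l ↑ʳ i) Fin.<? (j ↑ˡ m)) ≡ false
  ↑ʳ≮↑ˡ i j = dec-false ((l ↑ʳ i) Fin.<? (j ↑ˡ m)) λ p → ℕ.<-irrefl ≡.refl (ℕ.<-trans
    (≡.subst₂ ℕ._<_ (Fin.toℕ-↑ʳ l i) (Fin.toℕ-↑ˡ j m) p) (ℕ.<-≤-trans (Fin.toℕ<n j) (ℕ.m≤m+n l (toℕ i))))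

  left : ∀ i → Π.product (λ j → signOf (inversion (σ ∥ τ) (i ↑ˡ m) j)) ≡ Π.product (λ j → signOf (inversion σ i j))
  left i = ≡.trans (Π.sum-++ l λ j → signOf (inversion (σ ∥ τ) (i ↑ˡ m) j)) (≡.trans
    (≡.cong₂ Sign._*_
      (Π.product-cong λ j → ≡.cong signOf (≡.cong₂ _∧_ (<?-↑ˡ i j)
        (≡.trans (≡.cong₂ (λ a b → does (a Fin.<? b)) (∥-↑ˡ j) (∥-↑ˡ i)) (<?-↑ˡ (σ ⟨$⟩ʳ j) (σ ⟨$⟩ʳ i)))))
      (Π.sum-zero (λ j → signOf (inversion (σ ∥ τ) (i ↑ˡ m) (l ↑ʳ j))) λ j → ≡.cong signOf (≡.trans
        (≡.cong (does ((i ↑ˡ m) Fin.<? (l ↑ʳ j)) ∧_)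
          (≡.trans (≡.cong₂ (λ a b → does (a Fin.<? b)) (∥-↑ʳ j) (∥-↑ˡ i)) (↑ʳ≮↑ˡ (τ ⟨$⟩ʳ j) (σ ⟨$⟩ʳ i))))
        (Bool.∧-zeroʳ _))))
    (Sign.*-identityʳ _))

  right : ∀ i → Π.product (λ j → signOf (inversion (σ ∥ τ) (l ↑ʳ i) j)) ≡ Π.product (λ j → signOf (inversion τ i j))
  right i = ≡.trans (Π.sum-++ l λ j → signOf (inversion (σ ∥ τ) (l ↑ʳ i) j)) (≡.cong₂ Sign._*_
    (Π.sum-zero (λ j → signOf (inversion (σ ∥ τ) (l ↑ʳ i) (j ↑ˡ m))) λ j →
      ≡.cong (λ b → signOf (b ∧ does (((σ ∥ τ) ⟨$⟩ʳ (j ↑ˡ m)) Fin.<? ((σ ∥ τ) ⟨$⟩ʳ (l ↑ʳ i))))) (↑ʳ≮↑ˡ i j))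
    (Π.product-cong λ j → ≡.cong signOf (≡.cong₂ _∧_ (<?-↑ʳ i j)
      (≡.trans (≡.cong₂ (λ a b → does (a Fin.<? b)) (∥-↑ʳ j) (∥-↑ʳ i)) (<?-↑ʳ (τ ⟨$⟩ʳ j) (τ ⟨$⟩ʳ i))))))

swap₀₁ : ∀ {n} → Permutation′ (ℕ.suc (ℕ.suc n))
swap₀₁ = Perm.swap Perm.id

-- The pair (0, 1) is the only inversion; its factor appears as `Sign.opposite`.
sign-swap₀₁ : ∀ {n} → sign (swap₀₁ {n}) ≡ Sign.-
sign-swap₀₁ {n} = ≡.cong₂ (λ s t → Sign.opposite s Sign.* t) row₀ (≡.cong₂ Sign._*_ row₁ rest)
  where
  row₀ : Π.product {n} (λ k → signOf (inversion swap₀₁ zero (suc (suc k)))) ≡ Sign.+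
  row₀ = Π.sum-zero {n} (λ k → signOf (inversion swap₀₁ zero (suc (suc k)))) λ k → ≡.refl

  row₁ : Π.product {n} (λ k → signOf (inversion swap₀₁ (suc zero) (suc (suc k)))) ≡ Sign.+
  row₁ = Π.sum-zero {n} (λ k → signOf (inversion swap₀₁ (suc zero) (suc (suc k)))) λ k → ≡.refl

  no-inversion : ∀ (i j : Fin n) → inversion swap₀₁ (suc (suc i)) (suc (suc j)) ≡ false
  no-inversion i j with Fin.<-cmp i j
  ... | tri< i<j _ _ = ≡.trans (≡.cong (does (i Fin.<? j) ∧_) (dec-false (j Fin.<? i) (ℕ.<-asym i<j))) (Bool.∧-zeroʳ _)
  ... | tri≈ i≮j _ _ = ≡.cong (_∧ does (j Fin.<? i)) (dec-false (i Fin.<? j) i≮j)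
  ... | tri> i≮j _ _ = ≡.cong (_∧ does (j Fin.<? i)) (dec-false (i Fin.<? j) i≮j)

  rest : Π.product {n} (λ i → Π.product (λ j → signOf (inversion swap₀₁ (suc (suc i)) j))) ≡ Sign.+
  rest = Π.sum-zero (λ i → Π.product (λ j → signOf (inversion swap₀₁ (suc (suc i)) j))) λ i →
    Π.sum-zero (λ k → signOf (inversion swap₀₁ (suc (suc i)) (suc (suc k)))) λ j → ≡.cong signOf (no-inversion i j)

sign-conjugate : ∀ {n} (ω σ : Permutation′ n) → sign (ω ∙ σ ∙ Perm.flip ω) ≡ sign σ
sign-conjugate {n} ω σ = begin
  sign (ω ∙ σ ∙ Perm.flip ω)                          ≡⟨ sign-∙ (ω ∙ σ) (Perm.flip ω) ⟩
  sign (ω ∙ σ) Sign.* sign (Perm.flip ω)              ≡⟨ ≡.cong (Sign._* sign (Perm.flip ω)) (sign-∙ ω σ) ⟩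
  (sign ω Sign.* sign σ) Sign.* sign (Perm.flip ω)    ≡⟨ ≡.cong (Sign._* sign (Perm.flip ω)) (Sign.*-comm (sign ω) (sign σ)) ⟩
  (sign σ Sign.* sign ω) Sign.* sign (Perm.flip ω)    ≡⟨ Sign.*-assoc (sign σ) _ _ ⟩
  sign σ Sign.* (sign ω Sign.* sign (Perm.flip ω))    ≡⟨ ≡.cong (sign σ Sign.*_) (sign-∙ ω (Perm.flip ω)) ⟨
  sign σ Sign.* sign (ω ∙ Perm.flip ω)                ≡⟨ ≡.cong (sign σ Sign.*_) (sign-cong {σ = ω ∙ Perm.flip ω} {τ = Perm.id} (λ _ → Perm.inverseʳ ω)) ⟩
  sign σ Sign.* sign (Perm.id {n})                     ≡⟨ ≡.cong (sign σ Sign.*_) sign-id ⟩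
  sign σ Sign.* Sign.+                                ≡⟨ Sign.*-identityʳ (sign σ) ⟩
  sign σ                                              ∎
  where
  open ≡.≡-Reasoning
  square⇒+ : ∀ s → s ≡ s Sign.* s → s ≡ Sign.+
  square⇒+ s p = ≡.trans p (Sign.s*s≡+ s)
  sign-id : sign (Perm.id {n}) ≡ Sign.+
  sign-id = square⇒+ (sign (Perm.id {n})) (sign-∙ (Perm.id {n}) (Perm.id {n}))

private
  module ℤ-semiring = SemiringSum ℤ.+-*-semiring

i≡-i⇒i≡0 : ∀ i → i ≡ ℤ.- i → i ≡ 0ℤ
i≡-i⇒i≡0 +0       _ = ≡.refl

±-product : ∀ s t i j k → ± s i ℤ.* ± t j ℤ.* ± (s Sign.* t) k ≡ i ℤ.* j ℤ.* k
±-product Sign.+ Sign.+ i j k = ≡.refl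
±-product Sign.+ Sign.- i j k = cancel i j k
  where
  cancel : ∀ i j k → i ℤ.* (ℤ.- j) ℤ.* (ℤ.- k) ≡ i ℤ.* j ℤ.* k
  cancel = solve-∀
±-product Sign.- Sign.+ i j k = cancel i j k
  where
  cancel : ∀ i j k → (ℤ.- i) ℤ.* j ℤ.* (ℤ.- k) ≡ i ℤ.* j ℤ.* k
  cancel = solve-∀
±-product Sign.- Sign.- i j k = cancel i j k
  where
  cancel : ∀ i j k → (ℤ.- i) ℤ.* (ℤ.- j) ℤ.* k ≡ i ℤ.* j ℤ.* k
  cancel = solve-∀

HasRepeatedLetter : ∀ {A : Set} {n} → Vec A n → Set
HasRepeatedLetter w = ∃[ i ] ∃[ j ] i ≢ j × lookup w i ≡ lookup w j

module _ {A : Set} where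

  lookup-· : ∀ {n} (σ : Permutation′ n) (w : Vec A n) i → lookup (σ · w) i ≡ lookup w (σ ⟨$⟩ˡ i)
  lookup-· σ w = Vec.lookup∘tabulate (λ i → lookup w (σ ⟨$⟩ˡ i))

  •-cong : ∀ {n} {w : Vec A n} (σ τ : Permutation′ n) → σ Perm.≈ τ → (r : Rearrangement w) → σ • r ≡ τ • r
  •-cong σ τ σ≈τ r = word-injective (·-cong σ τ σ≈τ (word r))

  •-∙ : ∀ {n} {w : Vec A n} (σ τ : Permutation′ n) (r : Rearrangement w) → (σ ∙ τ) • r ≡ σ • τ • r
  •-∙ σ τ r = word-injective (·-∙ σ τ (word r))

  -- With the two equal letters moved to the front, the odd permutation is always `swap₀₁`, whose
  -- inversions are explicit; `sign-conjugate` carries the sign back to the original word.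
  repeatedLetter-to-front : ∀ {n} (w : Vec A n) → HasRepeatedLetter w →
    ∃[ ω ] ∃[ T ] sign T ≡ Sign.- × T · Perm.flip ω · w ≡ Perm.flip ω · w
  repeatedLetter-to-front {0}                   w (() , _)
  repeatedLetter-to-front {1}                   w (zero , zero , 0≢0 , _) = contradiction ≡.refl 0≢0
  repeatedLetter-to-front {ℕ.suc (ℕ.suc n)} w (i , j , i≢j , wᵢ≡wⱼ) =
    ω , swap₀₁ , sign-swap₀₁ {n} , ≡.trans (Vec.tabulate-cong fixed) (Vec.tabulate∘lookup q)
    where
    ω : Permutation′ (ℕ.suc (ℕ.suc n))
    -- `ω` sends 0 to `i` and 1 to `j`, so that `Perm.flip ω · w` begins with the letters of `w` at
    -- `i` and `j`.
    ω = Perm.insert zero i (Perm.insert zero (punchOut i≢j) Perm.id)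
    q : Vec A (ℕ.suc (ℕ.suc n))
    q = Perm.flip ω · w
    q₀≡q₁ : lookup q zero ≡ lookup q (suc zero)
    q₀≡q₁ = ≡.trans (lookup-· (Perm.flip ω) w zero) (≡.trans wᵢ≡wⱼ (≡.sym (≡.trans
      (lookup-· (Perm.flip ω) w (suc zero)) (≡.cong (lookup w) (≡.trans
        (Perm.insert-punchIn zero i (Perm.insert zero (punchOut i≢j) Perm.id) zero) (Fin.punchIn-punchOut i≢j))))))
    fixed : ∀ k → lookup q (swap₀₁ ⟨$⟩ˡ k) ≡ lookup q k
    fixed zero          = ≡.sym q₀≡q₁
    fixed (suc zero)    = q₀≡q₁
    fixed (suc (suc k)) = ≡.refl

-- Young's character and the columns of the Littlewood-Richardson matrix

module Words {A : Set} (_≟_ : DecidableEquality A) where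

  -- The permutation inside a rearrangement is irrelevant and cannot be extracted. A search through
  -- all permutations finds one, and the irrelevant proof serves only to refute failure.
  rearrangements : ∀ {n} (w : Vec A n) → Fin (n !) ↠ Rearrangement w
  rearrangements {n} w = mk↠ₛ {to = λ k → permutationAt n k • original w} surjective
    where
    impossible : ∀ {v} → ¬ (∃[ k ] permutationAt n k · w ≡ v) → ∃[ σ ] σ · w ≡ v → ⊥
    impossible ¬∃ (σ , σw≡v) with k , at-k≈σ ← permutationAt-surjective n σ =
      ¬∃ (k , ≡.trans (·-cong (permutationAt n k) σ at-k≈σ w) σw≡v)
    surjective : ∀ r → ∃[ k ] permutationAt n k • original w ≡ r
    surjective (v by inOrbit) with Fin.any? (λ k → Vec.≡-dec _≟_ (permutationAt n k · w) v)
    ... | yes (k , eq) = k , word-injective eq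
    ... | no  ¬∃       = ⊥-elim-irr (impossible ¬∃ inOrbit)

  -- If `q` is the word with two equal letters in front and `p` is `ρω · q`, then conjugating by
  -- `ρω` a swap that fixes `q` gives one that fixes `p`, with the same sign.
  odd-stabilizer : ∀ {n} {w : Vec A n} → HasRepeatedLetter w → (p : Rearrangement w) →
                   ∃[ T ] sign T ≡ Sign.- × T • p ≡ p
  odd-stabilizer {n} {w} repeated p
    with k , ρ•w≡p ← Surjection.strictlySurjective (rearrangements w) p
    with ω , T , odd , fixed ← repeatedLetter-to-front w repeated =
    ρω ∙ T ∙ Perm.flip ρω , ≡.trans (sign-conjugate ρω T) odd , word-injective (begin
      (ρω ∙ T ∙ Perm.flip ρω) · word p     ≡⟨ ·-∙ (ρω ∙ T) (Perm.flip ρω) (word p) ⟩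
      (ρω ∙ T) · Perm.flip ρω · word p     ≡⟨ ≡.cong ((ρω ∙ T) ·_) (·-flip ρω {word p} {q} p≡ρωq) ⟩
      (ρω ∙ T) · q                         ≡⟨ ·-∙ ρω T q ⟩
      ρω · T · q                           ≡⟨ ≡.cong (ρω ·_) fixed ⟩
      ρω · q                               ≡⟨ p≡ρωq ⟨
      word p                               ∎)
    where
    open ≡.≡-Reasoning
    ρ ρω : Permutation′ n
    ρ = permutationAt n k
    ρω = ρ ∙ ω
    q : Vec A n
    q = Perm.flip ω · w
    p≡ρωq : word p ≡ ρω · q
    p≡ρωq = begin
      word p        ≡⟨ ≡.cong word ρ•w≡p ⟨
      ρ · w         ≡⟨ ≡.cong (ρ ·_) (·-flip (Perm.flip ω) {q} {w} ≡.refl) ⟨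
      ρ · ω · q     ≡⟨ ·-∙ ρ ω q ⟨
      ρω · q        ∎

  -- Left translation by the inverse of an odd `T` fixing `p` preserves the sum, while
  -- `young-equivariant` makes it change sign; so it equals its own negative.
  young-sum-zero : ∀ {n} (a b : Vec A n) → HasRepeatedLetter b → (s : Rearrangement a) (p : Rearrangement b) →
                   ∑[ σ ∈Sym n ] young _≟_ a b (σ • s) p ≡ 0ℤ
  young-sum-zero {n} a b repeated s p with T , odd , T•p≡p ← odd-stabilizer repeated p =
    i≡-i⇒i≡0 (sumOverSym n F) (begin
      sumOverSym n F                            ≡⟨ sumOverSym-translate n F F-cong (Perm.flip T) ⟨
      ∑[ σ ∈Sym n ] F (Perm.flip T ∙ σ)         ≡⟨ sumOverSym-cong n (negated T odd T•p≡p) ⟩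
      ∑[ σ ∈Sym n ] (ℤ.- F σ)                   ≡⟨ sumOverSym-neg n F ⟩
      ℤ.- sumOverSym n F                        ∎)
    where
    open ≡.≡-Reasoning
    F : Permutation′ n → ℤ
    F σ = young _≟_ a b (σ • s) p
    F-cong : ∀ σ τ → σ Perm.≈ τ → F σ ≡ F τ
    F-cong σ τ σ≈τ = ≡.cong (λ r → young _≟_ a b r p) (•-cong σ τ σ≈τ s)
    negated : ∀ T → sign T ≡ Sign.- → T • p ≡ p → ∀ σ → F (Perm.flip T ∙ σ) ≡ ℤ.- F σ
    negated T odd T•p≡p σ = begin
      F (Perm.flip T ∙ σ)                          ≡⟨ ≡.cong (λ r → young _≟_ a b r p) (•-∙ (Perm.flip T) σ s) ⟩
      young _≟_ a b (Perm.flip T • σ • s) p        ≡⟨ young-equivariant _≟_ a b T (σ • s) p ⟩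
      ± (sign T) (young _≟_ a b (σ • s) (T • p))   ≡⟨ ≡.cong₂ (λ ε r → ± ε (young _≟_ a b (σ • s) r)) odd T•p≡p ⟩
      ℤ.- F σ                                      ∎

  young-swap : ∀ {n} (a b : Vec A n) r r′ → young _≟_ a b r r′ ≡ young _≟_ b a r′ r
  young-swap {n} a b r r′ = sumOverSym-cong n λ σ → ≡.cong (λ c → if c then sgn σ else 0ℤ)
    (Bool.∧-comm (does (Vec.≡-dec _≟_ (σ · a) (word r))) (does (Vec.≡-dec _≟_ (σ · b) (word r′))))

  -- Moves `σ` from the column index, where the Littlewood-Richardson matrix has it, to the row
  -- index, where it acts on vectors of the Specht module; the price is the sign.
  young-move : ∀ {n} (a b : Vec A n) σ p s → young _≟_ b a (σ • s) p ≡ ± (sign σ) (young _≟_ a b (Perm.flip σ • p) s)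
  young-move a b σ p s = begin
    young _≟_ b a (σ • s) p                               ≡⟨ young-swap b a (σ • s) p ⟩
    young _≟_ a b p (σ • s)                               ≡⟨ ±-involutive (sign σ) _ ⟨
    ± (sign σ) (± (sign σ) (young _≟_ a b p (σ • s)))     ≡⟨ ≡.cong (± (sign σ)) (young-equivariant _≟_ a b σ p s) ⟨
    ± (sign σ) (young _≟_ a b (Perm.flip σ • p) s)        ∎
    where
    open ≡.≡-Reasoning
    ±-involutive : ∀ s i → ± s (± s i) ≡ i
    ±-involutive Sign.+ i = ≡.refl
    ±-involutive Sign.- i = ℤ.neg-involutive i

  module _ {l m} (x₁ x₂ : Vec A l) (y₁ y₂ : Vec A m) (w₁ w₂ : Vec A (l ℕ.+ m)) where
    open LittlewoodRichardson _≟_ x₁ x₂ y₁ y₂ w₁ w₂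

    youngProduct : Row → Column → ℤ
    youngProduct (p , q , r) (s , t , u) = young _≟_ x₁ x₂ p s ℤ.* young _≟_ y₁ y₂ q t ℤ.* young _≟_ w₁ w₂ r u

    -- Inverses appear because a group element acts on a function by precomposing with its inverse;
    -- hence `moveRow-∙` reverses the order of the factors.
    moveRow : Permutation′ l × Permutation′ m → Row → Row
    moveRow (σ , τ) (p , q , r) = Perm.flip σ • p , Perm.flip τ • q , Perm.flip (σ ∥ τ) • r

    moveRow-∙ : ∀ σ τ σ′ τ′ ρ → moveRow (σ′ , τ′) (moveRow (σ , τ) ρ) ≡ moveRow (σ ∙ σ′ , τ ∙ τ′) ρ
    moveRow-∙ σ τ σ′ τ′ (p , q , r) = ≡.cong₂ _,_ (≡.sym (•-∙ (Perm.flip σ′) (Perm.flip σ) p))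
      (≡.cong₂ _,_ (≡.sym (•-∙ (Perm.flip τ′) (Perm.flip τ) q))
        (≡.trans (≡.sym (•-∙ (Perm.flip (σ′ ∥ τ′)) (Perm.flip (σ ∥ τ)) r))
          (•-cong (Perm.flip (σ′ ∥ τ′) ∙ Perm.flip (σ ∥ τ)) (Perm.flip ((σ ∙ σ′) ∥ (τ ∙ τ′)))
            (λ i → ≡.sym (∥-homo (Perm.flip σ′ , Perm.flip τ′) (Perm.flip σ , Perm.flip τ) i)) r)))
      where
      open GroupMorphisms.IsGroupHomomorphism (∥-homomorphism l m) using () renaming (homo to ∥-homo)

    moveRow-cong : ∀ {σ σ′ τ τ′} → σ Perm.≈ σ′ → τ Perm.≈ τ′ → ∀ ρ → moveRow (σ , τ) ρ ≡ moveRow (σ′ , τ′) ρ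
    moveRow-cong {σ} {σ′} {τ} {τ′} σ≈σ′ τ≈τ′ (p , q , r) = ≡.cong₂ _,_
      (•-cong (Perm.flip σ) (Perm.flip σ′) (Perm-cong-⟨$⟩ˡ σ σ′ σ≈σ′) p)
      (≡.cong₂ _,_ (•-cong (Perm.flip τ) (Perm.flip τ′) (Perm-cong-⟨$⟩ˡ τ τ′ τ≈τ′) q)
        (•-cong (Perm.flip (σ ∥ τ)) (Perm.flip (σ′ ∥ τ′))
          (Perm-cong-⟨$⟩ˡ (σ ∥ τ) (σ′ ∥ τ′) (⟦⟧-cong {σ , τ} {σ′ , τ′} (σ≈σ′ , τ≈τ′))) r))
      where
      open GroupMorphisms.IsGroupHomomorphism (∥-homomorphism l m) using (⟦⟧-cong)

    -- The three signs of σ, τ and σ ∥ τ cancel.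
    matrix-orbitSum : ∀ ρ c → matrix ρ c ≡ ∑[ σ ∈Sym l ] ∑[ τ ∈Sym m ] youngProduct (moveRow (σ , τ) ρ) c
    matrix-orbitSum (p , q , r) (s , t , u) = sumOverSym-cong l λ σ → sumOverSym-cong m λ τ → begin
      young _≟_ x₂ x₁ (σ • s) p ℤ.* young _≟_ y₂ y₁ (τ • t) q ℤ.* young _≟_ w₂ w₁ ((σ ∥ τ) • u) r
        ≡⟨ ≡.cong₂ ℤ._*_ (≡.cong₂ ℤ._*_ (young-move x₁ x₂ σ p s) (young-move y₁ y₂ τ q t))
             (≡.trans (young-move w₁ w₂ (σ ∥ τ) r u) (≡.cong (λ ε → ± ε (Z σ τ)) (sign-∥ σ τ))) ⟩
      ± (sign σ) (X σ) ℤ.* ± (sign τ) (Y τ) ℤ.* ± (sign σ Sign.* sign τ) (Z σ τ)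
        ≡⟨ ±-product (sign σ) (sign τ) (X σ) (Y τ) (Z σ τ) ⟩
      X σ ℤ.* Y τ ℤ.* Z σ τ
        ∎
      where
      open ≡.≡-Reasoning
      X : Permutation′ l → ℤ
      X σ = young _≟_ x₁ x₂ (Perm.flip σ • p) s
      Y : Permutation′ m → ℤ
      Y τ = young _≟_ y₁ y₂ (Perm.flip τ • q) t
      Z : Permutation′ l → Permutation′ m → ℤ
      Z σ τ = young _≟_ w₁ w₂ (Perm.flip (σ ∥ τ) • r) u

    -- Moving the row left-translates the summation variables of the orbit sum, one symmetric group
    -- at a time.
    matrix-invariant : ∀ g ρ c → matrix (moveRow g ρ) c ≡ matrix ρ c
    matrix-invariant (σ , τ) ρ c = begin
      matrix (moveRow (σ , τ) ρ) c
        ≡⟨ matrix-orbitSum (moveRow (σ , τ) ρ) c ⟩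
      ∑[ σ′ ∈Sym l ] ∑[ τ′ ∈Sym m ] youngProduct (moveRow (σ′ , τ′) (moveRow (σ , τ) ρ)) c
        ≡⟨ sumOverSym-cong l (λ σ′ → sumOverSym-cong m λ τ′ → ≡.cong (λ ρ′ → youngProduct ρ′ c) (moveRow-∙ σ τ σ′ τ′ ρ)) ⟩
      ∑[ σ′ ∈Sym l ] ∑[ τ′ ∈Sym m ] F (σ ∙ σ′) (τ ∙ τ′)
        ≡⟨ sumOverSym-cong l (λ σ′ → sumOverSym-translate m (F (σ ∙ σ′)) (λ τ′ τ″ τ′≈τ″ →
             F-cong {σ ∙ σ′} {σ ∙ σ′} {τ′} {τ″} (λ _ → ≡.refl) τ′≈τ″) τ) ⟩
      ∑[ σ′ ∈Sym l ] ∑[ τ′ ∈Sym m ] F (σ ∙ σ′) τ′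
        ≡⟨ sumOverSym-translate l (λ σ′ → ∑[ τ′ ∈Sym m ] F σ′ τ′) (λ σ′ σ″ σ′≈σ″ → sumOverSym-cong m λ τ′ →
             F-cong {σ′} {σ″} {τ′} {τ′} σ′≈σ″ (λ _ → ≡.refl)) σ ⟩
      ∑[ σ′ ∈Sym l ] ∑[ τ′ ∈Sym m ] F σ′ τ′
        ≡⟨ matrix-orbitSum ρ c ⟨
      matrix ρ c
        ∎
      where
      open ≡.≡-Reasoning
      F : Permutation′ l → Permutation′ m → ℤ
      F σ′ τ′ = youngProduct (moveRow (σ′ , τ′) ρ) c
      F-cong : ∀ {σ σ′ τ τ′} → σ Perm.≈ σ′ → τ Perm.≈ τ′ → F σ τ ≡ F σ′ τ′
      F-cong {σ} {σ′} {τ} {τ′} σ≈σ′ τ≈τ′ = ≡.cong (λ ρ′ → youngProduct ρ′ c) (moveRow-cong {σ} {σ′} {τ} {τ′} σ≈σ′ τ≈τ′ ρ)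

    private
      translated-sum-zero : ∀ {n} (a b : Vec A n) → HasRepeatedLetter b → (s : Rearrangement a) (p : Rearrangement b) (σ : Permutation′ n) →
        sumℤ {n !} (λ k → young _≟_ a b (σ • permutationAt n k • s) p) ≡ 0ℤ
      translated-sum-zero {n} a b repeated s p σ = begin
        sumℤ {n !} (λ k → young _≟_ a b (σ • permutationAt n k • s) p)
          ≡⟨ sumℤ-cong {n !} (λ k → ≡.cong (λ r → young _≟_ a b r p) (•-∙ σ (permutationAt n k) s)) ⟨
        sumℤ {n !} (λ k → young _≟_ a b ((σ ∙ permutationAt n k) • s) p)
          ≡⟨ sumOverSym-at n (λ α → young _≟_ a b ((σ ∙ α) • s) p) ⟨
        ∑[ α ∈Sym n ] young _≟_ a b ((σ ∙ α) • s) p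
          ≡⟨ sumOverSym-translate n (λ α → young _≟_ a b (α • s) p)
               (λ α β α≈β → ≡.cong (λ r → young _≟_ a b r p) (•-cong α β α≈β s)) σ ⟩
        ∑[ α ∈Sym n ] young _≟_ a b (α • s) p
          ≡⟨ young-sum-zero a b repeated s p ⟩
        0ℤ
          ∎
        where open ≡.≡-Reasoning

      columnTerm : Permutation′ l → Permutation′ m → Row → Column → ℤ
      columnTerm σ τ (p , q , r) (s , t , u) =
        young _≟_ x₂ x₁ (σ • s) p ℤ.* young _≟_ y₂ y₁ (τ • t) q ℤ.* young _≟_ w₂ w₁ ((σ ∥ τ) • u) r

      -- The sum over columns is interchanged with those over the two groups, so cancellation may be
      -- shown for each `σ` and `τ` separately.
      matrix-sum-zero : ∀ {k} ρ (c : Fin k → Column) →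
        (∀ σ τ → sumℤ (columnTerm σ τ ρ ∘ c) ≡ 0ℤ) → sumℤ (matrix ρ ∘ c) ≡ 0ℤ
      matrix-sum-zero {k} ρ c term≡0 = ≡.trans (sum-sumOverSym-comm l λ a σ → ∑[ τ ∈Sym m ] term σ τ a) (sumOverSym-zero l λ σ →
        ≡.trans (sum-sumOverSym-comm m λ a τ → term σ τ a) (sumOverSym-zero m λ τ → term≡0 σ τ))
        where
        term : Permutation′ l → Permutation′ m → Fin k → ℤ
        term σ τ a = columnTerm σ τ ρ (c a)

    -- Indexed by permutations instead of rearrangements: repeated columns are harmless in an affine
    -- combination, and translation invariance of sums over the group applies. The other two indices
    -- are arbitrary fixed ones.
    xColumns : Fin (l !) → Column
    xColumns k = permutationAt l k • original x₂ , original y₂ , original w₂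

    columns-sum-zero-x : HasRepeatedLetter x₁ → ∀ ρ →
      sumℤ (matrix ρ ∘ xColumns) ≡ 0ℤ
    columns-sum-zero-x repeated (p , q , r) = matrix-sum-zero (p , q , r) xColumns λ σ τ →
      let X = λ k → young _≟_ x₂ x₁ (σ • permutationAt l k • original x₂) p
          Y = young _≟_ y₂ y₁ (τ • original y₂) q
          Z = young _≟_ w₂ w₁ ((σ ∥ τ) • original w₂) r
      in begin
      sumℤ {l !} (λ k → X k ℤ.* Y ℤ.* Z)   ≡⟨ ℤ-semiring.*-distribʳ-sum {l !} Z (λ k → X k ℤ.* Y) ⟨
      sumℤ {l !} (λ k → X k ℤ.* Y) ℤ.* Z   ≡⟨ ≡.cong (ℤ._* Z) (ℤ-semiring.*-distribʳ-sum {l !} Y X) ⟨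
      sumℤ {l !} X ℤ.* Y ℤ.* Z             ≡⟨ ≡.cong (λ i → i ℤ.* Y ℤ.* Z) (translated-sum-zero x₂ x₁ repeated (original x₂) p σ) ⟩
      0ℤ                                   ∎
      where open ≡.≡-Reasoning

    yColumns : Fin (m !) → Column
    yColumns k = original x₂ , permutationAt m k • original y₂ , original w₂

    columns-sum-zero-y : HasRepeatedLetter y₁ → ∀ ρ →
      sumℤ (matrix ρ ∘ yColumns) ≡ 0ℤ
    columns-sum-zero-y repeated (p , q , r) = matrix-sum-zero (p , q , r) yColumns λ σ τ →
      let X = young _≟_ x₂ x₁ (σ • original x₂) p
          Y = λ k → young _≟_ y₂ y₁ (τ • permutationAt m k • original y₂) q
          Z = young _≟_ w₂ w₁ ((σ ∥ τ) • original w₂) r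
      in begin
      sumℤ {m !} (λ k → X ℤ.* Y k ℤ.* Z)   ≡⟨ ℤ-semiring.*-distribʳ-sum {m !} Z (λ k → X ℤ.* Y k) ⟨
      sumℤ {m !} (λ k → X ℤ.* Y k) ℤ.* Z   ≡⟨ ≡.cong (ℤ._* Z) (ℤ-semiring.*-distribˡ-sum {m !} X Y) ⟨
      X ℤ.* sumℤ {m !} Y ℤ.* Z             ≡⟨ ≡.cong (λ i → X ℤ.* i ℤ.* Z) (translated-sum-zero y₂ y₁ repeated (original y₂) q τ) ⟩
      X ℤ.* 0ℤ ℤ.* Z                       ≡⟨ ≡.cong (ℤ._* Z) (ℤ.*-zeroʳ X) ⟩
      0ℤ                                   ∎
      where open ≡.≡-Reasoning

    wColumns : Fin ((l ℕ.+ m) !) → Column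
    wColumns k = original x₂ , original y₂ , permutationAt (l ℕ.+ m) k • original w₂

    columns-sum-zero-w : HasRepeatedLetter w₁ → ∀ ρ →
      sumℤ (matrix ρ ∘ wColumns) ≡ 0ℤ
    columns-sum-zero-w repeated (p , q , r) = matrix-sum-zero (p , q , r) wColumns λ σ τ →
      let X = young _≟_ x₂ x₁ (σ • original x₂) p
          Y = young _≟_ y₂ y₁ (τ • original y₂) q
          Z = λ k → young _≟_ w₂ w₁ ((σ ∥ τ) • permutationAt (l ℕ.+ m) k • original w₂) r
      in begin
      sumℤ {(l ℕ.+ m) !} (λ k → X ℤ.* Y ℤ.* Z k)   ≡⟨ ℤ-semiring.*-distribˡ-sum {(l ℕ.+ m) !} (X ℤ.* Y) Z ⟨
      X ℤ.* Y ℤ.* sumℤ {(l ℕ.+ m) !} Z             ≡⟨ ≡.cong (X ℤ.* Y ℤ.*_) (translated-sum-zero w₂ w₁ repeated (original w₂) r (σ ∥ τ)) ⟩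
      X ℤ.* Y ℤ.* 0ℤ                               ≡⟨ ℤ.*-zeroʳ (X ℤ.* Y) ⟩
      0ℤ                                           ∎
      where open ≡.≡-Reasoning

-- Partitions and scalars

module _ {A : Set} (_≟_ : DecidableEquality A) where

  occurs : ∀ {n} (w : Vec A n) {a} → 1 ℕ.≤ occurrences _≟_ w a → ∃[ i ] a ≡ lookup w i
  occurs (x ∷ w) {a} 1≤ with a ≟ x
  ... | yes a≡x = zero , a≡x
  ... | no  _   with i , a≡ ← occurs w 1≤ = suc i , a≡

  occursTwice : ∀ {n} (w : Vec A n) {a} → 2 ℕ.≤ occurrences _≟_ w a → HasRepeatedLetter w
  occursTwice (x ∷ w) {a} 2≤ with a ≟ x
  ... | yes a≡x with i , a≡ ← occurs w (ℕ.s≤s⁻¹ 2≤) = zero , suc i , (λ ()) , ≡.trans (≡.sym a≡x) a≡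
  ... | no  _   with i , j , i≢j , eq ← occursTwice w 2≤ = suc i , suc j , i≢j ∘ Fin.suc-injective , eq

  -- The bound `1 ≤ k` excludes the entries beyond the end of the list, which are 0 and belong to no
  -- letter.
  entry-map : ∀ (f : A → ℕ) as j {k} → 1 ℕ.≤ k → k ℕ.≤ entry (List.map f as) j → ∃[ a ] k ℕ.≤ f a
  entry-map f []       j         1≤k k≤ = contradiction (ℕ.≤-trans 1≤k k≤) λ ()
  entry-map f (a ∷ as) ℕ.zero    1≤k k≤ = a , k≤
  entry-map f (a ∷ as) (ℕ.suc j) 1≤k k≤ = entry-map f as j 1≤k k≤

  largeEntry : ∀ {ks} → ¬ All (ℕ._≤ 1) ks → ∃[ j ] 2 ℕ.≤ entry ks j
  largeEntry {[]}     ¬all = contradiction [] ¬all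
  largeEntry {k ∷ ks} ¬all with k ℕ.≤? 1
  ... | no  k≰1 = 0 , ℕ.≰⇒> k≰1
  ... | yes k≤1 with j , 2≤ ← largeEntry {ks} (¬all ∘ (k≤1 ∷_)) = ℕ.suc j , 2≤

  -- A part that exceeds 1 is the multiplicity of some letter.
  repeatedLetter : ∀ {n} {w : Vec A n} (κ : Partition n) → HasMultiplicities _≟_ w (entry (parts κ)) →
                   ¬ SingleColumn κ → HasRepeatedLetter w
  repeatedLetter {w = w} κ multiplicity ¬single
    with j , 2≤ ← largeEntry ¬single
    with a , 2≤occ ← entry-map (occurrences _≟_ w) (HasMultiplicities.letters multiplicity) j (ℕ.s≤s ℕ.z≤n)
           (ℕ.≤-trans 2≤ (ℕ.≤-reflexive (≡.sym (HasMultiplicities.multiplicities multiplicity j)))) =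
    occursTwice w 2≤occ

-- Integers and rationals inside the scalars

ℚ-zero-or-unit : ∀ q → q ≡ 0ℚ ⊎ ∃[ r ] r ℚ.* q ≡ 1ℚ
ℚ-zero-or-unit q with q ℚ.≟ 0ℚ
... | yes q≡0 = inj₁ q≡0
... | no  q≢0 = inj₂ (ℚ.1/_ q {{ℚ.≢-nonZero q≢0}} , ℚ.*-inverseˡ q {{ℚ.≢-nonZero q≢0}})

toℚ : ℤ → ℚ
toℚ i = i ℚ./ 1

private
  toℚᵘ-toℚ : ∀ i → ℚ.toℚᵘ (toℚ i) ℚᵘ.≃ ℚᵘ.mkℚᵘ i 0
  toℚᵘ-toℚ i = ℚᵘ.≃-trans (ℚᵘ.≃-reflexive (≡.cong ℚ.toℚᵘ (toℚ≡fromℚᵘ i))) (ℚ.toℚᵘ-fromℚᵘ (ℚᵘ.mkℚᵘ i 0))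
    where
    toℚ≡fromℚᵘ : ∀ i → toℚ i ≡ ℚ.fromℚᵘ (ℚᵘ.mkℚᵘ i 0)
    toℚ≡fromℚᵘ +0       = ≡.refl
    toℚ≡fromℚᵘ +[1+ n ] = ≡.refl
    toℚ≡fromℚᵘ -[1+ n ] = ≡.refl

  -- Fractions in ℚ are kept in lowest terms, so the comparison is made among unnormalised
  -- fractions, where integers have denominator 1.
  toℚ-+ : ∀ i j → toℚ (i ℤ.+ j) ≡ toℚ i ℚ.+ toℚ j
  toℚ-+ i j = ℚ.toℚᵘ-injective (begin
    ℚ.toℚᵘ (toℚ (i ℤ.+ j))                     ≈⟨ toℚᵘ-toℚ (i ℤ.+ j) ⟩
    ℚᵘ.mkℚᵘ (i ℤ.+ j) 0                         ≡⟨ ≡.cong₂ (λ i j → ℚᵘ.mkℚᵘ (i ℤ.+ j) 0) (ℤ.*-identityʳ i) (ℤ.*-identityʳ j) ⟨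
    ℚᵘ.mkℚᵘ i 0 ℚᵘ.+ ℚᵘ.mkℚᵘ j 0                ≈⟨ ℚᵘ.+-cong (toℚᵘ-toℚ i) (toℚᵘ-toℚ j) ⟨
    ℚ.toℚᵘ (toℚ i) ℚᵘ.+ ℚ.toℚᵘ (toℚ j)          ≈⟨ ℚ.toℚᵘ-homo-+ (toℚ i) (toℚ j) ⟨
    ℚ.toℚᵘ (toℚ i ℚ.+ toℚ j)                   ∎)
    where open ℚᵘ.≃-Reasoning

  toℚ-* : ∀ i j → toℚ (i ℤ.* j) ≡ toℚ i ℚ.* toℚ j
  toℚ-* i j = ℚ.toℚᵘ-injective (begin
    ℚ.toℚᵘ (toℚ (i ℤ.* j))                     ≈⟨ toℚᵘ-toℚ (i ℤ.* j) ⟩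
    ℚᵘ.mkℚᵘ i 0 ℚᵘ.* ℚᵘ.mkℚᵘ j 0                ≈⟨ ℚᵘ.*-cong (toℚᵘ-toℚ i) (toℚᵘ-toℚ j) ⟨
    ℚ.toℚᵘ (toℚ i) ℚᵘ.* ℚ.toℚᵘ (toℚ j)          ≈⟨ ℚ.toℚᵘ-homo-* (toℚ i) (toℚ j) ⟨
    ℚ.toℚᵘ (toℚ i ℚ.* toℚ j)                   ∎)
    where open ℚᵘ.≃-Reasoning

toℚ-homomorphism : SemiringHomomorphism ℤ.+-*-commutativeRing ℚ.+-*-commutativeRing toℚ
toℚ-homomorphism = record
  { isNearSemiringHomomorphism = record
    { +-isMonoidHomomorphism = record
      { isMagmaHomomorphism = record
        { isRelHomomorphism = record { cong = ≡.cong toℚ }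
        ; homo = toℚ-+
        }
      ; ε-homo = ≡.refl
      }
    ; *-homo = toℚ-*
    }
  ; 1#-homo = ≡.refl
  }

fromℚ : ℚ → ℝ
fromℚ q = (λ _ → q) , RealProperties.const-~ q

fromℚ-homomorphism : SemiringHomomorphism ℚ.+-*-commutativeRing ℝ-commutativeRing fromℚ
fromℚ-homomorphism = record
  { isNearSemiringHomomorphism = record
    { +-isMonoidHomomorphism = record
      { isMagmaHomomorphism = record
        { isRelHomomorphism = record { cong = λ {p} p≡q → RealProperties.≗⇒~ (RealProperties.const-~ p) λ _ → p≡q }
        ; homo = λ p q → RealProperties.const-~ (p ℚ.+ q)
        }
      ; ε-homo = RealProperties.const-~ 0ℚ
      }
    ; *-homo = λ p q → RealProperties.const-~ (p ℚ.* q)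
    }
  ; 1#-homo = RealProperties.const-~ 1ℚ
  }

module _ (R : CommutativeRing 0ℓ 0ℓ) where
  open CommutativeRing R
  open import Algebra.Properties.Ring ring using (-0#≈0#)

  -- This is the inclusion of the ring as the real part of its complexification, not the projection.
  realPart-homomorphism : SemiringHomomorphism R (Complexification.complexRing R) (_, 0#)
  realPart-homomorphism = record
    { isNearSemiringHomomorphism = record
      { +-isMonoidHomomorphism = record
        { isMagmaHomomorphism = record
          { isRelHomomorphism = record { cong = λ x≈y → x≈y , refl }
          ; homo = λ x y → refl , sym (+-identityˡ 0#)
          }
        ; ε-homo = refl , refl
        }
      ; *-homo = λ x y →
            sym (trans (+-congˡ (trans (-‿cong (zeroˡ 0#)) -0#≈0#)) (+-identityʳ (x * y)))
          , sym (trans (+-cong (zeroʳ x) (zeroˡ y)) (+-identityˡ 0#))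
      }
    ; 1#-homo = refl , refl
    }

SemiringHomomorphism-∘ : ∀ (A B C : CommutativeRing 0ℓ 0ℓ) {f g} →
  SemiringHomomorphism A B f → SemiringHomomorphism B C g → SemiringHomomorphism A C (g ∘ f)
SemiringHomomorphism-∘ A B C = Composition.isSemiringHomomorphism (CommutativeRing.trans C)

fromℚᶜ : ℚ → CommutativeRing.Carrier ℂ-commutativeRing
fromℚᶜ q = fromℚ q , CommutativeRing.0# ℝ-commutativeRing

fromℚᶜ-homomorphism : SemiringHomomorphism ℚ.+-*-commutativeRing ℂ-commutativeRing fromℚᶜ
fromℚᶜ-homomorphism = SemiringHomomorphism-∘ ℚ.+-*-commutativeRing ℝ-commutativeRing ℂ-commutativeRing
  fromℚ-homomorphism (realPart-homomorphism ℝ-commutativeRing)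

private
  module ℚΣ where
    open ProductSums (CommutativeRing.+-commutativeMonoid ℚ.+-*-commutativeRing) public
    open SemiringSum (CommutativeRing.semiring ℚ.+-*-commutativeRing) public using (*-distribˡ-sum)

-- The weight is 1/n. The sum of `n` ones is invertible because it is positive, being 1 plus a
-- nonnegative sum. It serves both for averaging over the group and for affine combinations.
equalWeights : ∀ n .{{_ : ℕ.NonZero n}} → ∃[ q ] ℚΣ.sum {n} (λ _ → q) ≡ 1ℚ
equalWeights (ℕ.suc n) with ℚ-zero-or-unit (ℚΣ.sum {ℕ.suc n} λ _ → 1ℚ)
... | inj₁ sum≡0     = contradiction (≡.sym sum≡0) (ℚ.<⇒≢ (ℚ.+-mono-<-≤ (ℚ.positive⁻¹ 1ℚ) (sum≥0 n)))
  where
  sum≥0 : ∀ n → 0ℚ ℚ.≤ ℚΣ.sum {n} (λ _ → 1ℚ)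
  sum≥0 ℕ.zero    = ℚ.≤-refl
  sum≥0 (ℕ.suc n) = ℚ.+-mono-≤ (ℚ.nonNegative⁻¹ 1ℚ) (sum≥0 n)
... | inj₂ (q , q*) = q , (begin
  ℚΣ.sum {ℕ.suc n} (λ _ → q)              ≡⟨ ℚΣ.sum-cong-≋ {ℕ.suc n} (λ _ → ℚ.*-identityʳ q) ⟨
  ℚΣ.sum {ℕ.suc n} (λ _ → q ℚ.* 1ℚ)       ≡⟨ ℚΣ.*-distribˡ-sum {ℕ.suc n} q (λ _ → 1ℚ) ⟨
  q ℚ.* ℚΣ.sum {ℕ.suc n} (λ _ → 1ℚ)       ≡⟨ q* ⟩
  1ℚ                                      ∎)
  where open ≡.≡-Reasoning

module Rational (R : CommutativeRing 0ℓ 0ℓ) {h : ℚ → CommutativeRing.Carrier R}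
                (h-homomorphism : SemiringHomomorphism ℚ.+-*-commutativeRing R h) where
  open CommutativeRing R hiding (zero) renaming (Carrier to K)
  open LinearAlgebra R
  open LinearMaps R
  open ProductSums +-commutativeMonoid
  open SemiringMorphisms.IsSemiringHomomorphism h-homomorphism using (1#-homo)
  open SetoidReasoning setoid

  h∘toℚ-homomorphism : SemiringHomomorphism ℤ.+-*-commutativeRing R (h ∘ toℚ)
  h∘toℚ-homomorphism = SemiringHomomorphism-∘ ℤ.+-*-commutativeRing ℚ.+-*-commutativeRing R
    toℚ-homomorphism h-homomorphism

  open SemiringMorphisms.IsSemiringHomomorphism h∘toℚ-homomorphism public using ()
    renaming (*-homo to h∘toℚ-*; 0#-homo to h∘toℚ-0)
  open BaseChange ℤ.+-*-commutativeRing R h∘toℚ-homomorphism public using ()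
    renaming (sum-homo to h∘toℚ-sum)
  private module ℚ→R = BaseChange ℚ.+-*-commutativeRing R h-homomorphism

  total-weight : ∀ n {q} → ℚΣ.sum {n} (λ _ → q) ≡ 1ℚ → sum {n} (λ _ → h q) ≈ 1#
  total-weight n {q} eq = trans (sym (ℚ→R.sum-homo {n} λ _ → q)) (trans (reflexive (≡.cong h eq)) 1#-homo)

  sum-rational : ∀ {n} (v : Vector K n) (f : Vector ℤ n) {i} →
                 (∀ k → v k ≈ h (toℚ (f k))) → sumℤ f ≡ i → sum v ≈ h (toℚ i)
  sum-rational v f v≈f ≡.refl = trans (sum-cong-≋ v≈f) (sym (h∘toℚ-sum f))

  -- The mean of a nonempty family of columns with sum zero is an affine combination equal to 0.
  zero-in-hull : ∀ {I J : Set} (M : I → J → ℤ) {P : (I → K) → Set} → (∀ j → P (λ x → h (toℚ (M x j)))) →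
    ∀ {n} .{{_ : ℕ.NonZero n}} (c : Fin n → J) → (∀ x → sumℤ (M x ∘ c) ≡ 0ℤ) →
    AffineHull (functions I) P (λ _ → 0#)
  zero-in-hull M columns {n} c zero-sum with q , q-total ← equalWeights n =
    n , (λ a x → h (toℚ (M x (c a)))) , (λ _ → h q) , columns ∘ c , total-weight n q-total , λ x → sym (begin
      combination (functions _) (λ _ → h q) (λ a x → h (toℚ (M x (c a)))) x
        ≡⟨ combination-functions (λ _ → h q) (λ a x → h (toℚ (M x (c a)))) x ⟩
      sum (λ a → h q * h (toℚ (M x (c a))))
        ≈⟨ SemiringSum.*-distribˡ-sum semiring (h q) (λ a → h (toℚ (M x (c a)))) ⟨
      h q * sum (λ a → h (toℚ (M x (c a))))
        ≈⟨ *-congˡ (trans (sym (h∘toℚ-sum (M x ∘ c))) (trans (reflexive (≡.cong (h ∘ toℚ) (zero-sum x))) h∘toℚ-0)) ⟩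
      h q * 0#
        ≈⟨ zeroʳ (h q) ⟩
      0#
        ∎)

-- The Littlewood-Richardson matrix

open import Data.Nat.Base using (_+_)

module ℝ-rational = Rational ℝ-commutativeRing fromℚ-homomorphism
module ℂ-rational = Rational ℂ-commutativeRing fromℚᶜ-homomorphism

infixr 2 _×-listing_

_×-listing_ : ∀ {X Y : Set} {m n} → Fin m ↠ X → Fin n ↠ Y → Fin (m ℕ.* n) ↠ (X × Y)
X ×-listing Y = (X ×-↠ Y) ↠-∘ ↔⇒↠ Fin.*↔×

0≤1 : CommutativeRing.0# ℝ-commutativeRing ≤ℝ CommutativeRing.1# ℝ-commutativeRing
0≤1 ε 0<ε = 0 , λ _ _ → ℚ.<-trans 0<ε (≡.subst (ℚ._< 1ℚ ℚ.+ ε) (ℚ.+-identityˡ ε) (ℚ.+-monoˡ-< ε (ℚ.positive⁻¹ 1ℚ)))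

module _ {A : Set} (_≟_ : DecidableEquality A) where
  open Words _≟_

  rational-rank : ∀ {I J : Set} {m n} → Fin m ↠ I → Fin n ↠ J → (M : I → J → ℤ) →
    MatrixRank.RankFactorization ℚ.+-*-commutativeRing (λ i j → toℚ (M i j))
  rational-rank I J M = MatrixRank.rankFactorization ℚ.+-*-commutativeRing ℚ-zero-or-unit I J λ i j → toℚ (M i j)

  open LinearAlgebra ℂ-commutativeRing
  open LinearMaps ℂ-commutativeRing using (≈-sum-cong; dimension-transfer)
  open Realizations ℂ-commutativeRing
  open Dimensions ℂ-commutativeRing
  private module ℂ = CommutativeRing ℂ-commutativeRing

  complex-rank : ∀ {I J : Set} (M : I → J → ℤ) →
    MatrixRank.RankFactorization ℚ.+-*-commutativeRing (λ i j → toℚ (M i j)) →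
    MatrixRank.RankFactorization ℂ-commutativeRing (λ i j → fromℤᶜ (M i j))
  complex-rank _ = BaseChange.rankFactorization-map ℚ.+-*-commutativeRing ℂ-commutativeRing fromℚᶜ-homomorphism

  module _ {n} (w₁ w₂ : Vec A n) where
    private
      column : Rearrangement w₂ → Rearrangement w₁ → ℂ.Carrier
      column s r = fromℤᶜ (young _≟_ w₁ w₂ r s)

      proj₁-linear : IsLinear (Representation.V (spechtModule _≟_ w₁ w₂)) (functions (Rearrangement w₁)) proj₁
      proj₁-linear = linear (Representation.V (spechtModule _≟_ w₁ w₂)) (functions (Rearrangement w₁))
        (λ f≈g → f≈g) (λ (f , _) (g , _) r → ℂ.refl {f r ℂ.+ g r}) (λ a (f , _) r → ℂ.refl {a ℂ.* f r})

      generator : Rearrangement w₂ → ∣ Representation.V (spechtModule _≟_ w₁ w₂) ∣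
      generator s = column s , 1 , (λ _ → s) , (λ _ → ℂ.1#) , λ r → let z = ℂ.1# ℂ.* column s r in
        ℂ.sym {z ℂ.+ ℂ.0#} {column s r}
          (ℂ.trans {z ℂ.+ ℂ.0#} {z} {column s r} (ℂ.+-identityʳ z) (ℂ.*-identityˡ (column s r)))

      spanned : SpannedImage (Representation.V (spechtModule _≟_ w₁ w₂)) proj₁ generator
      spanned (f , n , k , c , f≈) = n , k , c ,
        ≈-sum-cong (functions (Rearrangement w₁)) {f} {n} _ _ f≈
          (λ i r → ℂ.refl {c i ℂ.* column (k i) r})

      factorization : MatrixRank.RankFactorization ℂ-commutativeRing (λ r s → proj₁ (generator s) r)
      factorization = complex-rank (young _≟_ w₁ w₂)
        (rational-rank (rearrangements w₁) (rearrangements w₂) (young _≟_ w₁ w₂))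

    -- A vector of the Specht module is already a function on the rearrangements of `w₁`, so `ι`
    -- only forgets the witness of membership in the column span; `ι-span` is that witness.
    specht-realization : Realization (spechtModule _≟_ w₁ w₂) (Rearrangement w₁) (Rearrangement w₂)
                                     (λ σ r → Perm.flip σ • r)
    specht-realization = column-realization (spechtModule _≟_ w₁ w₂) {move = λ σ r → Perm.flip σ • r} {ι = proj₁} proj₁-linear
      (λ _ _ f≈g → f≈g) (λ σ (f , _) r → ℂ.refl {f (Perm.flip σ • r)})
      generator spanned factorization

  module _ {l m} (x₁ x₂ : Vec A l) (y₁ y₂ : Vec A m) (w₁ w₂ : Vec A (l + m)) where
    open LittlewoodRichardson _≟_ x₁ x₂ y₁ y₂ w₁ w₂

    module _ (F : MatrixRank.RankFactorization ℚ.+-*-commutativeRing (λ ρ c → toℚ (matrix ρ c))) where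
      open MatrixRank.RankFactorization F using (rank)

      -- Polytope and columns have the same linear span: a column is the convex combination with
      -- single weight 1, and a convex combination is a linear one.
      polytope-dimension : ∀ {n} .{{_ : ℕ.NonZero n}} (c : Fin n → Column) →
                           (∀ ρ → sumℤ (matrix ρ ∘ c) ≡ 0ℤ) → PolytopeHasDimension rank
      polytope-dimension c zero-sum = Dimensions.affineDimension ℝ-commutativeRing
        (BaseChange.rankFactorization-map ℚ.+-*-commutativeRing ℝ-commutativeRing fromℚ-homomorphism F)
        polytope columns (λ {f} → spanned {f}) (ℝ-rational.zero-in-hull matrix {polytope} columns c zero-sum)
        where
        module ℝ-ring = CommutativeRing ℝ-commutativeRing

        columns : ∀ c → polytope (λ ρ → fromℚ (toℚ (matrix ρ c)))
        columns c = 1 , (λ _ → c) , (λ _ → ℝ-ring.1#) , (λ _ → 0≤1) , ℝ-ring.+-identityʳ ℝ-ring.1# , λ ρ →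
          let z = ℝ-ring.1# ℝ-ring.* fromℤ (matrix ρ c) in
          ℝ-ring.sym {z ℝ-ring.+ ℝ-ring.0#} {fromℤ (matrix ρ c)}
            (ℝ-ring.trans {z ℝ-ring.+ ℝ-ring.0#} {z} {fromℤ (matrix ρ c)}
              (ℝ-ring.+-identityʳ z) (ℝ-ring.*-identityˡ (fromℤ (matrix ρ c))))

        spanned : ∀ {f} → polytope f → ℝ-linear.Span (ℝ-linear.functions Row) (λ c ρ → fromℚ (toℚ (matrix ρ c))) f
        spanned {f} (n , k , a , _ , _ , f≈) = n , k , a ,
          LinearMaps.≈-sum-cong ℝ-commutativeRing (ℝ-linear.functions Row) {f} {n} _ _ f≈
            (λ i ρ → ℝ-ring.refl {a i ℝ-ring.* fromℤ (matrix ρ (k i))})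

      private
        assocʳ : ∀ {X Y Z : Set} → (X × Y) × Z → X × Y × Z
        assocʳ ((x , y) , z) = x , y , z

        assocˡ : ∀ {X Y Z : Set} → X × Y × Z → (X × Y) × Z
        assocˡ (x , y , z) = (x , y) , z

        realization = ⊗-realization (⊠-realization (specht-realization x₁ x₂) (specht-realization y₁ y₂))
          (restrict-realization {Sym (l + m)} {DirectProduct.group (Sym l) (Sym m)} (∥-homomorphism l m)
            (specht-realization w₁ w₂))

        factorization : MatrixRank.RankFactorization ℂ-commutativeRing (λ ρ c → fromℤᶜ (matrix (assocʳ ρ) (assocʳ c)))
        factorization = rankFactorization-reindex {M = λ ρ c → fromℤᶜ (matrix ρ c)}
          assocʳ assocˡ assocʳ assocˡ (λ _ → ≡.refl) (λ _ → ≡.refl) (complex-rank matrix F)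

        element : Fin (l !) × Fin (m !) → Permutation′ l × Permutation′ m
        element (i , j) = permutationAt l i , permutationAt m j

        elementAt : Fin (l ! ℕ.* m !) → Permutation′ l × Permutation′ m
        elementAt = element ∘ remQuot (m !)

        matrix-elementAt : ∀ ρ c → sumℤ (λ k → youngProduct x₁ x₂ y₁ y₂ w₁ w₂ (moveRow x₁ x₂ y₁ y₂ w₁ w₂ (elementAt k) ρ) c) ≡ matrix ρ c
        matrix-elementAt ρ c = begin
          sumℤ (λ k → E (elementAt k))
            ≡⟨ sumℤ-remQuot {l !} {m !} (E ∘ element) ⟩
          sumℤ {l !} (λ i → sumℤ {m !} λ j → E (permutationAt l i , permutationAt m j))
            ≡⟨ sumℤ-cong {l !} (λ i → sumOverSym-at m λ τ → E (permutationAt l i , τ)) ⟨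
          sumℤ {l !} (λ i → ∑[ τ ∈Sym m ] E (permutationAt l i , τ))
            ≡⟨ sumOverSym-at l (λ σ → ∑[ τ ∈Sym m ] E (σ , τ)) ⟨
          ∑[ σ ∈Sym l ] ∑[ τ ∈Sym m ] E (σ , τ)
            ≡⟨ matrix-orbitSum x₁ x₂ y₁ y₂ w₁ w₂ ρ c ⟨
          matrix ρ c
            ∎
          where
          open ≡.≡-Reasoning
          E : Permutation′ l × Permutation′ m → ℤ
          E g = youngProduct x₁ x₂ y₁ y₂ w₁ w₂ (moveRow x₁ x₂ y₁ y₂ w₁ w₂ g ρ) c

        fromℤᶜ-product : ∀ i j k → (fromℤᶜ i ℂ.* fromℤᶜ j) ℂ.* fromℤᶜ k ℂ.≈ fromℤᶜ (i ℤ.* j ℤ.* k)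
        fromℤᶜ-product i j k = ℂ.trans
          {(fromℤᶜ i ℂ.* fromℤᶜ j) ℂ.* fromℤᶜ k} {fromℤᶜ (i ℤ.* j) ℂ.* fromℤᶜ k} {fromℤᶜ (i ℤ.* j ℤ.* k)}
          (ℂ.*-congʳ {fromℤᶜ k} {fromℤᶜ i ℂ.* fromℤᶜ j} {fromℤᶜ (i ℤ.* j)}
            (ℂ.sym {fromℤᶜ (i ℤ.* j)} {fromℤᶜ i ℂ.* fromℤᶜ j} (ℂ-rational.h∘toℚ-* i j)))
          (ℂ.sym {fromℤᶜ (i ℤ.* j ℤ.* k)} {fromℤᶜ (i ℤ.* j) ℂ.* fromℤᶜ k} (ℂ-rational.h∘toℚ-* (i ℤ.* j) k))

        rep₁ = (spechtModule _≟_ x₁ x₂ ⊠ spechtModule _≟_ y₁ y₂) ⊗ᴿ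
          restrict {Sym (l + m)} {DirectProduct.group (Sym l) (Sym m)} (∥-homomorphism l m) (spechtModule _≟_ w₁ w₂)

        rep₂ = (spechtModule _≟_ x₁ x₂ ⊠ spechtModule _≟_ y₁ y₂) ⊗ᴿ
          restrict (∥-homomorphism l m) (spechtModule _≟_ w₁ w₂)

        open TensorProduct (Representation.V (spechtModule _≟_ x₁ x₂ ⊠ spechtModule _≟_ y₁ y₂))
          (Representation.V (spechtModule _≟_ w₁ w₂)) using (Tensor; _⊗_; 𝟎; _⊕_; ⊖_; _≋_; ≋-refl; ⊕-cong; ⊖-cong; ≋-trans; ≋-sym)
          renaming (_·_ to _⊙_; ·-cong to ⊙-cong)

        acts-agree : ∀ g (t : Tensor) → Representation.act rep₂ g t ≋ Representation.act rep₁ g t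
        acts-agree g (x ⊗ y) = ≋-refl
        acts-agree g 𝟎       = ≋-refl
        acts-agree g (t ⊕ u) = ⊕-cong (acts-agree g t) (acts-agree g u)
        acts-agree g (⊖ t)   = ⊖-cong (acts-agree g t)
        acts-agree g (a ⊙ t) = ⊙-cong (ℂ.refl {a}) (acts-agree g t)

        -- U₂ is the space of `CoefficientEquals`. There the implicit group of `restrict`
        -- is elaborated to an η-expansion of Sym (l + m), and converting U₁ to U₂ as a
        -- whole is intractable, whereas the two actions agree on each tensor constructor.
        U₁ = invariants rep₁
        U₂ = invariants rep₂

        dimension-U₁⇒U₂ : HasDimension U₁ rank → HasDimension U₂ rank
        dimension-U₁⇒U₂ = dimension-transfer U₁ U₂
          (λ (t , t-invariant) → t , λ g → ≋-trans (acts-agree g t) (t-invariant g))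
          (λ t≋u → t≋u) (λ _ _ → ≋-refl) (λ _ _ → ≋-refl) (λ _ t≋0 → t≋0)
          (λ (t , t-invariant) → (t , λ g → ≋-trans (≋-sym (acts-agree g t)) (t-invariant g)) , ≋-refl)

      coefficient-equals : CoefficientEquals rank
      coefficient-equals = let q , q-total = equalWeights (l ! ℕ.* m !) {{l ℕ.!* m !≢0}} in
        dimension-U₁⇒U₂ (invariants-dimension realization factorization elementAt (fromℚᶜ q) (ℂ-rational.total-weight (l ! ℕ.* m !) q-total)
          -- A product of three Specht columns has integer values, products of Young characters, so
          -- its orbit sum can be evaluated in ℤ, where it is an entry of the matrix.
          (λ ((s , t) , u) ((p , q) , r) → ℂ-rational.sum-rational _
            (λ k → youngProduct x₁ x₂ y₁ y₂ w₁ w₂ (moveRow x₁ x₂ y₁ y₂ w₁ w₂ (elementAt k) (p , q , r)) (s , t , u))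
            (λ k → let σ , τ = elementAt k in fromℤᶜ-product
              (young _≟_ x₁ x₂ (Perm.flip σ • p) s) (young _≟_ y₁ y₂ (Perm.flip τ • q) t)
              (young _≟_ w₁ w₂ (Perm.flip (σ ∥ τ) • r) u))
            (matrix-elementAt (p , q , r) (s , t , u)))
          (λ g ρ c → ℂ.reflexive (≡.cong fromℤᶜ (matrix-invariant x₁ x₂ y₁ y₂ w₁ w₂ g (assocʳ ρ) (assocʳ c)))))

  -- Being a single column is decidable, so the negated conjunction yields a definite partition with
  -- a part above 1. The columns whose index varies in the second word of that pair then sum to
  -- zero.
  zero-sum-columns : ∀ {l m} (κ : Partition l) (μ : Partition m) (ν : Partition (l + m))
    (x₁ x₂ : Vec A l) (y₁ y₂ : Vec A m) (w₁ w₂ : Vec A (l + m)) →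
    Corresponds _≟_ x₁ x₂ κ → Corresponds _≟_ y₁ y₂ μ → Corresponds _≟_ w₁ w₂ ν →
    ¬ (SingleColumn κ × SingleColumn μ × SingleColumn ν) →
    let open LittlewoodRichardson _≟_ x₁ x₂ y₁ y₂ w₁ w₂ in
    ∃[ n ] Σ[ c ∈ (Fin n → Column) ] ℕ.NonZero n × (∀ ρ → sumℤ (matrix ρ ∘ c) ≡ 0ℤ)
  zero-sum-columns {l} {m} κ μ ν x₁ x₂ y₁ y₂ w₁ w₂ (x₁-κ , _) (y₁-μ , _) (w₁-ν , _) ¬single
    with All.all? (ℕ._≤? 1) (parts κ) | All.all? (ℕ._≤? 1) (parts μ) | All.all? (ℕ._≤? 1) (parts ν)
  ... | no ¬κ₁ | _ | _ = l ! , xColumns x₁ x₂ y₁ y₂ w₁ w₂ , (l ℕ.!≢0) ,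
    columns-sum-zero-x x₁ x₂ y₁ y₂ w₁ w₂ (repeatedLetter _≟_ κ x₁-κ ¬κ₁)
  ... | yes _ | no ¬μ₁ | _ = m ! , yColumns x₁ x₂ y₁ y₂ w₁ w₂ , (m ℕ.!≢0) ,
    columns-sum-zero-y x₁ x₂ y₁ y₂ w₁ w₂ (repeatedLetter _≟_ μ y₁-μ ¬μ₁)
  ... | yes _ | yes _ | no ¬ν₁ = (l + m) ! , wColumns x₁ x₂ y₁ y₂ w₁ w₂ , ((l + m) ℕ.!≢0) ,
    columns-sum-zero-w x₁ x₂ y₁ y₂ w₁ w₂ (repeatedLetter _≟_ ν w₁-ν ¬ν₁)
  ... | yes κ₁ | yes μ₁ | yes ν₁ = contradiction (κ₁ , μ₁ , ν₁) ¬single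

theorem7p6 : ∀ {A : Set} (_≟_ : DecidableEquality A) {l m : ℕ}
    (κ : Partition l) (μ : Partition m) (ν : Partition (l + m))
    (x₁ x₂ : Vec A l) (y₁ y₂ : Vec A m) (w₁ w₂ : Vec A (l + m)) →
    Complementary x₁ x₂ → Corresponds _≟_ x₁ x₂ κ →
    Complementary y₁ y₂ → Corresponds _≟_ y₁ y₂ μ →
    Complementary w₁ w₂ → Corresponds _≟_ w₁ w₂ ν →
    ¬ (SingleColumn κ × SingleColumn μ × SingleColumn ν) →
    let open LittlewoodRichardson _≟_ x₁ x₂ y₁ y₂ w₁ w₂ in
    ∃[ d ] (PolytopeHasDimension d × CoefficientEquals d)
theorem7p6 _≟_ κ μ ν x₁ x₂ y₁ y₂ w₁ w₂ _ x-κ _ y-μ _ w-ν ¬single =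
  MatrixRank.RankFactorization.rank F ,
  polytope-dimension _≟_ x₁ x₂ y₁ y₂ w₁ w₂ F {{nonZero}} columns zero-sum ,
  coefficient-equals _≟_ x₁ x₂ y₁ y₂ w₁ w₂ F
  where
  open LittlewoodRichardson _≟_ x₁ x₂ y₁ y₂ w₁ w₂ using (matrix)
  open Words _≟_ using (rearrangements)
  F : MatrixRank.RankFactorization ℚ.+-*-commutativeRing (λ ρ c → toℚ (matrix ρ c))
  F = rational-rank _≟_
    (rearrangements x₁ ×-listing rearrangements y₁ ×-listing rearrangements w₁)
    (rearrangements x₂ ×-listing rearrangements y₂ ×-listing rearrangements w₂) matrix
  family = zero-sum-columns _≟_ κ μ ν x₁ x₂ y₁ y₂ w₁ w₂ x-κ y-μ w-ν ¬single
  columns = proj₁ (proj₂ family)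
  nonZero = proj₁ (proj₂ (proj₂ family))
  zero-sum = proj₂ (proj₂ (proj₂ family))
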